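{- Let $1<a<b$ be coprime integers. For all $\mathbf{n},\mathbf{n}'\in C_{\mathbb{R}}$ we have $B(\mathbf{n},\mathbf{n}')\ge0$; in particular $Q(\mathbf{n})\ge0$ for $\mathbf{n}\in C_\mathbb{R}$. Moreover, for every $\mathbf{n}\in C_{\mathbb{R}}$, \[ Q(\mathbf{n})\ge \frac{1}{|G|}\,\|\mathbf{n}\|_\infty^2, \] where $\|\mathbf{n}\|_\infty=\max_{i\in G}|n_i|$.
   Context: Fix coprime integers $1<a<b$. Let $g:\mathbb{Z}^2\to\mathbb{Z}$, $g(x,y)=ab-ax-by$, and $G=\{(x,y)\in\mathbb{Z}_{\ge1}^2: g(x,y)>0\}$. Equip $G$ with the partial order $i\preceq j$ iff $g(j)-g(i)\in\{ma+nb: m,n\in\mathbb{Z}_{\ge0}\}$. Let \[ C_{\mathbb{R}}=\{\mathbf{n}=(n_i)_{i\in G}\in\mathbb{R}^G:\ n_i\ge0 \text{ for all } i,\ \ n_j\ge n_i \text{ whenever } i\preceq j\}. \] Define $K(d)=\mathbf{1}_{d\ge0}-\mathbf{1}_{d\ge a}-\mathbf{1}_{d\ge b}+\mathbf{1}_{d\ge a+b}$ for $d\in\mathbb{Z}$, the quadratic form $Q(\mathbf{n})=\sum_{i,j\in G}K(g(j)-g(i))\,n_in_j$ on $\mathbb{R}^G$, and the associated symmetric bilinear form \[ B(\mathbf{n},\mathbf{n}')=\tfrac12\sum_{i,j\in G}K(g(j)-g(i))\,(n_in'_j+n'_in_j), \] so that $B(\mathbf{n},\mathbf{n})=Q(\mathbf{n})$.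 -}

module Defs where

open import Data.Bool.Base using (if_then_else_)
open import Data.Integer.Base as ℤ using (ℤ; +_; -[1+_]; 0ℤ; 1ℤ)
import Data.Integer.Properties as ℤ
open import Data.Irrelevant using ([_])
open import Data.List.Base using (List; []; _∷_; map; foldr; length; mapMaybe; upTo; cartesianProduct)
open import Data.List.Membership.Propositional using (_∈_)
open import Data.List.Membership.Propositional.Properties using (∈-map⁺; ∈-upTo⁺; ∈-cartesianProduct⁺)
open import Data.List.Relation.Unary.All as All using (All; []; _∷_)
open import Data.List.Relation.Unary.AllPairs using ([]; _∷_)
open import Data.List.Relation.Unary.Any using (here; there)
open import Data.List.Relation.Unary.Unique.Propositional using (Unique)
import Data.List.Relation.Unary.Unique.Propositional.Properties as Unique
open import Data.Maybe.Base using (Maybe; just; nothing)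
open import Data.Nat.Base as ℕ using (ℕ; zero; suc; s≤s; z≤n)
import Data.Nat.Properties as ℕ
open import Data.Product.Base using (∃; ∃₂; _×_; _,_; proj₁; proj₂)
open import Data.Rational.Base as ℚ using (ℚ; 0ℚ; 1ℚ; ½)
import Data.Rational.Properties as ℚ
open import Data.Rational.Solver using (module +-*-Solver)
open import Data.Refinement using (Refinement-syntax; value; _,_)
open import Data.Sum.Base using (inj₁; inj₂)
open import Relation.Binary.PropositionalEquality
open import Relation.Nullary using (Dec; yes; no; does; contradiction-irr; _×-dec_)

-- The real numbers, as Cauchy sequences of rationals.  Two sequences denote
-- the same real number iff x ≤ℝ y and y ≤ℝ x; as the order alone is used
-- below, this equality is not introduced separately.

Cauchy : (ℕ → ℚ) → Set
Cauchy x = ∀ ε → 0ℚ ℚ.< ε → ∃ λ N → ∀ m n → N ℕ.≤ m → N ℕ.≤ n → ℚ.∣ x m ℚ.- x n ∣ ℚ.< ε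

record ℝ : Set where
  constructor mkℝ
  field
    seq    : ℕ → ℚ
    cauchy : Cauchy seq

open ℝ public

infix 4 _≤ℝ_

_≤ℝ_ : ℝ → ℝ → Set
x ≤ℝ y = ∀ ε → 0ℚ ℚ.< ε → ∃ λ N → ∀ n → N ℕ.≤ n → seq x n ℚ.≤ seq y n ℚ.+ ε

private
  half-sum : ∀ ε → ε ℚ.* ½ ℚ.+ ε ℚ.* ½ ≡ ε
  half-sum ε = trans (sym (ℚ.*-distribˡ-+ ε ½ ½)) (ℚ.*-identityʳ ε)

  half-pos : ∀ {ε} → 0ℚ ℚ.< ε → 0ℚ ℚ.< ε ℚ.* ½
  half-pos {ε} 0<ε = subst (ℚ._< ε ℚ.* ½) (ℚ.*-zeroˡ ½) (ℚ.*-monoˡ-<-pos ½ 0<ε)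

  p≤∣p∣ : ∀ p → p ℚ.≤ ℚ.∣ p ∣
  p≤∣p∣ p with ℚ.≤-total 0ℚ p
  ... | inj₁ 0≤p = ℚ.≤-reflexive (sym (ℚ.0≤p⇒∣p∣≡p 0≤p))
  ... | inj₂ p≤0 = ℚ.≤-trans p≤0 (ℚ.0≤∣p∣ p)

  ∣p∣≤ : ∀ {p q} → p ℚ.≤ q → ℚ.- p ℚ.≤ q → ℚ.∣ p ∣ ℚ.≤ q
  ∣p∣≤ {p} {q} p≤q -p≤q with ℚ.∣p∣≡p∨∣p∣≡-p p
  ... | inj₁ e = subst (ℚ._≤ q) (sym e) p≤q
  ... | inj₂ e = subst (ℚ._≤ q) (sym e) -p≤q

  -‿flip : ∀ p q → ℚ.- (p ℚ.- q) ≡ q ℚ.- p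
  -‿flip = solve 2 (λ p q → :- (p :- q) := q :- p) refl
    where open +-*-Solver

  ∣-∣-flip : ∀ p q → ℚ.∣ p ℚ.- q ∣ ≡ ℚ.∣ q ℚ.- p ∣
  ∣-∣-flip p q = trans (sym (ℚ.∣-p∣≡∣p∣ (p ℚ.- q))) (cong ℚ.∣_∣ (-‿flip p q))

  shift : ∀ {p q c} → p ℚ.≤ q ℚ.+ c → p ℚ.- q ℚ.≤ c
  shift {p} {q} {c} h = subst (p ℚ.- q ℚ.≤_) (lem q c) (ℚ.+-monoˡ-≤ (ℚ.- q) h)
    where
    open +-*-Solver
    lem : ∀ q c → q ℚ.+ c ℚ.- q ≡ c
    lem = solve 2 (λ q c → q :+ c :- q := c) refl

  unshift : ∀ p q → p ≡ q ℚ.+ (p ℚ.- q)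
  unshift = solve 2 (λ p q → p := q :+ (p :- q)) refl
    where open +-*-Solver

  p≤q+∣p-q∣ : ∀ p q → p ℚ.≤ q ℚ.+ ℚ.∣ p ℚ.- q ∣
  p≤q+∣p-q∣ p q = begin
    p                        ≡⟨ unshift p q ⟩
    q ℚ.+ (p ℚ.- q)          ≤⟨ ℚ.+-monoʳ-≤ q (p≤∣p∣ (p ℚ.- q)) ⟩
    q ℚ.+ ℚ.∣ p ℚ.- q ∣      ∎
    where open ℚ.≤-Reasoning

  ∣∣-lipschitz : ∀ p q → ℚ.∣ ℚ.∣ p ∣ ℚ.- ℚ.∣ q ∣ ∣ ℚ.≤ ℚ.∣ p ℚ.- q ∣
  ∣∣-lipschitz p q = ∣p∣≤ (half p q)
    (subst₂ ℚ._≤_ (sym (-‿flip ℚ.∣ p ∣ ℚ.∣ q ∣)) (∣-∣-flip q p) (half q p))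
    where
    half : ∀ p q → ℚ.∣ p ∣ ℚ.- ℚ.∣ q ∣ ℚ.≤ ℚ.∣ p ℚ.- q ∣
    half p q = shift (subst (λ r → ℚ.∣ r ∣ ℚ.≤ ℚ.∣ q ∣ ℚ.+ ℚ.∣ p ℚ.- q ∣)
                            (sym (unshift p q)) (ℚ.∣p+q∣≤∣p∣+∣q∣ q (p ℚ.- q)))

  ⊔-lipschitz : ∀ p q r s {ε} → ℚ.∣ p ℚ.- r ∣ ℚ.≤ ε → ℚ.∣ q ℚ.- s ∣ ℚ.≤ ε →
                ℚ.∣ (p ℚ.⊔ q) ℚ.- (r ℚ.⊔ s) ∣ ℚ.≤ ε
  ⊔-lipschitz p q r s {ε} h k = ∣p∣≤ (half p q r s h k)
    (subst (ℚ._≤ ε) (sym (-‿flip (p ℚ.⊔ q) (r ℚ.⊔ s)))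
      (half r s p q (subst (ℚ._≤ ε) (∣-∣-flip p r) h) (subst (ℚ._≤ ε) (∣-∣-flip q s) k)))
    where
    half : ∀ p q r s → ℚ.∣ p ℚ.- r ∣ ℚ.≤ ε → ℚ.∣ q ℚ.- s ∣ ℚ.≤ ε →
           (p ℚ.⊔ q) ℚ.- (r ℚ.⊔ s) ℚ.≤ ε
    half p q r s h k = shift (ℚ.⊔-lub
      (ℚ.≤-trans (p≤q+∣p-q∣ p r) (ℚ.+-mono-≤ (ℚ.p≤p⊔q r s) h))
      (ℚ.≤-trans (p≤q+∣p-q∣ q s) (ℚ.+-mono-≤ (ℚ.p≤q⊔p r s) k)))

  eventually-bounded : ∀ {x} → Cauchy x →
    ∃ λ M → 0ℚ ℚ.< M × ∃ λ N → ∀ n → N ℕ.≤ n → ℚ.∣ x n ∣ ℚ.≤ M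
  eventually-bounded {x} cx with cx 1ℚ (ℚ.positive⁻¹ 1ℚ)
  ... | N , close = ℚ.∣ x N ∣ ℚ.+ 1ℚ
                  , ℚ.+-mono-≤-< (ℚ.0≤∣p∣ (x N)) (ℚ.positive⁻¹ 1ℚ)
                  , N
                  , bound
    where
    open ℚ.≤-Reasoning
    bound : ∀ n → N ℕ.≤ n → ℚ.∣ x n ∣ ℚ.≤ ℚ.∣ x N ∣ ℚ.+ 1ℚ
    bound n N≤n = begin
      ℚ.∣ x n ∣                            ≡⟨ cong ℚ.∣_∣ (unshift (x n) (x N)) ⟩
      ℚ.∣ x N ℚ.+ (x n ℚ.- x N) ∣          ≤⟨ ℚ.∣p+q∣≤∣p∣+∣q∣ (x N) (x n ℚ.- x N) ⟩
      ℚ.∣ x N ∣ ℚ.+ ℚ.∣ x n ℚ.- x N ∣      ≤⟨ ℚ.+-monoʳ-≤ ℚ.∣ x N ∣ (ℚ.<⇒≤ (close n N N≤n ℕ.≤-refl)) ⟩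
      ℚ.∣ x N ∣ ℚ.+ 1ℚ                     ∎

  product-close : ∀ p q r s M K → ℚ.∣ q ∣ ℚ.≤ K → ℚ.∣ r ∣ ℚ.≤ M →
    ℚ.∣ p ℚ.* q ℚ.- r ℚ.* s ∣ ℚ.≤ ℚ.∣ p ℚ.- r ∣ ℚ.* K ℚ.+ ℚ.∣ q ℚ.- s ∣ ℚ.* M
  product-close p q r s M K q≤K r≤M = begin
    ℚ.∣ p ℚ.* q ℚ.- r ℚ.* s ∣
      ≡⟨ cong ℚ.∣_∣ (lem p q r s) ⟩
    ℚ.∣ (p ℚ.- r) ℚ.* q ℚ.+ (q ℚ.- s) ℚ.* r ∣
      ≤⟨ ℚ.∣p+q∣≤∣p∣+∣q∣ ((p ℚ.- r) ℚ.* q) ((q ℚ.- s) ℚ.* r) ⟩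
    ℚ.∣ (p ℚ.- r) ℚ.* q ∣ ℚ.+ ℚ.∣ (q ℚ.- s) ℚ.* r ∣
      ≡⟨ cong₂ ℚ._+_ (ℚ.∣p*q∣≡∣p∣*∣q∣ (p ℚ.- r) q) (ℚ.∣p*q∣≡∣p∣*∣q∣ (q ℚ.- s) r) ⟩
    ℚ.∣ p ℚ.- r ∣ ℚ.* ℚ.∣ q ∣ ℚ.+ ℚ.∣ q ℚ.- s ∣ ℚ.* ℚ.∣ r ∣
      ≤⟨ ℚ.+-mono-≤ (ℚ.*-monoˡ-≤-nonNeg ℚ.∣ p ℚ.- r ∣ {{ℚ.∣-∣-nonNeg (p ℚ.- r)}} q≤K)
                    (ℚ.*-monoˡ-≤-nonNeg ℚ.∣ q ℚ.- s ∣ {{ℚ.∣-∣-nonNeg (q ℚ.- s)}} r≤M) ⟩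
    ℚ.∣ p ℚ.- r ∣ ℚ.* K ℚ.+ ℚ.∣ q ℚ.- s ∣ ℚ.* M
      ∎
    where
    open ℚ.≤-Reasoning
    lem : ∀ p q r s → p ℚ.* q ℚ.- r ℚ.* s ≡ (p ℚ.- r) ℚ.* q ℚ.+ (q ℚ.- s) ℚ.* r
    lem = solve 4 (λ p q r s → p :* q :- r :* s := (p :- r) :* q :+ (q :- s) :* r) refl
      where open +-*-Solver

  scale : ∀ {ε M} → 0ℚ ℚ.< ε → 0ℚ ℚ.< M → ∃ λ δ → 0ℚ ℚ.< δ × δ ℚ.* M ≡ ε ℚ.* ½
  scale {ε} {M} 0<ε 0<M = ε ℚ.* ½ ℚ.* M⁻¹ , δ>0 , δM
    where
    instance
      M-pos : ℚ.Positive M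
      M-pos = ℚ.positive 0<M
      M-nonZero : ℚ.NonZero M
      M-nonZero = ℚ.pos⇒nonZero M
    M⁻¹ : ℚ
    M⁻¹ = ℚ.1/ M
    δ>0 : 0ℚ ℚ.< ε ℚ.* ½ ℚ.* M⁻¹
    δ>0 = subst (ℚ._< ε ℚ.* ½ ℚ.* M⁻¹) (ℚ.*-zeroˡ M⁻¹)
            (ℚ.*-monoˡ-<-pos M⁻¹ {{ℚ.1/pos⇒pos M}} (half-pos 0<ε))
    δM : ε ℚ.* ½ ℚ.* M⁻¹ ℚ.* M ≡ ε ℚ.* ½
    δM = trans (ℚ.*-assoc (ε ℚ.* ½) M⁻¹ M)
           (trans (cong (ε ℚ.* ½ ℚ.*_) (ℚ.*-inverseˡ M)) (ℚ.*-identityʳ (ε ℚ.* ½)))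

  ⊔-≤ˡ : ∀ {k l m} → k ℕ.⊔ l ℕ.≤ m → k ℕ.≤ m
  ⊔-≤ˡ {k} {l} = ℕ.≤-trans (ℕ.m≤m⊔n k l)

  ⊔-≤ʳ : ∀ {k l m} → k ℕ.⊔ l ℕ.≤ m → l ℕ.≤ m
  ⊔-≤ʳ {k} {l} = ℕ.≤-trans (ℕ.m≤n⊔m k l)

  +-cauchy : ∀ {x y} → Cauchy x → Cauchy y → Cauchy (λ n → x n ℚ.+ y n)
  +-cauchy {x} {y} cx cy ε 0<ε
    with Nx , hx ← cx (ε ℚ.* ½) (half-pos 0<ε) | Ny , hy ← cy (ε ℚ.* ½) (half-pos 0<ε)
    = Nx ℕ.⊔ Ny , λ m n N≤m N≤n → begin-strict
      ℚ.∣ (x m ℚ.+ y m) ℚ.- (x n ℚ.+ y n) ∣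
        ≡⟨ cong ℚ.∣_∣ (lem (x m) (y m) (x n) (y n)) ⟩
      ℚ.∣ (x m ℚ.- x n) ℚ.+ (y m ℚ.- y n) ∣
        ≤⟨ ℚ.∣p+q∣≤∣p∣+∣q∣ (x m ℚ.- x n) (y m ℚ.- y n) ⟩
      ℚ.∣ x m ℚ.- x n ∣ ℚ.+ ℚ.∣ y m ℚ.- y n ∣
        <⟨ ℚ.+-mono-< (hx m n (⊔-≤ˡ N≤m) (⊔-≤ˡ N≤n))
                      (hy m n (⊔-≤ʳ {Nx} N≤m) (⊔-≤ʳ {Nx} N≤n)) ⟩
      ε ℚ.* ½ ℚ.+ ε ℚ.* ½
        ≡⟨ half-sum ε ⟩
      ε ∎
    where
    open ℚ.≤-Reasoning
    lem : ∀ p q r s → (p ℚ.+ q) ℚ.- (r ℚ.+ s) ≡ (p ℚ.- r) ℚ.+ (q ℚ.- s)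
    lem = solve 4 (λ p q r s → (p :+ q) :- (r :+ s) := (p :- r) :+ (q :- s)) refl
      where open +-*-Solver

  *-cauchy : ∀ {x y} → Cauchy x → Cauchy y → Cauchy (λ n → x n ℚ.* y n)
  *-cauchy {x} {y} cx cy ε 0<ε =
    let M , M>0 , N₁ , bx = eventually-bounded {x} cx
        K , K>0 , N₂ , by = eventually-bounded {y} cy
        δ₁ , δ₁>0 , e₁ = scale {ε} {K} 0<ε K>0
        δ₂ , δ₂>0 , e₂ = scale {ε} {M} 0<ε M>0
        N₃ , hx = cx δ₁ δ₁>0
        N₄ , hy = cy δ₂ δ₂>0
    in (N₁ ℕ.⊔ N₂) ℕ.⊔ (N₃ ℕ.⊔ N₄) , λ m n N≤m N≤n →
      close M K δ₁ δ₂ M>0 K>0 e₁ e₂ m n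
        (bx n (⊔-≤ˡ {N₁} (⊔-≤ˡ {N₁ ℕ.⊔ N₂} N≤n)))
        (by m (⊔-≤ʳ {N₁} (⊔-≤ˡ {N₁ ℕ.⊔ N₂} N≤m)))
        (hx m n (⊔-≤ˡ {N₃} (⊔-≤ʳ {N₁ ℕ.⊔ N₂} N≤m)) (⊔-≤ˡ {N₃} (⊔-≤ʳ {N₁ ℕ.⊔ N₂} N≤n)))
        (hy m n (⊔-≤ʳ {N₃} (⊔-≤ʳ {N₁ ℕ.⊔ N₂} N≤m)) (⊔-≤ʳ {N₃} (⊔-≤ʳ {N₁ ℕ.⊔ N₂} N≤n)))
    where
    open ℚ.≤-Reasoning
    close : ∀ M K δ₁ δ₂ → 0ℚ ℚ.< M → 0ℚ ℚ.< K →
      δ₁ ℚ.* K ≡ ε ℚ.* ½ → δ₂ ℚ.* M ≡ ε ℚ.* ½ → ∀ m n →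
      ℚ.∣ x n ∣ ℚ.≤ M → ℚ.∣ y m ∣ ℚ.≤ K →
      ℚ.∣ x m ℚ.- x n ∣ ℚ.< δ₁ → ℚ.∣ y m ℚ.- y n ∣ ℚ.< δ₂ →
      ℚ.∣ x m ℚ.* y m ℚ.- x n ℚ.* y n ∣ ℚ.< ε
    close M K δ₁ δ₂ M>0 K>0 e₁ e₂ m n xn≤M ym≤K hx hy = begin-strict
      ℚ.∣ x m ℚ.* y m ℚ.- x n ℚ.* y n ∣
        ≤⟨ product-close (x m) (y m) (x n) (y n) M K ym≤K xn≤M ⟩
      ℚ.∣ x m ℚ.- x n ∣ ℚ.* K ℚ.+ ℚ.∣ y m ℚ.- y n ∣ ℚ.* M
        <⟨ ℚ.+-mono-< (ℚ.*-monoˡ-<-pos K {{ℚ.positive K>0}} hx)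
                      (ℚ.*-monoˡ-<-pos M {{ℚ.positive M>0}} hy) ⟩
      δ₁ ℚ.* K ℚ.+ δ₂ ℚ.* M
        ≡⟨ cong₂ ℚ._+_ e₁ e₂ ⟩
      ε ℚ.* ½ ℚ.+ ε ℚ.* ½
        ≡⟨ half-sum ε ⟩
      ε ∎

  ⊔-cauchy : ∀ {x y} → Cauchy x → Cauchy y → Cauchy (λ n → x n ℚ.⊔ y n)
  ⊔-cauchy {x} {y} cx cy ε 0<ε
    with Nx , hx ← cx (ε ℚ.* ½) (half-pos 0<ε) | Ny , hy ← cy (ε ℚ.* ½) (half-pos 0<ε)
    = Nx ℕ.⊔ Ny , λ m n N≤m N≤n → ℚ.≤-<-trans
        (⊔-lipschitz (x m) (y m) (x n) (y n)
          (ℚ.<⇒≤ (hx m n (⊔-≤ˡ N≤m) (⊔-≤ˡ N≤n)))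
          (ℚ.<⇒≤ (hy m n (⊔-≤ʳ {Nx} N≤m) (⊔-≤ʳ {Nx} N≤n))))
        half<
    where
    half< : ε ℚ.* ½ ℚ.< ε
    half< = subst₂ ℚ._<_ (ℚ.+-identityʳ (ε ℚ.* ½)) (half-sum ε)
              (ℚ.+-monoʳ-< (ε ℚ.* ½) (half-pos 0<ε))

  ∣∣-cauchy : ∀ {x} → Cauchy x → Cauchy (λ n → ℚ.∣ x n ∣)
  ∣∣-cauchy {x} cx ε 0<ε with N , h ← cx ε 0<ε
    = N , λ m n N≤m N≤n → ℚ.≤-<-trans (∣∣-lipschitz (x m) (x n)) (h m n N≤m N≤n)

  const-cauchy : ∀ q → Cauchy (λ _ → q)
  const-cauchy q ε 0<ε = 0 , λ _ _ _ _ →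
    subst (ℚ._< ε) (cong ℚ.∣_∣ (sym (ℚ.+-inverseʳ q))) 0<ε

fromℚ : ℚ → ℝ
fromℚ q = mkℝ (λ _ → q) (const-cauchy q)

fromℤ : ℤ → ℝ
fromℤ k = fromℚ (k ℚ./ 1)

0ℝ : ℝ
0ℝ = fromℚ 0ℚ

infixl 6 _+ℝ_
infixl 7 _*ℝ_
infixl 6 _⊔ℝ_

_+ℝ_ : ℝ → ℝ → ℝ
x +ℝ y = mkℝ (λ n → seq x n ℚ.+ seq y n) (+-cauchy {seq x} {seq y} (cauchy x) (cauchy y))

_*ℝ_ : ℝ → ℝ → ℝ
x *ℝ y = mkℝ (λ n → seq x n ℚ.* seq y n) (*-cauchy {seq x} {seq y} (cauchy x) (cauchy y))

_⊔ℝ_ : ℝ → ℝ → ℝ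
x ⊔ℝ y = mkℝ (λ n → seq x n ℚ.⊔ seq y n) (⊔-cauchy {seq x} {seq y} (cauchy x) (cauchy y))

∣_∣ℝ : ℝ → ℝ
∣ x ∣ℝ = mkℝ (λ n → ℚ.∣ seq x n ∣) (∣∣-cauchy {seq x} (cauchy x))

module _ (a b : ℕ) where

  g : ℤ × ℤ → ℤ
  g (x , y) = + a ℤ.* + b ℤ.- + a ℤ.* x ℤ.- + b ℤ.* y

  InG : ℤ × ℤ → Set
  InG (x , y) = 1ℤ ℤ.≤ x × 1ℤ ℤ.≤ y × 0ℤ ℤ.< g (x , y)

  InG? : ∀ p → Dec (InG p)
  InG? (x , y) = 1ℤ ℤ.≤? x ×-dec 1ℤ ℤ.≤? y ×-dec 0ℤ ℤ.<? g (x , y)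

  G : Set
  G = [ p ∈ ℤ × ℤ ∣ InG p ]

  gᴳ : G → ℤ
  gᴳ i = g (value i)

  _⪯_ : G → G → Set
  i ⪯ j = ∃₂ λ (m n : ℕ) → gᴳ j ℤ.- gᴳ i ≡ + m ℤ.* + a ℤ.+ + n ℤ.* + b

  toG : ℤ × ℤ → Maybe G
  toG p with InG? p
  ... | yes p∈G = just (p , [ p∈G ])
  ... | no  _   = nothing

  candidates : List (ℤ × ℤ)
  candidates = cartesianProduct (map +_ (upTo b)) (map +_ (upTo a))

  -- g (x , y) > 0 forces x < b and y < a.  The list contains every element
  -- of G (∈-elements) exactly once (elements-unique).
  elements : List G
  elements = mapMaybe toG candidates

  private
    ∈-mapMaybe-toG : ∀ (i : G) ps → value i ∈ ps → i ∈ mapMaybe toG ps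
    ∈-mapMaybe-toG (p , [ pf ]) (_ ∷ ps) (here refl) with InG? p
    ... | yes _   = here refl
    ... | no  p∉G = contradiction-irr pf p∉G
    ∈-mapMaybe-toG i (q ∷ ps) (there i∈ps) with InG? q
    ... | yes _ = there (∈-mapMaybe-toG i ps i∈ps)
    ... | no  _ = ∈-mapMaybe-toG i ps i∈ps

    mapMaybe-toG-fresh : ∀ (i : G) ps → All (value i ≢_) ps → All (i ≢_) (mapMaybe toG ps)
    mapMaybe-toG-fresh i []       []           = []
    mapMaybe-toG-fresh i (q ∷ ps) (p≢q ∷ p∉ps) with InG? q
    ... | yes _ = (λ e → p≢q (cong value e)) ∷ mapMaybe-toG-fresh i ps p∉ps
    ... | no  _ = mapMaybe-toG-fresh i ps p∉ps

    mapMaybe-toG-unique : ∀ ps → Unique ps → Unique (mapMaybe toG ps)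
    mapMaybe-toG-unique []       []         = []
    mapMaybe-toG-unique (p ∷ ps) (p∉ps ∷ u) with InG? p
    ... | yes p∈G = mapMaybe-toG-fresh (p , [ p∈G ]) ps p∉ps ∷ mapMaybe-toG-unique ps u
    ... | no  _   = mapMaybe-toG-unique ps u

    diff≤0 : ∀ {k l m} → k ℤ.≤ l → 0ℤ ℤ.≤ m → k ℤ.- l ℤ.- m ℤ.≤ 0ℤ
    diff≤0 k≤l 0≤m = ℤ.+-mono-≤ (ℤ.i≤j⇒i-j≤0 k≤l) (ℤ.neg-mono-≤ 0≤m)

    nonNeg* : ∀ k l → 0ℤ ℤ.≤ + k ℤ.* + l
    nonNeg* k l = subst (0ℤ ℤ.≤_) (ℤ.pos-* k l) (ℤ.+≤+ z≤n)

    swap : ∀ k l m → k ℤ.- l ℤ.- m ≡ k ℤ.- m ℤ.- l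
    swap k l m = trans (ℤ.+-assoc k (ℤ.- l) (ℤ.- m))
      (trans (cong (λ z → k ℤ.+ z) (ℤ.+-comm (ℤ.- l) (ℤ.- m))) (sym (ℤ.+-assoc k (ℤ.- m) (ℤ.- l))))

    x<b : ∀ x y → InG (+ x , + y) → x ℕ.< b
    x<b x y (_ , _ , g>0) = ℕ.≰⇒> λ b≤x → ℤ.<⇒≱ g>0
      (diff≤0 (ℤ.*-monoˡ-≤-nonNeg (+ a) (ℤ.+≤+ b≤x)) (nonNeg* b y))

    y<a : ∀ x y → InG (+ x , + y) → y ℕ.< a
    y<a x y (_ , _ , g>0) = ℕ.≰⇒> λ a≤y → ℤ.<⇒≱ g>0
      (subst (ℤ._≤ 0ℤ) (sym (swap (+ a ℤ.* + b) (+ a ℤ.* + x) (+ b ℤ.* + y)))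
        (diff≤0 (subst (ℤ._≤ + b ℤ.* + y) (ℤ.*-comm (+ b) (+ a))
                  (ℤ.*-monoˡ-≤-nonNeg (+ b) (ℤ.+≤+ a≤y)))
                (nonNeg* a x)))

    ∈-candidates : ∀ p → InG p → p ∈ candidates
    ∈-candidates (+ x , + y) h = ∈-cartesianProduct⁺
      (∈-map⁺ +_ (∈-upTo⁺ (x<b x y h))) (∈-map⁺ +_ (∈-upTo⁺ (y<a x y h)))
    ∈-candidates (+ _ , -[1+ _ ]) (_ , () , _)
    ∈-candidates (-[1+ _ ] , _)   (() , _)

  ∈-elements : ∀ i → i ∈ elements
  ∈-elements i@(p , [ pf ]) with InG? p
  ... | yes p∈G = ∈-mapMaybe-toG i candidates (∈-candidates p p∈G)
  ... | no  p∉G = contradiction-irr pf p∉G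

  elements-unique : Unique elements
  elements-unique = mapMaybe-toG-unique candidates
    (Unique.cartesianProduct⁺ (Unique.map⁺ ℤ.+-injective (Unique.upTo⁺ b))
                              (Unique.map⁺ ℤ.+-injective (Unique.upTo⁺ a)))

  ∣G∣ : ℕ
  ∣G∣ = length elements

  private
    1,1∈G : 1 ℕ.< a → a ℕ.< b → InG (1ℤ , 1ℤ)
    1,1∈G 1<a a<b = ℤ.≤-refl , ℤ.≤-refl , subst (0ℤ ℤ.<_) (sym eq) (ℤ.+<+ (ℕ.m<n⇒0<n∸m a+b<ab))
      where
      a+b<ab : a ℕ.+ b ℕ.< a ℕ.* b
      a+b<ab = begin-strict
        a ℕ.+ b          <⟨ ℕ.+-monoˡ-< b a<b ⟩
        b ℕ.+ b          ≡⟨ cong (b ℕ.+_) (ℕ.+-identityʳ b) ⟨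
        2 ℕ.* b          ≤⟨ ℕ.*-monoˡ-≤ b 1<a ⟩
        a ℕ.* b          ∎
        where open ℕ.≤-Reasoning
      eq : g (1ℤ , 1ℤ) ≡ + (a ℕ.* b ℕ.∸ (a ℕ.+ b))
      eq = begin
        + a ℤ.* + b ℤ.- + a ℤ.* 1ℤ ℤ.- + b ℤ.* 1ℤ
          ≡⟨ cong₂ (λ u v → + a ℤ.* + b ℤ.- u ℤ.- v) (ℤ.*-identityʳ (+ a)) (ℤ.*-identityʳ (+ b)) ⟩
        + a ℤ.* + b ℤ.- + a ℤ.- + b
          ≡⟨ ℤ.+-assoc (+ a ℤ.* + b) (ℤ.- + a) (ℤ.- + b) ⟩
        + a ℤ.* + b ℤ.+ (ℤ.- + a ℤ.- + b)
          ≡⟨ cong₂ ℤ._+_ (sym (ℤ.pos-* a b)) (sym (ℤ.neg-distrib-+ (+ a) (+ b))) ⟩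
        + (a ℕ.* b) ℤ.- + (a ℕ.+ b)
          ≡⟨ ℤ.m-n≡m⊖n (a ℕ.* b) (a ℕ.+ b) ⟩
        a ℕ.* b ℤ.⊖ (a ℕ.+ b)
          ≡⟨ ℤ.⊖-≥ (ℕ.<⇒≤ a+b<ab) ⟩
        + (a ℕ.* b ℕ.∸ (a ℕ.+ b)) ∎
        where open ≡-Reasoning

    ∈⇒nonZero : ∀ {A : Set} {x : A} {xs} → x ∈ xs → ℕ.NonZero (length xs)
    ∈⇒nonZero (here _)  = _
    ∈⇒nonZero (there _) = _

  ∣G∣-nonZero : 1 ℕ.< a → a ℕ.< b → ℕ.NonZero ∣G∣
  ∣G∣-nonZero 1<a a<b = ∈⇒nonZero (∈-elements ((1ℤ , 1ℤ) , [ 1,1∈G 1<a a<b ]))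

  1/∣G∣ : 1 ℕ.< a → a ℕ.< b → ℝ
  1/∣G∣ 1<a a<b = fromℚ ((1ℤ ℚ./ ∣G∣) {{∣G∣-nonZero 1<a a<b}})

  ℝᴳ : Set
  ℝᴳ = G → ℝ

  ΣG : (G → ℝ) → ℝ
  ΣG f = foldr _+ℝ_ 0ℝ (map f elements)

  Cone : ℝᴳ → Set
  Cone n = (∀ i → 0ℝ ≤ℝ n i) × (∀ i j → i ⪯ j → n i ≤ℝ n j)

  𝟏[_≥_] : ℤ → ℤ → ℤ
  𝟏[ d ≥ c ] = if does (c ℤ.≤? d) then 1ℤ else 0ℤ

  K : ℤ → ℤ
  K d = 𝟏[ d ≥ 0ℤ ] ℤ.- 𝟏[ d ≥ + a ] ℤ.- 𝟏[ d ≥ + b ] ℤ.+ 𝟏[ d ≥ + a ℤ.+ + b ]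

  Q : ℝᴳ → ℝ
  Q n = ΣG λ i → ΣG λ j → fromℤ (K (gᴳ j ℤ.- gᴳ i)) *ℝ n i *ℝ n j

  B : ℝᴳ → ℝᴳ → ℝ
  B n n′ = fromℚ ½ *ℝ ΣG λ i → ΣG λ j →
    fromℤ (K (gᴳ j ℤ.- gᴳ i)) *ℝ (n i *ℝ n′ j +ℝ n′ i *ℝ n j)

  -- Starting the maximum at 0 does not change it, since all entries are ≥ 0
  -- and G is nonempty.
  ‖_‖∞ : ℝᴳ → ℝ
  ‖ n ‖∞ = foldr _⊔ℝ_ 0ℝ (map (λ i → ∣ n i ∣ℝ) elements)

{-# OPTIONS --safe #-}
module Submission where

-- Let S = ⟨a , b⟩.  The heights of the elements of G are the gaps of S, and ⪯ is the
-- coordinatewise order reversed.  So a family n in the cone, with largest entry M (at (1 , 1)),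
-- extends to a function N on ℤ that is 0 below 0, equal to M on S, and nondecreasing under
-- z ↦ z + a and z ↦ z + b.  Its superlevel sets are bounded by lattice paths from (0 , a) to
-- (b , 0), continued periodically, with vertical and horizontal steps recorded by
-- α z = N z - N (z - a) and β z = N z - N (z - b), and
--
--   X t = Σ_z α z · β′ (z + t)
--
-- counts the crossings of the paths of n with those of n′ translated to relative height t.
-- Telescoping gives 2 B(n , n′) = Σ_{-a < t < b} (X t - M M′).  Each path passes through
-- (0 , a), of height 0, and stays at heights ≥ 0, so for each such t they do cross: X t ≥ M M′.
--
-- For n = n′ the terms t = 0 and t = b - a agree, whence Q(n) ≥ X 0 - M² ≥ Σ_G α β.  Descending
-- from (1 , 1) along the neighbour with the larger entry shows Σ_G min(α , β) ≥ M, and the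
-- Cauchy-Schwarz inequality finishes.
--
-- This is carried out for integer families, hence holds for rational ones.  Real families
-- are approximated by rational r which satisfy the cone inequalities up to ε; adding ε (1 + g)
-- repairs them exactly.

open import Algebra.Structures using (IsCommutativeRing)
open import Data.Bool.Base using (if_then_else_)
open import Data.Integer.Base as ℤ using (ℤ; +_; -[1+_]; 0ℤ; 1ℤ; _+_; _*_; _-_; -_; _≤_; +≤+)
import Data.Integer.Coprimality as ℤ
import Data.Integer.DivMod as ℤ
open import Data.Integer.Divisibility.Signed
  using (_∣_; divides; _∣?_; ∣ᵤ⇒∣; ∣⇒∣ᵤ; ∣m∣n⇒∣m+n; ∣m∣n⇒∣m-n; ∣m⇒∣-m; ∣n⇒∣m*n; ∣m⇒∣m*n; ∣-refl)
import Data.Integer.Properties as ℤ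
open import Data.Integer.Tactic.RingSolver using (solve-∀)
open import Data.Irrelevant using ([_])
open import Data.List.Base using (List; []; _∷_; _∷ʳ_; map; foldr; length; upTo)
open import Data.List.Membership.Propositional using (_∈_)
open import Data.List.Membership.Propositional.Properties using (∈-upTo⁺; ∈-upTo⁻)
open import Data.List.Properties using (length-upTo)
import Data.List.Properties as List
import Data.List.Relation.Unary.All as All
open import Data.List.Relation.Unary.AllPairs using (_∷_)
open import Data.List.Relation.Unary.Any using (here; there)
open import Data.List.Relation.Unary.Unique.Propositional using (Unique)
import Data.List.Relation.Unary.Unique.Propositional.Properties as Unique
open import Data.Nat.Base as ℕ using (ℕ; zero; suc; s≤s; z≤n; _<_)
open import Data.Nat.Coprimality using (Coprime; coprime-Bézout)
import Data.Nat.Coprimality as ℕ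
import Data.Nat.DivMod as ℕ
open import Data.Nat.GCD using (module Bézout)
import Data.Nat.Properties as ℕ
open import Data.Product.Base using (_×_; _,_; ∃; ∃₂; proj₁; proj₂)
open import Data.Rational.Base as ℚ using (ℚ; mkℚ; 0ℚ; 1ℚ; ½)
import Data.Rational.Properties as ℚ
open import Data.Rational.Solver using (module +-*-Solver)
open import Data.Rational.Unnormalised.Base as ℚᵘ using (mkℚᵘ)
import Data.Rational.Unnormalised.Properties as ℚᵘ
open import Data.Refinement using (value; _,_)
open import Data.Sum.Base using (_⊎_; inj₁; inj₂)
open import Defs
open import Function.Base using (_∘_)
open import Relation.Binary.PropositionalEquality
open import Relation.Nullary using (Dec; yes; no; does; ¬_; contradiction; recompute; _×-dec_)
open import Relation.Nullary.Decidable using (dec-true; dec-false)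

-- `B` only sees `K d + K (- d)`, which is the double difference `Λ` of the indicator `W` of
-- `- a < d < b`. Summation by parts with `α` and `β` applies the same `Λ` to a kernel, and this
-- fixes the range of `t`. Since `N` stays at `M` on the semigroup, a boundary contribution is left
-- over: `M M′` times the number of pairs `k < a`, `l < b` with `- a < l a - k b < b`. There are
-- `a + b - 1` of these, as many as there are values of `t`, so exactly one `M M′` is charged to
-- each `X t`. Integrality enters in the lower bound for `X t`: the families have `M` and `M′`
-- superlevel sets, and every pair of them contributes a crossing. The crossing is found by
-- arithmetic modulo `a` or `b`, not by topology of paths. In the quadratic bound the two equal
-- excesses, at distinct heights because `a < b`, make up for the factor ½ in `B`; the factor
-- `1 / |G|` is the one of Cauchy-Schwarz over `G`. The repair by `ε (1 + g)` is forced by the order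
-- on the reals: it controls late terms of the sequences only up to ε, so these terms need not lie
-- in the cone.

-- Finite sums in a commutative ring, for use over ℤ and ℚ.

module Summation {R : Set} {add mul : R → R → R} {neg : R → R} {0# 1# : R}
                 (isRing : IsCommutativeRing _≡_ add mul neg 0# 1#) where
  open IsCommutativeRing isRing using (+-identityˡ; +-assoc; +-comm; zeroʳ; distribˡ)
  open ≡-Reasoning

  private variable I I′ : Set

  ∑ : List I → (I → R) → R
  ∑ xs f = foldr add 0# (map f xs)

  ∑-cong∈ : (xs : List I) {f h : I → R} → (∀ {x} → x ∈ xs → f x ≡ h x) → ∑ xs f ≡ ∑ xs h
  ∑-cong∈ []       e = refl
  ∑-cong∈ (x ∷ xs) e = cong₂ add (e (here refl)) (∑-cong∈ xs (e ∘ there))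

  ∑-cong : (xs : List I) {f h : I → R} → (∀ x → f x ≡ h x) → ∑ xs f ≡ ∑ xs h
  ∑-cong xs e = ∑-cong∈ xs (λ {x} _ → e x)

  ∑-zero : (xs : List I) {f : I → R} → (∀ {x} → x ∈ xs → f x ≡ 0#) → ∑ xs f ≡ 0#
  ∑-zero []       e = refl
  ∑-zero (x ∷ xs) e = trans (cong₂ add (e (here refl)) (∑-zero xs (e ∘ there))) (+-identityˡ 0#)

  private
    interchange : ∀ p q r s → add (add p q) (add r s) ≡ add (add p r) (add q s)
    interchange p q r s = begin
      add (add p q) (add r s)  ≡⟨ +-assoc p q (add r s) ⟩
      add p (add q (add r s))  ≡⟨ cong (add p) (+-assoc q r s) ⟨
      add p (add (add q r) s)  ≡⟨ cong (λ u → add p (add u s)) (+-comm q r) ⟩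
      add p (add (add r q) s)  ≡⟨ cong (add p) (+-assoc r q s) ⟩
      add p (add r (add q s))  ≡⟨ +-assoc p r (add q s) ⟨
      add (add p r) (add q s)  ∎

  ∑-+ : (xs : List I) (f h : I → R) → ∑ xs (λ x → add (f x) (h x)) ≡ add (∑ xs f) (∑ xs h)
  ∑-+ []       f h = sym (+-identityˡ 0#)
  ∑-+ (x ∷ xs) f h = trans (cong (add (add (f x) (h x))) (∑-+ xs f h)) (interchange (f x) (h x) _ _)

  ∑-*ˡ : (xs : List I) (c : R) (f : I → R) → ∑ xs (λ x → mul c (f x)) ≡ mul c (∑ xs f)
  ∑-*ˡ []       c f = sym (zeroʳ c)
  ∑-*ˡ (x ∷ xs) c f = trans (cong (add (mul c (f x))) (∑-*ˡ xs c f)) (sym (distribˡ c (f x) _))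

  ∑-swap : (xs : List I) (ys : List I′) (f : I → I′ → R) →
           ∑ xs (λ x → ∑ ys (f x)) ≡ ∑ ys (λ y → ∑ xs (λ x → f x y))
  ∑-swap []       ys f = sym (∑-zero ys (λ _ → refl))
  ∑-swap (x ∷ xs) ys f = trans (cong (add (∑ ys (f x))) (∑-swap xs ys f)) (sym (∑-+ ys (f x) _))

open Summation ℤ.+-*-isCommutativeRing
open Summation ℚ.+-*-isCommutativeRing using ()
  renaming (∑ to ∑ℚ; ∑-cong to ∑ℚ-cong; ∑-+ to ∑ℚ-+; ∑-*ˡ to ∑ℚ-*ˡ)

-- Integer inequalities and finite integer sums.

private variable I I′ : Set

-- Inequalities are proved by certificate: a visibly non-negative expression, whose equality with
-- `y - x` is left to the ring solver.
≤-by : ∀ {e x y} → 0ℤ ≤ e → e ≡ y - x → x ≤ y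
≤-by 0≤e eq = ℤ.0≤i-j⇒j≤i (subst (0ℤ ≤_) eq 0≤e)

0≤+ : ∀ {x y} → 0ℤ ≤ x → 0ℤ ≤ y → 0ℤ ≤ x + y
0≤+ = ℤ.+-mono-≤

0≤* : ∀ {x y} → 0ℤ ≤ x → 0ℤ ≤ y → 0ℤ ≤ x * y
0≤* {+ m} {+ n} _ _ = subst (0ℤ ≤_) (ℤ.pos-* m n) (+≤+ z≤n)

*-mono-≤-nonNeg : ∀ {x y u v} → 0ℤ ≤ x → 0ℤ ≤ u → x ≤ y → u ≤ v → x * u ≤ y * v
*-mono-≤-nonNeg {x} {y} {u} {v} 0≤x 0≤u x≤y u≤v =
  ≤-by (0≤+ (0≤* (ℤ.≤-trans 0≤x x≤y) (ℤ.i≤j⇒0≤j-i u≤v)) (0≤* 0≤u (ℤ.i≤j⇒0≤j-i x≤y))) (lem x y u v)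
  where
  lem : ∀ x y u v → y * (v - u) + u * (y - x) ≡ y * v - x * u
  lem = solve-∀

∑-neg : (xs : List I) (f : I → ℤ) → ∑ xs (λ x → - f x) ≡ - ∑ xs f
∑-neg []       f = refl
∑-neg (x ∷ xs) f = trans (cong (λ u → - f x + u) (∑-neg xs f)) (sym (ℤ.neg-distrib-+ (f x) _))

∑-- : (xs : List I) (f h : I → ℤ) → ∑ xs (λ x → f x - h x) ≡ ∑ xs f - ∑ xs h
∑-- xs f h = trans (∑-+ xs f _) (cong (λ u → ∑ xs f + u) (∑-neg xs h))

∑-*ʳ : (xs : List I) (c : ℤ) (f : I → ℤ) → ∑ xs (λ x → f x * c) ≡ ∑ xs f * c
∑-*ʳ xs c f = trans (∑-cong xs (λ x → ℤ.*-comm (f x) c)) (trans (∑-*ˡ xs c f) (ℤ.*-comm c _))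

∑-product : (xs : List I) (ys : List I′) (f : I → ℤ) (h : I′ → ℤ) →
            ∑ xs f * ∑ ys h ≡ ∑ xs (λ x → ∑ ys (λ y → f x * h y))
∑-product xs ys f h = sym (trans (∑-cong xs (λ x → ∑-*ˡ ys (f x) h)) (∑-*ʳ xs (∑ ys h) f))

∑-mono : (xs : List I) {f h : I → ℤ} → (∀ {x} → x ∈ xs → f x ≤ h x) → ∑ xs f ≤ ∑ xs h
∑-mono []       le = ℤ.≤-refl
∑-mono (x ∷ xs) le = ℤ.+-mono-≤ (le (here refl)) (∑-mono xs (le ∘ there))

∑-nonNeg : (xs : List I) {f : I → ℤ} → (∀ {x} → x ∈ xs → 0ℤ ≤ f x) → 0ℤ ≤ ∑ xs f
∑-nonNeg xs {f} h = subst (_≤ ∑ xs f) (∑-zero xs (λ _ → refl)) (∑-mono xs {λ _ → 0ℤ} h)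

∑-single : {xs : List I} → Unique xs → ∀ {x} → x ∈ xs → (f : I → ℤ) →
           (∀ {y} → y ∈ xs → y ≢ x → f y ≡ 0ℤ) → ∑ xs f ≡ f x
∑-single {xs = x ∷ xs} (x∉ ∷ u) (here refl) f z =
  trans (cong (λ v → f x + v) (∑-zero xs (λ y∈ → z (there y∈) (λ y≡x → All.lookup x∉ y∈ (sym y≡x)))))
        (ℤ.+-identityʳ (f x))
∑-single {xs = y ∷ xs} (y∉ ∷ u) {x} (there x∈) f z =
  trans (cong₂ _+_ (z (here refl) (All.lookup y∉ x∈)) (∑-single u x∈ f (z ∘ there))) (ℤ.+-identityˡ (f x))

∑-member : {xs : List I} {f : I → ℤ} → (∀ {x} → x ∈ xs → 0ℤ ≤ f x) → ∀ {x} → x ∈ xs → f x ≤ ∑ xs f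
∑-member {xs = x ∷ xs} {f} 0≤f (here refl) =
  subst (_≤ f x + ∑ xs f) (ℤ.+-identityʳ (f x)) (ℤ.+-monoʳ-≤ (f x) (∑-nonNeg xs (0≤f ∘ there)))
∑-member {xs = y ∷ xs} {f} 0≤f {x} (there x∈) =
  subst (_≤ f y + ∑ xs f) (ℤ.+-identityˡ (f x)) (ℤ.+-mono-≤ (0≤f (here refl)) (∑-member (0≤f ∘ there) x∈))

∑-const : (xs : List I) (c : ℤ) → ∑ xs (λ _ → c) ≡ + length xs * c
∑-const []       c = sym (ℤ.*-zeroˡ c)
∑-const (x ∷ xs) c = trans (cong (λ u → c + u) (∑-const xs c)) (sym (ℤ.suc-* (+ length xs) c))

2xy≤x²+y² : ∀ x y → + 2 * (x * y) ≤ x * x + y * y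
2xy≤x²+y² x y = ≤-by (square (x - y)) (lem x y)
  where
  square : ∀ z → 0ℤ ≤ z * z
  square (+ n)      = 0≤* {+ n} {+ n} (+≤+ z≤n) (+≤+ z≤n)
  square (-[1+ n ]) = +≤+ z≤n
  lem : ∀ x y → (x - y) * (x - y) ≡ x * x + y * y - + 2 * (x * y)
  lem = solve-∀

-- Induction on the list: the new cross terms `2 f x f y`, one for each `y` in `xs`, are bounded
-- separately by the sum of the two squares.
cauchy-schwarz : (xs : List I) (f : I → ℤ) →
                 ∑ xs f * ∑ xs f ≤ + length xs * ∑ xs (λ x → f x * f x)
cauchy-schwarz []       f = ℤ.≤-refl
cauchy-schwarz (x ∷ xs) f = subst₂ _≤_ (lem₁ (f x) S) (lem₂ (+ length xs) (f x) T)
  (ℤ.+-mono-≤ (ℤ.+-monoʳ-≤ (f x * f x) cross) (cauchy-schwarz xs f))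
  where
  S = ∑ xs f
  T = ∑ xs (λ y → f y * f y)
  cross : + 2 * (f x * S) ≤ + length xs * (f x * f x) + T
  cross = subst₂ _≤_
    (trans (∑-*ˡ xs (+ 2) (λ y → f x * f y)) (cong (+ 2 *_) (∑-*ˡ xs (f x) f)))
    (trans (∑-+ xs (λ _ → f x * f x) (λ y → f y * f y)) (cong (_+ T) (∑-const xs (f x * f x))))
    (∑-mono xs (λ {y} _ → 2xy≤x²+y² (f x) (f y)))
  lem₁ : ∀ p s → p * p + + 2 * (p * s) + s * s ≡ (p + s) * (p + s)
  lem₁ = solve-∀
  lem₂ : ∀ n p t → p * p + (n * (p * p) + t) + n * t ≡ (1ℤ + n) * (p * p + t)
  lem₂ = solve-∀

upTo-unique : ∀ n → Unique (upTo n)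
upTo-unique = Unique.upTo⁺

∑-upTo-suc : ∀ n (f : ℕ → ℤ) → ∑ (upTo (suc n)) f ≡ ∑ (upTo n) f + f n
∑-upTo-suc n f = trans (cong (λ xs → ∑ xs f) (sym (List.upTo-∷ʳ n))) (snoc (upTo n))
  where
  snoc : ∀ xs → ∑ (xs ∷ʳ n) f ≡ ∑ xs f + f n
  snoc []       = ℤ.+-comm (f n) 0ℤ
  snoc (x ∷ xs) = trans (cong (λ u → f x + u) (snoc xs)) (sym (ℤ.+-assoc (f x) _ (f n)))

∑-telescope : ∀ n (f : ℕ → ℤ) → ∑ (upTo n) (λ k → f (suc k) - f k) ≡ f n - f 0
∑-telescope zero    f = sym (ℤ.+-inverseʳ (f 0))
∑-telescope (suc n) f = trans (∑-upTo-suc n _)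
  (trans (cong (_+ (f (suc n) - f n)) (∑-telescope n f)) (lem (f n) (f 0) (f (suc n))))
  where
  lem : ∀ p q r → p - q + (r - p) ≡ r - q
  lem = solve-∀

-- Iverson brackets, Kronecker delta and Heaviside steps.

⟦_⟧ : {P : Set} → Dec P → ℤ
⟦ d ⟧ = if does d then 1ℤ else 0ℤ

⟦⟧-yes : {P : Set} (d : Dec P) → P → ⟦ d ⟧ ≡ 1ℤ
⟦⟧-yes d p = cong (if_then 1ℤ else 0ℤ) (dec-true d p)

⟦⟧-no : {P : Set} (d : Dec P) → ¬ P → ⟦ d ⟧ ≡ 0ℤ
⟦⟧-no d ¬p = cong (if_then 1ℤ else 0ℤ) (dec-false d ¬p)

⟦⟧-cong : {P Q : Set} (d : Dec P) (e : Dec Q) → (P → Q) → (Q → P) → ⟦ d ⟧ ≡ ⟦ e ⟧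
⟦⟧-cong (yes p) e f g = sym (⟦⟧-yes e (f p))
⟦⟧-cong (no ¬p) e f g = sym (⟦⟧-no e (¬p ∘ g))

⟦⟧-mono : {P Q : Set} (d : Dec P) (e : Dec Q) → (P → Q) → ⟦ d ⟧ ≤ ⟦ e ⟧
⟦⟧-mono (yes p) e f = ℤ.≤-reflexive (sym (⟦⟧-yes e (f p)))
⟦⟧-mono (no _)  (yes _) f = +≤+ z≤n
⟦⟧-mono (no _)  (no _)  f = ℤ.≤-refl

⟦⟧-nonNeg : {P : Set} (d : Dec P) → 0ℤ ≤ ⟦ d ⟧
⟦⟧-nonNeg (yes _) = +≤+ z≤n
⟦⟧-nonNeg (no _)  = ℤ.≤-refl

δ : ℤ → ℤ → ℤ
δ x y = ⟦ x ℤ.≟ y ⟧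

δ-refl : ∀ x → δ x x ≡ 1ℤ
δ-refl x = ⟦⟧-yes (x ℤ.≟ x) refl

δ-≢ : ∀ {x y} → x ≢ y → δ x y ≡ 0ℤ
δ-≢ {x} {y} = ⟦⟧-no (x ℤ.≟ y)

δ-shift : ∀ c x y → δ (x + c) y ≡ δ x (y - c)
δ-shift c x y = ⟦⟧-cong (x + c ℤ.≟ y) (x ℤ.≟ y - c)
  (λ { refl → lem₁ x c }) (λ { refl → lem₂ y c })
  where
  lem₁ : ∀ x c → x ≡ x + c - c
  lem₁ = solve-∀
  lem₂ : ∀ y c → y - c + c ≡ y
  lem₂ = solve-∀

-- Unfolds to the same term as `𝟏[ d ≥ c ]`, so that its lemmas apply to `K` by computation.
H : ℤ → ℤ → ℤ
H d c = ⟦ c ℤ.≤? d ⟧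

H-shift : ∀ d c e → H (d + e) c ≡ H d (c - e)
H-shift d c e = ⟦⟧-cong (c ℤ.≤? d + e) (c - e ℤ.≤? d)
  (λ h → ≤-by (ℤ.i≤j⇒0≤j-i h) (lem₁ d c e)) (λ h → ≤-by (ℤ.i≤j⇒0≤j-i h) (lem₂ d c e))
  where
  lem₁ : ∀ d c e → d + e - c ≡ d - (c - e)
  lem₁ = solve-∀
  lem₂ : ∀ d c e → d - (c - e) ≡ d + e - c
  lem₂ = solve-∀

H-neg : ∀ d c → H (- d) c ≡ 1ℤ - H d (1ℤ - c)
H-neg d c with c ℤ.≤? - d | 1ℤ - c ℤ.≤? d
... | yes _ | no _  = refl
... | no _  | yes _ = refl
... | yes p | yes q = contradiction (≤-by {x = 1ℤ} {0ℤ} (0≤+ (ℤ.i≤j⇒0≤j-i p) (ℤ.i≤j⇒0≤j-i q)) (lem c d)) (λ { (+≤+ ()) })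
  where
  lem : ∀ c d → - d - c + (d - (1ℤ - c)) ≡ 0ℤ - 1ℤ
  lem = solve-∀
... | no p  | no q  = contradiction
  (≤-by {x = 1ℤ} {0ℤ} (0≤+ (ℤ.i≤j⇒0≤j-i (ℤ.i<j⇒suc[i]≤j (ℤ.≰⇒> p))) (ℤ.i≤j⇒0≤j-i (ℤ.i<j⇒suc[i]≤j (ℤ.≰⇒> q)))) (lem c d)) (λ { (+≤+ ()) })
  where
  lem : ∀ c d → c - (1ℤ + - d) + (1ℤ - c - (1ℤ + d)) ≡ 0ℤ - 1ℤ
  lem = solve-∀

H-step : ∀ d c → H d c - H d (1ℤ + c) ≡ δ d c
H-step d c with c ℤ.≤? d | 1ℤ + c ℤ.≤? d | d ℤ.≟ c
... | yes _ | yes _ | no _  = refl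
... | yes _ | no _  | yes _ = refl
... | no _  | no _  | no _  = refl
... | yes p | no q  | no r  = contradiction (ℤ.i<j⇒suc[i]≤j (ℤ.≤∧≢⇒< p (r ∘ sym))) q
... | _     | yes q | yes refl = contradiction q (ℤ.<⇒≱ (ℤ.suc[i]≤j⇒i<j ℤ.≤-refl))
... | no p  | yes q | _     = contradiction (ℤ.≤-trans (ℤ.i≤suc[i] c) q) p
... | no p  | _     | yes refl = contradiction ℤ.≤-refl p

-- Each `δ` is one step of `H`, so the sum telescopes. This assembles the window kernel `W` from the
-- kernels of single heights.
∑-interval : ∀ n s d → ∑ (upTo n) (λ j → δ d (s + + j)) ≡ H d s - H d (s + + n)
∑-interval n s d = begin
  ∑ (upTo n) (λ j → δ d (s + + j))
    ≡⟨ ∑-cong (upTo n) (λ j → trans (sym (H-step d (s + + j)))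
         (trans (cong (λ u → H d (s + + j) - H d u) (lem₁ s (+ j))) (lem₂ (H d (s + + j)) _))) ⟩
  ∑ (upTo n) (λ j → - H d (s + + suc j) - - H d (s + + j))
    ≡⟨ ∑-telescope n (λ j → - H d (s + + j)) ⟩
  - H d (s + + n) - - H d (s + 0ℤ)
    ≡⟨ trans (cong (λ u → - H d (s + + n) - - H d u) (ℤ.+-identityʳ s)) (lem₃ (H d (s + + n)) (H d s)) ⟩
  H d s - H d (s + + n) ∎
  where
  open ≡-Reasoning
  lem₁ : ∀ s j → 1ℤ + (s + j) ≡ s + (1ℤ + j)
  lem₁ = solve-∀
  lem₂ : ∀ p q → p - q ≡ - q - - p
  lem₂ = solve-∀
  lem₃ : ∀ p q → - p - - q ≡ q - p
  lem₃ = solve-∀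

-- Multiples and residues modulo `a`.

multiple-nonNeg : ∀ a {d} → + a ∣ d → - + a ℤ.< d → 0ℤ ≤ d
multiple-nonNeg a (divides q refl) -a<d = 0≤* (ℤ.i<j⇒suc[i]≤j -1<q) (+≤+ z≤n)
  where
  -1<q : -[1+ 0 ] ℤ.< q
  -1<q = ℤ.*-cancelʳ-<-nonNeg (+ a) (subst (ℤ._< q * + a) (lem (+ a)) -a<d)
    where
    lem : ∀ a → - a ≡ (- 1ℤ) * a
    lem = solve-∀

multiple-zero : ∀ a {d} → + a ∣ d → - + a ℤ.< d → d ℤ.< + a → d ≡ 0ℤ
multiple-zero a {d} a∣d -a<d d<a = ℤ.≤-antisym
  (subst (_≤ 0ℤ) (ℤ.neg-involutive d) (ℤ.neg-mono-≤ (multiple-nonNeg a (∣m⇒∣-m a∣d) (ℤ.neg-mono-< d<a))))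
  (multiple-nonNeg a a∣d -a<d)

difference-multiple : ∀ {n k l} → k < n → l < n → + n ∣ + k - + l → k ≡ l
difference-multiple {n} {k} {l} k<n l<n n∣ = ℤ.+-injective (ℤ.i-j≡0⇒i≡j (+ k) (+ l) (multiple-zero n n∣
  (subst (ℤ._< + k - + l) (ℤ.+-identityˡ (- + n)) (ℤ.+-mono-≤-< (+≤+ z≤n) (ℤ.neg-mono-< (ℤ.+<+ l<n))))
  (subst (+ k - + l ℤ.<_) (ℤ.+-identityʳ (+ n)) (ℤ.+-mono-<-≤ (ℤ.+<+ k<n) (ℤ.neg-mono-≤ (+≤+ (z≤n {l})))))))

module _ (a b : ℕ) (coprime : Coprime a b) where

  coprime-∣ : ∀ y → + a ∣ y * + b → + a ∣ y
  coprime-∣ y a∣yb = ∣ᵤ⇒∣ (ℤ.coprime-divisor (+ a) (+ b) y coprime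
    (∣⇒∣ᵤ (subst (+ a ∣_) (ℤ.*-comm y (+ b)) a∣yb)))

  inverse : ∃ λ v → + a ∣ 1ℤ - v * + b
  inverse with coprime-Bézout coprime
  ... | Bézout.+- x y eq = - + y , divides (+ x) (trans (lem (+ y) (+ b)) (trans (cong (λ u → 1ℤ + u) (sym (ℤ.pos-* y b)))
      (trans (cong +_ eq) (ℤ.pos-* x a))))
    where
    lem : ∀ y b → 1ℤ - - y * b ≡ 1ℤ + y * b
    lem = solve-∀
  ... | Bézout.-+ x y eq = + y , divides (- + x) (trans (cong (λ u → 1ℤ - u) (sym eq′)) (lem (+ x) (+ a)))
    where
    eq′ : 1ℤ + + x * + a ≡ + y * + b
    eq′ = trans (cong (λ u → 1ℤ + u) (sym (ℤ.pos-* x a))) (trans (cong +_ eq) (ℤ.pos-* y b))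
    lem : ∀ x a → 1ℤ - (1ℤ + x * a) ≡ - x * a
    lem = solve-∀

  -- With `v` the inverse of `b` modulo `a`, take `l` to be `z v` reduced modulo `a`; then `z - l b`
  -- is `z (1 - v b)` plus a multiple of `a`.
  residue : .{{_ : ℕ.NonZero a}} → ∀ z → ∃ λ l → l < a × + a ∣ z - + l * + b
  residue z with v , a∣ ← inverse = l , ℤ.n%ℕd<d (z * v) a ,
    subst (+ a ∣_) eq (∣m∣n⇒∣m+n (∣n⇒∣m*n z a∣) (∣m⇒∣m*n (+ b) (divides q refl)))
    where
    l = (z * v) ℤ.%ℕ a
    q = (z * v) ℤ./ℕ a
    eq : z * (1ℤ - v * + b) + q * + a * + b ≡ z - + l * + b
    eq = trans (lem₁ z v (+ b) (q * + a)) (trans (cong (λ u → z - (u - q * + a) * + b) (ℤ.a≡a%ℕn+[a/ℕn]*n (z * v) a))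
               (lem₂ z (+ b) (+ l) (q * + a)))
      where
      lem₁ : ∀ z v b p → z * (1ℤ - v * b) + p * b ≡ z - (z * v - p) * b
      lem₁ = solve-∀
      lem₂ : ∀ z b l p → z - (l + p - p) * b ≡ z - l * b
      lem₂ = solve-∀

-- Upward closed sets and their common generators.

-- The superlevel sets of `N`, stripped to what the crossing argument uses. `a` and `b` enter
-- symmetrically, which allows the roles to be exchanged later.
record UpSet (a b : ℕ) (U : ℤ → Set) : Set where
  field
    dec  : ∀ z → Dec (U z)
    up-a : ∀ {z} → U z → U (z + + a)
    up-b : ∀ {z} → U z → U (z + + b)
    neg  : ∀ {z} → z ℤ.< 0ℤ → ¬ U z
    zero∈ : U 0ℤ

  up-multiple : ∀ k {z} → U z → U (z + + k * + a)
  up-multiple zero    {z} u = subst U (lem z (+ a)) u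
    where
    lem : ∀ z a → z ≡ z + 0ℤ * a
    lem = solve-∀
  up-multiple (suc k) {z} u = subst U (lem z (+ k) (+ a)) (up-a (up-multiple k u))
    where
    lem : ∀ z k a → z + k * a + a ≡ z + (1ℤ + k) * a
    lem = solve-∀

  down-multiple : ∀ k {z} → ¬ U z → ¬ U (z - + k * + a)
  down-multiple k {z} ¬u u = ¬u (subst U (lem z (+ k * + a)) (up-multiple k u))
    where
    lem : ∀ z c → z - c + c ≡ z
    lem = solve-∀

  multiples∈ : ∀ {z} → + a ∣ z → 0ℤ ≤ z → .{{_ : ℕ.NonZero a}} → U z
  multiples∈ {z} (divides q refl) 0≤z = go q (ℤ.*-cancelʳ-≤-pos 0ℤ q (+ a) {{pos}} 0≤z)
    where
    pos : ℤ.Positive (+ a)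
    pos = ℤ.positive (ℤ.+<+ (ℕ.>-nonZero⁻¹ a))
    go : ∀ q → 0ℤ ≤ q → U (q * + a)
    go (+ k) _ = subst U (ℤ.+-identityˡ _) (up-multiple k zero∈)

  private
    smaller : .{{_ : ℕ.NonZero a}} → ∀ p n → p ℤ.< + suc n → p - + a ℤ.< + n
    smaller p n p<n = subst (p - + a ℤ.<_) (lem (+ n))
      (ℤ.+-mono-<-≤ p<n (ℤ.neg-mono-≤ (ℤ.+≤+ (ℕ.>-nonZero⁻¹ a))))
      where
      lem : ∀ n → 1ℤ + n - 1ℤ ≡ n
      lem = solve-∀

  -- Finds the least element of `U` in the class of `p` modulo `a`. The bound `n` on `p` is the
  -- fuel, and the descent must stop because `U` has no negative elements.
  descend : .{{_ : ℕ.NonZero a}} → ∀ n p → p ℤ.< + n → U p →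
            ∃ λ m → U (p - + m * + a) × ¬ U (p - + m * + a - + a)
  descend zero    p p<0 u = contradiction u (neg p<0)
  descend (suc n) p p<n u with dec (p - + a)
  ... | no ¬u = 0 , subst U (lem₁ p (+ a)) u , ¬u ∘ subst U (lem₂ p (+ a))
    where
    lem₁ : ∀ p a → p ≡ p - 0ℤ * a
    lem₁ = solve-∀
    lem₂ : ∀ p a → p - 0ℤ * a - a ≡ p - a
    lem₂ = solve-∀
  ... | yes u′ with m , um , ¬um ← descend n (p - + a) (smaller p n p<n) u′
    = suc m , subst U (lem₁ p (+ m) (+ a)) um , ¬um ∘ subst U (lem₂ p (+ m) (+ a))
    where
    lem₁ : ∀ p m a → p - a - m * a ≡ p - (1ℤ + m) * a
    lem₁ = solve-∀
    lem₂ : ∀ p m a → p - (1ℤ + m) * a - a ≡ p - a - m * a - a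
    lem₂ = solve-∀

-- The least elements p of U in the residue classes 0, b, 2b, … mod a form a walk
-- p ↦ p + b - m a.  It starts at 0, where p - t is negative unless t = 0, and
-- reaches the class of t, where p - t ∈ V; the first p with p - t ∈ V is the witness.
module _ {a b : ℕ} .{{_ : ℕ.NonZero a}} {U V : ℤ → Set} (upU : UpSet a b U) (upV : UpSet a b V) {t : ℕ} where
  private
    module 𝐔 = UpSet upU
    module 𝐕 = UpSet upV

    -- A generator is a vertical step of the boundary path of `U`. It is common if the boundary path
    -- of `V`, translated by `t`, makes a horizontal step there: the two paths cross.
    Generator CommonGenerator : ℤ → Set
    Generator p = U p × ¬ U (p - + a)
    CommonGenerator z = Generator z × (V (z - + t) × ¬ V (z - + t - + b))

    bounded : ∀ q → ∃ λ n → q ℤ.< + n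
    bounded (+ n)      = suc n , ℤ.+<+ ℕ.≤-refl
    bounded (-[1+ n ]) = 0 , ℤ.-<+

    -- Once `p` and `t` are congruent modulo `a`, `p - t` is a multiple of `a` exceeding `- a`,
    -- because `p ≥ 0` and `t < a`. So it is a non-negative multiple, and these all lie in `V`.
    arrive : ∀ p c → t < a → U p → + a ∣ p - c → + a ∣ + t - c → V (p - + t)
    arrive p c t<a u a∣p a∣t = 𝐕.multiples∈ a∣p-t (multiple-nonNeg a a∣p-t -a<p-t)
      where
      lem : ∀ p c t → p - c - (t - c) ≡ p - t
      lem = solve-∀
      a∣p-t : + a ∣ p - + t
      a∣p-t = subst (+ a ∣_) (lem p c (+ t)) (∣m∣n⇒∣m-n a∣p a∣t)
      -a<p-t : - + a ℤ.< p - + t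
      -a<p-t = subst (ℤ._< p - + t) (ℤ.+-identityˡ (- + a))
        (ℤ.+-mono-≤-< (ℤ.≮⇒≥ (λ p<0 → 𝐔.neg p<0 u)) (ℤ.neg-mono-< (ℤ.+<+ t<a)))

    -- `p′ - t - b` is `p - t` lowered by a multiple of `a`, so it inherits being outside `V`. Hence
    -- the negative half of the condition on `V` is an invariant of the walk.
    step : ∀ p k → U p → + a ∣ p - + k * + b → ¬ V (p - + t) →
           ∃ λ p′ → Generator p′ × + a ∣ p′ - + suc k * + b × ¬ V (p′ - + t - + b)
    step p k u a∣p ¬v =
      let N , p+b<N = bounded (p + + b)
          m , um , ¬um = 𝐔.descend N (p + + b) p+b<N (𝐔.up-b u)
      in p + + b - + m * + a , (um , ¬um) ,
         subst (+ a ∣_) (lem₁ p (+ b) (+ k) (+ m * + a)) (∣m∣n⇒∣m-n a∣p (divides (+ m) refl)) ,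
         λ v → 𝐕.down-multiple m ¬v (subst V (lem₂ p (+ b) (+ t) (+ m * + a)) v)
      where
      lem₁ : ∀ p b k c → p - k * b - c ≡ p + b - c - (1ℤ + k) * b
      lem₁ = solve-∀
      lem₂ : ∀ p b t c → p + b - c - t - b ≡ p - t - c
      lem₂ = solve-∀

    -- `n` counts the steps left before the class of `t`, which is that of `K b`; there `arrive`
    -- rules out going on.
    walk : t < a → ∀ K → + a ∣ + t - + K * + b → ∀ n k p → n ℕ.+ k ≡ K → + a ∣ p - + k * + b →
           Generator p → ¬ V (p - + t - + b) → ∃ CommonGenerator
    walk t<a K a∣t n k p n+k≡K a∣p gen ¬v with 𝐕.dec (p - + t)
    walk t<a K a∣t n       k p n+k≡K a∣p gen ¬v | yes v = p , gen , v , ¬v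
    walk t<a K a∣t zero    k p refl  a∣p gen ¬v | no ¬v′ =
      contradiction (arrive p (+ k * + b) t<a (proj₁ gen) a∣p a∣t) ¬v′
    walk t<a K a∣t (suc n) k p n+k≡K a∣p gen ¬v | no ¬v′ =
      let p′ , gen′ , a∣p′ , ¬v″ = step p k (proj₁ gen) a∣p ¬v′
      in walk t<a K a∣t n (suc k) p′ (trans (ℕ.+-suc n k) n+k≡K) a∣p′ gen′ ¬v″

    0-a<0 : 0ℤ - + a ℤ.< 0ℤ
    0-a<0 = ℤ.+-monoʳ-< 0ℤ (ℤ.neg-mono-< (ℤ.+<+ (ℕ.>-nonZero⁻¹ a)))

    0-t-b<0 : 0 < b → 0ℤ - + t - + b ℤ.< 0ℤ
    0-t-b<0 0<b = ℤ.+-mono-≤-< (ℤ.+-monoʳ-≤ 0ℤ (ℤ.neg-mono-≤ (+≤+ (z≤n {t})))) (ℤ.neg-mono-< (ℤ.+<+ 0<b))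

  common-generator : Coprime a b → 0 < b → t < a → ∃ CommonGenerator
  common-generator coprime 0<b t<a =
    let K , _ , a∣K = residue a b coprime (+ t)
    in walk t<a K a∣K K 0 0ℤ (ℕ.+-identityʳ K) (divides 0ℤ refl)
         (𝐔.zero∈ , 𝐔.neg 0-a<0) (𝐕.neg (0-t-b<0 0<b))

-- Gaps of the semigroup generated by `a` and `b`.

module Gaps (a b : ℕ) (1<a : 1 < a) (a<b : a < b) (coprime : Coprime a b) where

  instance
    a≢0 : ℕ.NonZero a
    a≢0 = ℕ.>-nonZero (ℕ.<-trans (s≤s z≤n) 1<a)
    b≢0 : ℕ.NonZero b
    b≢0 = ℕ.>-nonZero (ℕ.<-trans (s≤s z≤n) (ℕ.<-trans 1<a a<b))

  0<a : 0ℤ ℤ.< + a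
  0<a = ℤ.+<+ (ℕ.>-nonZero⁻¹ a)

  0<b : 0ℤ ℤ.< + b
  0<b = ℤ.+<+ (ℕ.>-nonZero⁻¹ b)

  γ : G a b → ℤ
  γ = gᴳ a b

  X Y : G a b → ℤ
  X i = proj₁ (value i)
  Y i = proj₂ (value i)

  inG : ∀ i → InG a b (value i)
  inG (p , [ p∈G ]) = recompute (InG? a b p) p∈G

  1≤X : ∀ i → 1ℤ ≤ X i
  1≤X i = proj₁ (inG i)

  1≤Y : ∀ i → 1ℤ ≤ Y i
  1≤Y i = proj₁ (proj₂ (inG i))

  0<γ : ∀ i → 0ℤ ℤ.< γ i
  0<γ i = proj₂ (proj₂ (inG i))

  G-≡ : ∀ {i j : G a b} → X i ≡ X j → Y i ≡ Y j → i ≡ j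
  G-≡ refl refl = refl

  Y<a : ∀ i → Y i ℤ.< + a
  Y<a i = ℤ.≰⇒> λ a≤Y → ℤ.<⇒≱ (0<γ i) (≤-by
    (0≤+ (0≤* (+≤+ (z≤n {a})) (ℤ.<⇒≤ (ℤ.<-≤-trans (ℤ.+<+ (s≤s z≤n)) (1≤X i))))
         (0≤* (+≤+ (z≤n {b})) (ℤ.i≤j⇒0≤j-i a≤Y)))
    (lem (+ a) (+ b) (X i) (Y i)))
    where
    lem : ∀ a b x y → a * x + b * (y - a) ≡ 0ℤ - (a * b - a * x - b * y)
    lem = solve-∀

  X<b : ∀ i → X i ℤ.< + b
  X<b i = ℤ.≰⇒> λ b≤X → ℤ.<⇒≱ (0<γ i) (≤-by
    (0≤+ (0≤* (+≤+ (z≤n {a})) (ℤ.i≤j⇒0≤j-i b≤X))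
         (0≤* (+≤+ (z≤n {b})) (ℤ.<⇒≤ (ℤ.<-≤-trans (ℤ.+<+ (s≤s z≤n)) (1≤Y i)))))
    (lem (+ a) (+ b) (X i) (Y i)))
    where
    lem : ∀ a b x y → a * (x - b) + b * y ≡ 0ℤ - (a * b - a * x - b * y)
    lem = solve-∀

  -- Equal heights make `a` divide `(Y i - Y j) b`, hence `Y i - Y j`, which is smaller than `a` in
  -- absolute value.
  γ-injective : ∀ {i j} → γ i ≡ γ j → i ≡ j
  γ-injective {i} {j} γi≡γj = G-≡ X≡ Y≡
    where
    lem₁ : ∀ a b x y x′ y′ → (y - y′) * b ≡ (x′ - x) * a - ((a * b - a * x - b * y) - (a * b - a * x′ - b * y′))
    lem₁ = solve-∀
    a∣ : + a ∣ (Y i - Y j) * + b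
    a∣ = divides (X j - X i) (trans (lem₁ (+ a) (+ b) (X i) (Y i) (X j) (Y j))
           (trans (cong (λ u → (X j - X i) * + a - u) (ℤ.i≡j⇒i-j≡0 {γ i} {γ j} γi≡γj)) (ℤ.+-identityʳ _)))
    lower : ∀ i j → - + a ℤ.< Y i - Y j
    lower i j = subst (ℤ._< Y i - Y j) (ℤ.+-identityˡ (- + a))
      (ℤ.+-mono-<  (ℤ.<-≤-trans (ℤ.+<+ (s≤s z≤n)) (1≤Y i)) (ℤ.neg-mono-< (Y<a j)))
    lem₂ : ∀ p q → - (p - q) ≡ q - p
    lem₂ = solve-∀
    Y≡ : Y i ≡ Y j
    Y≡ = ℤ.i-j≡0⇒i≡j (Y i) (Y j) (multiple-zero a (coprime-∣ a b coprime _ a∣) (lower i j)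
      (subst (Y i - Y j ℤ.<_) (ℤ.neg-involutive (+ a))
        (subst (ℤ._< - - + a) (lem₂ (Y j) (Y i)) (ℤ.neg-mono-< (lower j i)))))
    lem₃ : ∀ a b x y x′ y′ → a * x ≡ a * x′ + b * (y′ - y) - ((a * b - a * x - b * y) - (a * b - a * x′ - b * y′))
    lem₃ = solve-∀
    lem₄ : ∀ p b y → p + b * (y - y) - 0ℤ ≡ p
    lem₄ = solve-∀
    X≡ : X i ≡ X j
    X≡ = ℤ.*-cancelˡ-≡ (+ a) (X i) (X j) (trans (lem₃ (+ a) (+ b) (X i) (Y i) (X j) (Y j))
      (trans (cong₂ (λ u v → + a * X j + + b * (Y j - u) - v) Y≡ (ℤ.i≡j⇒i-j≡0 {γ i} {γ j} γi≡γj))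
             (lem₄ (+ a * X j) (+ b) (Y j))))

  -- If a ∣ γ i - l b then a ∣ Y i + l, so Y i + l ≥ a, and γ i - l b = a (b - X i) - b (Y i + l).
  gap-residue : ∀ i l → 0ℤ ≤ l → + a ∣ γ i - l * + b → γ i - l * + b ℤ.< 0ℤ
  gap-residue i l 0≤l a∣ = ℤ.≤-<-trans
    (≤-by (0≤+ (0≤* (+≤+ (z≤n {a})) (ℤ.i≤j⇒0≤j-i (1≤X i))) (0≤* (+≤+ (z≤n {b})) (ℤ.i≤j⇒0≤j-i a≤Y+l)))
          (lem₂ (+ a) (+ b) (X i) (Y i) l))
    (ℤ.neg-mono-< 0<a)
    where
    lem₁ : ∀ a b x y l → (y + l) * b ≡ (b - x) * a - (a * b - a * x - b * y - l * b)
    lem₁ = solve-∀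
    a∣Y+l : + a ∣ Y i + l
    a∣Y+l = coprime-∣ a b coprime (Y i + l) (subst (+ a ∣_) (sym (lem₁ (+ a) (+ b) (X i) (Y i) l))
      (∣m∣n⇒∣m-n (divides (+ b - X i) refl) a∣))
    0<Y+l : 0ℤ ℤ.< Y i + l
    0<Y+l = ℤ.+-mono-<-≤ (ℤ.<-≤-trans (ℤ.+<+ (s≤s z≤n)) (1≤Y i)) 0≤l
    a≤Y+l : + a ≤ Y i + l
    a≤Y+l = ℤ.≮⇒≥ λ Y+l<a → ℤ.<-irrefl (sym (multiple-zero a a∣Y+l (ℤ.<-trans (ℤ.neg-mono-< 0<a) 0<Y+l) Y+l<a)) 0<Y+l
    lem₂ : ∀ a b x y l → a * (x - 1ℤ) + b * (y + l - a) ≡ - a - (a * b - a * x - b * y - l * b)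
    lem₂ = solve-∀

  -- The bound `l < a` is a normal form: this `l` is the index of the one nonzero term in `𝟏S`.
  InS : ℤ → Set
  InS z = ∃₂ λ k l → l < a × z ≡ + k * + a + + l * + b

  combination∈S : ∀ k l → InS (+ k * + a + + l * + b)
  -- Every `a` copies of `b` are traded for `b` copies of `a`, leaving `l` reduced modulo `a`.
  combination∈S k l = k ℕ.+ l ℕ./ a ℕ.* b , l ℕ.% a , ℕ.m%n<n l a ,
    trans (cong (λ u → + k * + a + u * + b) (trans (cong +_ (ℕ.m≡m%n+[m/n]*n l a))
             (cong (λ u → + (l ℕ.% a) + u) (ℤ.pos-* (l ℕ./ a) a))))
      (trans (lem (+ a) (+ b) (+ k) (+ (l ℕ.% a)) (+ (l ℕ./ a)))
        (cong (λ u → (+ k + u) * + a + + (l ℕ.% a) * + b) (sym (ℤ.pos-* (l ℕ./ a) b))))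
    where
    lem : ∀ a b k r q → k * a + (r + q * a) * b ≡ (k + q * b) * a + r * b
    lem = solve-∀

  S-+a : ∀ {z} → InS z → InS (z + + a)
  S-+a (k , l , _ , refl) = subst InS (lem (+ a) (+ k) (+ l * + b)) (combination∈S (suc k) l)
    where
    lem : ∀ a k c → (1ℤ + k) * a + c ≡ k * a + c + a
    lem = solve-∀

  S-+b : ∀ {z} → InS z → InS (z + + b)
  S-+b (k , l , _ , refl) = subst InS (lem (+ k * + a) (+ l) (+ b)) (combination∈S k (suc l))
    where
    lem : ∀ c l b → c + (1ℤ + l) * b ≡ c + l * b + b
    lem = solve-∀

  gap∉S : ∀ i → ¬ InS (γ i)
  gap∉S i (k , l , _ , eq) = ℤ.<⇒≱ (gap-residue i (+ l) (+≤+ z≤n) (divides (+ k) eq′))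
    (subst (0ℤ ≤_) (sym eq′) (0≤* {+ k} {+ a} (+≤+ z≤n) (+≤+ z≤n)))
    where
    lem : ∀ p q → p + q - q ≡ p
    lem = solve-∀
    eq′ : γ i - + l * + b ≡ + k * + a
    eq′ = trans (cong (_- + l * + b) eq) (lem (+ k * + a) (+ l * + b))

  data Class (z : ℤ) : Set where
    negative : z ℤ.< 0ℤ → Class z
    gap      : ∀ i → γ i ≡ z → Class z
    inS      : InS z → Class z

  -- The sign of `q` decides. For `q = - n` with `n ≥ 1`, the number `q a + l b` equals
  -- `a b - a n - b (a - l)`, the height of `(n , a - l)`.
  classify-combination : ∀ z → 0ℤ ℤ.< z → ∀ l → l < a → ∀ q → z ≡ q * + a + + l * + b → Class z
  classify-combination z 0<z l l<a (+ k)      eq = inS (k , l , l<a , eq)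
  classify-combination z 0<z l l<a (-[1+ n ]) eq = gap (p , [ +≤+ (s≤s z≤n) , 1≤a-l , 0<gp ]) gp≡z
    where
    p : ℤ × ℤ
    p = + suc n , + a - + l
    lem : ∀ a b n l → a * b - a * n - b * (a - l) ≡ - n * a + l * b
    lem = solve-∀
    gp≡z : g a b p ≡ z
    gp≡z = trans (lem (+ a) (+ b) (+ suc n) (+ l)) (sym eq)
    0<gp : 0ℤ ℤ.< g a b p
    0<gp = subst (0ℤ ℤ.<_) (sym gp≡z) 0<z
    lem′ : ∀ a l → a - (1ℤ + l) ≡ a - l - 1ℤ
    lem′ = solve-∀
    1≤a-l : 1ℤ ≤ + a - + l
    1≤a-l = ≤-by (ℤ.i≤j⇒0≤j-i (+≤+ l<a)) (lem′ (+ a) (+ l))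

  classify : ∀ z → Class z
  classify z with z ℤ.<? 0ℤ | z ℤ.≟ 0ℤ
  ... | yes z<0 | _ = negative z<0
  ... | no _    | yes refl = inS (combination∈S 0 0)
  ... | no z≮0  | no z≢0 = classify-pos (ℤ.≤∧≢⇒< (ℤ.≮⇒≥ z≮0) (z≢0 ∘ sym)) (residue a b coprime z)
    where
    lem : ∀ z c → z ≡ z - c + c
    lem = solve-∀
    classify-pos : 0ℤ ℤ.< z → (∃ λ l → l < a × + a ∣ z - + l * + b) → Class z
    classify-pos 0<z (l , l<a , divides q eq) =
      classify-combination z 0<z l l<a q (trans (lem z (+ l * + b)) (cong (_+ + l * + b) eq))

  top : G a b
  -- The certificate is `(a - 2) (b - 3) + (b - 3) + 2 (a - 2) = g (1 , 1) - 1`.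
  top = (1ℤ , 1ℤ) , [ ℤ.≤-refl , ℤ.≤-refl , ℤ.<-≤-trans (ℤ.+<+ (s≤s z≤n)) (≤-by
    (0≤+ (0≤* (ℤ.i≤j⇒0≤j-i 2≤a) (ℤ.i≤j⇒0≤j-i 3≤b))
         (0≤+ (ℤ.i≤j⇒0≤j-i 3≤b) (0≤+ (ℤ.i≤j⇒0≤j-i 2≤a) (ℤ.i≤j⇒0≤j-i 2≤a)))) (lem (+ a) (+ b))) ]
    where
    2≤a : + 2 ≤ + a
    2≤a = +≤+ 1<a
    3≤b : + 3 ≤ + b
    3≤b = +≤+ (ℕ.≤-<-trans 1<a a<b)
    lem : ∀ a b → (a - + 2) * (b - + 3) + (b - + 3 + (a - + 2 + (a - + 2))) ≡ a * b - a * 1ℤ - b * 1ℤ - 1ℤ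
    lem = solve-∀

-- Extending a family from the gaps to all integers.

module Filling (a b : ℕ) (1<a : 1 < a) (a<b : a < b) (coprime : Coprime a b) where
  open Gaps a b 1<a a<b coprime

  E : List (G a b)
  E = elements a b

  e : ℤ → ℤ
  e d = ⟦ (0ℤ ℤ.≤? d) ×-dec (+ a ∣? d) ⟧

  e-step : ∀ d → e d - e (d - + a) ≡ δ 0ℤ d
  e-step d with 0ℤ ℤ.≟ d
  ... | yes refl = cong₂ _-_ (⟦⟧-yes ((0ℤ ℤ.≤? 0ℤ) ×-dec (+ a ∣? 0ℤ)) (ℤ.≤-refl , divides 0ℤ refl))
    (⟦⟧-no ((0ℤ ℤ.≤? 0ℤ - + a) ×-dec (+ a ∣? 0ℤ - + a)) λ (p , _) →
      ℤ.<⇒≱ 0<a (ℤ.0≤i-j⇒j≤i {0ℤ} {+ a} p))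
  ... | no 0≢d = ℤ.i≡j⇒i-j≡0 (⟦⟧-cong ((0ℤ ℤ.≤? d) ×-dec (+ a ∣? d)) ((0ℤ ℤ.≤? d - + a) ×-dec (+ a ∣? d - + a))
    (λ (0≤d , a∣d) → ℤ.i≤j⇒0≤j-i (a≤d 0≤d a∣d) , ∣m∣n⇒∣m-n a∣d ∣-refl)
    (λ (a≤d , a∣d-a) → ℤ.≤-trans (ℤ.<⇒≤ 0<a) (ℤ.0≤i-j⇒j≤i a≤d) , subst (+ a ∣_) (lem d (+ a)) (∣m∣n⇒∣m+n a∣d-a ∣-refl)))
    where
    lem : ∀ d a → d - a + a ≡ d
    lem = solve-∀
    a≤d : 0ℤ ≤ d → + a ∣ d → + a ≤ d
    a≤d 0≤d a∣d = ℤ.≮⇒≥ λ d<a → 0≢d (sym (multiple-zero a a∣d (ℤ.<-≤-trans (ℤ.neg-mono-< 0<a) 0≤d) d<a))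

  -- Indicator of the semigroup: the multiples `k b` with `k < a` lie in distinct classes modulo
  -- `a`, so at most one term is nonzero. The form as a sum allows differences to be taken term by
  -- term.
  𝟏S : ℤ → ℤ
  𝟏S z = ∑ (upTo a) (λ k → e (z - + k * + b))

  -- The points `k b` with `k < a` form the Apéry set of `a`: the least elements of the semigroup in
  -- each class modulo `a`.
  𝟏S-step-a : ∀ z → 𝟏S z - 𝟏S (z - + a) ≡ ∑ (upTo a) (λ k → δ (+ k * + b) z)
  𝟏S-step-a z = trans (sym (∑-- (upTo a) (λ k → e (z - + k * + b)) (λ k → e (z - + a - + k * + b))))
    (∑-cong (upTo a) λ k → trans (cong (λ u → e (z - + k * + b) - e u) (lem z (+ a) (+ k * + b)))
      (trans (e-step (z - + k * + b)) (trans (sym (δ-shift (+ k * + b) 0ℤ z)) (cong (λ u → δ u z) (ℤ.+-identityˡ (+ k * + b))))))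
    where
    lem : ∀ z a c → z - a - c ≡ z - c - a
    lem = solve-∀

  -- Shifting by `b` moves the sum one place along `k`, so only `e z - e (z - a b)` survives. This
  -- is then unrolled into `b` steps of length `a`.
  𝟏S-step-b : ∀ z → 𝟏S z - 𝟏S (z - + b) ≡ ∑ (upTo b) (λ l → δ (+ l * + a) z)
  𝟏S-step-b z = begin
    𝟏S z - 𝟏S (z - + b)
      ≡⟨ ∑-- (upTo a) (λ k → e (z - + k * + b)) (λ k → e (z - + b - + k * + b)) ⟨
    ∑ (upTo a) (λ k → e (z - + k * + b) - e (z - + b - + k * + b))
      ≡⟨ ∑-cong (upTo a) (λ k → trans (cong (λ u → e (z - + k * + b) - e u) (lem₁ z (+ k) (+ b))) (flip (e (z - + k * + b)) _)) ⟩
    ∑ (upTo a) (λ k → - e (z - + suc k * + b) - - e (z - + k * + b))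
      ≡⟨ ∑-telescope a (λ k → - e (z - + k * + b)) ⟩
    - e (z - + a * + b) - - e (z - 0ℤ)
      ≡⟨ cong (λ u → - e (z - u) - - e (z - 0ℤ)) (ℤ.*-comm (+ a) (+ b)) ⟩
    - e (z - + b * + a) - - e (z - 0ℤ)
      ≡⟨ ∑-telescope b (λ l → - e (z - + l * + a)) ⟨
    ∑ (upTo b) (λ l → - e (z - + suc l * + a) - - e (z - + l * + a))
      ≡⟨ ∑-cong (upTo b) (λ l → trans (sym (flip (e (z - + l * + a)) _)) (trans (cong (λ u → e (z - + l * + a) - e u) (lem₂ z (+ l) (+ a)))
          (trans (e-step (z - + l * + a)) (trans (sym (δ-shift (+ l * + a) 0ℤ z)) (cong (λ u → δ u z) (ℤ.+-identityˡ (+ l * + a))))))) ⟩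
    ∑ (upTo b) (λ l → δ (+ l * + a) z) ∎
    where
    open ≡-Reasoning
    lem₁ : ∀ z k b → z - b - k * b ≡ z - (1ℤ + k) * b
    lem₁ = solve-∀
    lem₂ : ∀ z l a → z - (1ℤ + l) * a ≡ z - l * a - a
    lem₂ = solve-∀
    flip : ∀ p q → p - q ≡ - q - - p
    flip = solve-∀

  e-no : ∀ d → ¬ (0ℤ ≤ d × + a ∣ d) → e d ≡ 0ℤ
  e-no d = ⟦⟧-no ((0ℤ ℤ.≤? d) ×-dec (+ a ∣? d))

  𝟏S-neg : ∀ {z} → z ℤ.< 0ℤ → 𝟏S z ≡ 0ℤ
  𝟏S-neg {z} z<0 = ∑-zero (upTo a) λ {k} _ → e-no (z - + k * + b) λ (0≤d , _) → ℤ.<⇒≱ z<0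
    (ℤ.≤-trans (0≤* {+ k} {+ b} (+≤+ z≤n) (+≤+ z≤n)) (ℤ.0≤i-j⇒j≤i 0≤d))

  𝟏S-gap : ∀ i → 𝟏S (γ i) ≡ 0ℤ
  𝟏S-gap i = ∑-zero (upTo a) λ {k} _ → e-no (γ i - + k * + b) λ (0≤d , a∣d) →
    ℤ.<⇒≱ (gap-residue i (+ k) (+≤+ z≤n) a∣d) 0≤d

  𝟏S-S : ∀ {z} → InS z → 𝟏S z ≡ 1ℤ
  𝟏S-S {z} (k , l , l<a , refl) = trans
    (∑-single (upTo-unique a) (∈-upTo⁺ l<a) (λ l′ → e (z - + l′ * + b)) other)
    (⟦⟧-yes ((0ℤ ℤ.≤? z - + l * + b) ×-dec (+ a ∣? z - + l * + b))
      (subst (0ℤ ≤_) (sym (lem₁ (+ k * + a) (+ l * + b))) (0≤* {+ k} {+ a} (+≤+ z≤n) (+≤+ z≤n)) , divides (+ k) (lem₁ (+ k * + a) (+ l * + b))))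
    where
    lem₁ : ∀ p q → p + q - q ≡ p
    lem₁ = solve-∀
    lem₂ : ∀ c l l′ b → c + l * b - l′ * b - c ≡ (l - l′) * b
    lem₂ = solve-∀
    other : ∀ {l′} → l′ ∈ upTo a → l′ ≢ l → e (z - + l′ * + b) ≡ 0ℤ
    other {l′} l′∈ l′≢l = e-no (z - + l′ * + b) λ (_ , a∣d) → l′≢l (sym (difference-multiple l<a (∈-upTo⁻ l′∈)
      (coprime-∣ a b coprime (+ l - + l′)
        (subst (+ a ∣_) (lem₂ (+ k * + a) (+ l) (+ l′) (+ b)) (∣m∣n⇒∣m-n a∣d (divides (+ k) refl))))))

  module _ (m : G a b → ℤ) where

    ũ : ℤ → ℤ
    ũ z = ∑ E (λ i → m i * δ (γ i) z)

    ũ-gap : ∀ i → ũ (γ i) ≡ m i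
    ũ-gap i = trans (∑-single (elements-unique a b) (∈-elements a b i) _
        (λ {j} _ j≢i → trans (cong (m j *_) (δ-≢ (j≢i ∘ γ-injective))) (ℤ.*-zeroʳ (m j))))
      (trans (cong (m i *_) (δ-refl (γ i))) (ℤ.*-identityʳ (m i)))

    ũ-nongap : ∀ {z} → (∀ i → γ i ≢ z) → ũ z ≡ 0ℤ
    ũ-nongap γ≢z = ∑-zero E λ {i} _ → trans (cong (m i *_) (δ-≢ (γ≢z i))) (ℤ.*-zeroʳ (m i))

    N : ℤ → ℤ
    N z = ũ z + m top * 𝟏S z

    N-neg : ∀ {z} → z ℤ.< 0ℤ → N z ≡ 0ℤ
    N-neg z<0 = trans (cong₂ (λ u v → u + m top * v) (ũ-nongap (λ { i refl → ℤ.<-asym z<0 (0<γ i) })) (𝟏S-neg z<0))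
      (trans (ℤ.+-identityˡ _) (ℤ.*-zeroʳ (m top)))

    N-gap : ∀ i → N (γ i) ≡ m i
    N-gap i = trans (cong₂ (λ u v → u + m top * v) (ũ-gap i) (𝟏S-gap i))
      (trans (cong (λ u → m i + u) (ℤ.*-zeroʳ (m top))) (ℤ.+-identityʳ (m i)))

    N-S : ∀ {z} → InS z → N z ≡ m top
    N-S z∈S = trans (cong₂ (λ u v → u + m top * v) (ũ-nongap (λ { i refl → gap∉S i z∈S })) (𝟏S-S z∈S))
      (trans (ℤ.+-identityˡ _) (ℤ.*-identityʳ (m top)))

    -- N has infinite support but its differences do not: 𝒫 φ = Σ_z α z · φ z and ℛ φ = Σ_z β z · φ z.
    𝓕 : ℤ → ℕ → ℤ → (ℤ → ℤ) → ℤ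
    𝓕 c n d φ = ∑ E (λ i → m i * (φ (γ i) - φ (γ i + c))) + m top * ∑ (upTo n) (λ k → φ (+ k * d))

    𝒫 ℛ : (ℤ → ℤ) → ℤ
    𝒫 = 𝓕 (+ a) a (+ b)
    ℛ = 𝓕 (+ b) b (+ a)

    module _ (c : ℤ) (n : ℕ) (d : ℤ) where

      𝓕-cong∈ : ∀ φ ψ → (∀ i → φ (γ i) ≡ ψ (γ i)) → (∀ i → φ (γ i + c) ≡ ψ (γ i + c)) →
                (∀ k → k < n → φ (+ k * d) ≡ ψ (+ k * d)) → 𝓕 c n d φ ≡ 𝓕 c n d ψ
      𝓕-cong∈ φ ψ h₁ h₂ h₃ = cong₂ (λ u v → u + m top * v)
        (∑-cong E λ i → cong₂ (λ u v → m i * (u - v)) (h₁ i) (h₂ i))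
        (∑-cong∈ (upTo n) λ {k} k∈ → h₃ k (∈-upTo⁻ k∈))

      𝓕-cong : ∀ φ ψ → (∀ p → φ p ≡ ψ p) → 𝓕 c n d φ ≡ 𝓕 c n d ψ
      𝓕-cong φ ψ h = 𝓕-cong∈ φ ψ (λ i → h (γ i)) (λ i → h (γ i + c)) (λ k _ → h (+ k * d))

      𝓕-zero : 𝓕 c n d (λ _ → 0ℤ) ≡ 0ℤ
      𝓕-zero = trans (cong₂ (λ u v → u + m top * v) (∑-zero E λ {i} _ → ℤ.*-zeroʳ (m i)) (∑-zero (upTo n) λ _ → refl))
        (trans (ℤ.+-identityˡ _) (ℤ.*-zeroʳ (m top)))

      𝓕-+ : ∀ φ ψ → 𝓕 c n d (λ p → φ p + ψ p) ≡ 𝓕 c n d φ + 𝓕 c n d ψ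
      𝓕-+ φ ψ = trans (cong₂ (λ u v → u + m top * v)
          (trans (∑-cong E λ i → lem₁ (m i) (φ (γ i)) (ψ (γ i)) (φ (γ i + c)) (ψ (γ i + c)))
                 (∑-+ E (λ i → m i * (φ (γ i) - φ (γ i + c))) (λ i → m i * (ψ (γ i) - ψ (γ i + c)))))
          (∑-+ (upTo n) (λ k → φ (+ k * d)) (λ k → ψ (+ k * d))))
        (lem₂ (∑ E (λ i → m i * (φ (γ i) - φ (γ i + c)))) (∑ E (λ i → m i * (ψ (γ i) - ψ (γ i + c))))
              (m top) (∑ (upTo n) (λ k → φ (+ k * d))) (∑ (upTo n) (λ k → ψ (+ k * d))))
        where
        lem₁ : ∀ w p q r s → w * (p + q - (r + s)) ≡ w * (p - r) + w * (q - s)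
        lem₁ = solve-∀
        lem₂ : ∀ p q w r s → p + q + w * (r + s) ≡ p + w * r + (q + w * s)
        lem₂ = solve-∀

      𝓕-* : ∀ φ x → 𝓕 c n d (λ p → φ p * x) ≡ 𝓕 c n d φ * x
      𝓕-* φ x = trans (cong₂ (λ u v → u + m top * v)
          (trans (∑-cong E λ i → lem₁ (m i) (φ (γ i)) (φ (γ i + c)) x) (∑-*ʳ E x (λ i → m i * (φ (γ i) - φ (γ i + c)))))
          (∑-*ʳ (upTo n) x (λ k → φ (+ k * d))))
        (lem₂ (∑ E (λ i → m i * (φ (γ i) - φ (γ i + c)))) (m top) (∑ (upTo n) (λ k → φ (+ k * d))) x)
        where
        lem₁ : ∀ w p r x → w * (p * x - r * x) ≡ w * (p - r) * x
        lem₁ = solve-∀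
        lem₂ : ∀ p w r x → p * x + w * (r * x) ≡ (p + w * r) * x
        lem₂ = solve-∀

      𝓕-∑ : ∀ {A : Set} (xs : List A) (f : ℤ → A → ℤ) →
            𝓕 c n d (λ p → ∑ xs (f p)) ≡ ∑ xs (λ x → 𝓕 c n d (λ p → f p x))
      𝓕-∑ []       f = 𝓕-zero
      𝓕-∑ (x ∷ xs) f = trans (𝓕-+ (λ p → f p x) (λ p → ∑ xs (f p))) (cong (λ u → 𝓕 c n d (λ p → f p x) + u) (𝓕-∑ xs f))

    α β : ℤ → ℤ
    α z = N z - N (z - + a)
    β z = N z - N (z - + b)

    private
      ũ-step : ∀ c z → ũ z - ũ (z - c) ≡ ∑ E (λ i → m i * (δ (γ i) z - δ (γ i + c) z))
      ũ-step c z = trans (sym (∑-- E (λ i → m i * δ (γ i) z) (λ i → m i * δ (γ i) (z - c))))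
        (∑-cong E λ i → trans (cong (λ u → m i * δ (γ i) z - m i * u) (sym (δ-shift c (γ i) z))) (lem (m i) _ _))
        where
        lem : ∀ x p q → x * p - x * q ≡ x * (p - q)
        lem = solve-∀
      split : ∀ p q M r s → p + M * r - (q + M * s) ≡ (p - q) + M * (r - s)
      split = solve-∀

    α≡𝒫 : ∀ z → α z ≡ 𝒫 (λ p → δ p z)
    α≡𝒫 z = trans (split (ũ z) (ũ (z - + a)) (m top) (𝟏S z) (𝟏S (z - + a)))
      (cong₂ (λ u v → u + m top * v) (ũ-step (+ a) z) (𝟏S-step-a z))

    β≡ℛ : ∀ z → β z ≡ ℛ (λ p → δ p z)
    β≡ℛ z = trans (split (ũ z) (ũ (z - + b)) (m top) (𝟏S z) (𝟏S (z - + b)))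
      (cong₂ (λ u v → u + m top * v) (ũ-step (+ b) z) (𝟏S-step-b z))

  -- Monotonicity is stated in coordinates, where lowering one of them by 1 raises the height by `a`
  -- or `b`.
  record IntCone : Set where
    field
      weight  : G a b → ℤ
      nonNeg  : ∀ i → 0ℤ ≤ weight i
      mono    : ∀ i j → X j ≤ X i → Y j ≤ Y i → weight i ≤ weight j

    n̂ : ℤ → ℤ
    n̂ = N weight

    M : ℤ
    M = weight top

    ≤top : ∀ i → weight i ≤ M
    ≤top i = mono i top (1≤X i) (1≤Y i)

    n̂-nonNeg : ∀ z → 0ℤ ≤ n̂ z
    n̂-nonNeg z = by-class (classify z)
      where
      by-class : ∀ {z} → Class z → 0ℤ ≤ n̂ z
      by-class (negative z<0) = ℤ.≤-reflexive (sym (N-neg weight z<0))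
      by-class (gap i refl)   = subst (0ℤ ≤_) (sym (N-gap weight i)) (nonNeg i)
      by-class (inS z∈S)      = subst (0ℤ ≤_) (sym (N-S weight z∈S)) (nonNeg top)

    n̂≤M : ∀ z → n̂ z ≤ M
    n̂≤M z = by-class (classify z)
      where
      by-class : ∀ {z} → Class z → n̂ z ≤ M
      by-class (negative z<0) = subst (_≤ M) (sym (N-neg weight z<0)) (nonNeg top)
      by-class (gap i refl)   = subst (_≤ M) (sym (N-gap weight i)) (≤top i)
      by-class (inS z∈S)      = ℤ.≤-reflexive (N-S weight z∈S)

    private
      -- Covers a rise by `a` or by `b`, which lowers one coordinate by 1. Either the result is
      -- again a gap, or that coordinate was 1 and the point lands on an axis, inside the semigroup,
      -- where `N` is maximal.
      gap-step : ∀ i (p : ℤ × ℤ) c → g a b p ≡ γ i + c → 0ℤ ≤ c →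
        proj₁ p ≤ X i → proj₂ p ≤ Y i → (1ℤ ≤ proj₁ p × 1ℤ ≤ proj₂ p) ⊎ InS (γ i + c) →
        n̂ (γ i) ≤ n̂ (γ i + c)
      gap-step i p c eq 0≤c px py (inj₂ s) =
        subst₂ _≤_ (sym (N-gap weight i)) (sym (N-S weight s)) (≤top i)
      gap-step i p c eq 0≤c px py (inj₁ (1≤x , 1≤y)) =
        subst₂ _≤_ (sym (N-gap weight i)) (trans (sym (N-gap weight j)) (cong n̂ eq)) (mono i j px py)
        where
          j : G a b
          j = p , [ 1≤x , 1≤y , subst (0ℤ ℤ.<_) (sym eq) (ℤ.+-mono-<-≤ (0<γ i) 0≤c) ]

      pred-or-one : ∀ x → 1ℤ ≤ x → 1ℤ ≤ x - 1ℤ ⊎ x ≡ 1ℤ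
      pred-or-one (+ 1)             _ = inj₂ refl
      pred-or-one (+ (suc (suc n))) _ = inj₁ (+≤+ (s≤s z≤n))
      pred-or-one (+ 0) (+≤+ ())

      axis∈S : ∀ c d → 0ℤ ≤ c → 0ℤ ≤ d → InS (c * + a + d * + b)
      axis∈S (+ k) (+ l) _ _ = combination∈S k l

      x-1≤x : ∀ x → x - 1ℤ ≤ x
      x-1≤x x = ≤-by {1ℤ} (+≤+ z≤n) (lem x)
        where
        lem : ∀ x → 1ℤ ≡ x - (x - 1ℤ)
        lem = solve-∀

    n̂-+a : ∀ z → n̂ z ≤ n̂ (z + + a)
    n̂-+a z = by-class (classify z)
      where
      by-class : ∀ {z} → Class z → n̂ z ≤ n̂ (z + + a)
      by-class {z} (negative z<0) = subst (_≤ n̂ (z + + a)) (sym (N-neg weight z<0)) (n̂-nonNeg _)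
      by-class (inS z∈S)    = ℤ.≤-reflexive (trans (N-S weight z∈S) (sym (N-S weight (S-+a z∈S))))
      by-class (gap i refl) = gap-step i (X i - 1ℤ , Y i) (+ a) (lem₁ (+ a) (+ b) (X i) (Y i)) (+≤+ z≤n)
                           (x-1≤x (X i)) ℤ.≤-refl (next (pred-or-one (X i) (1≤X i)))
        where
        lem₁ : ∀ a b x y → a * b - a * (x - 1ℤ) - b * y ≡ a * b - a * x - b * y + a
        lem₁ = solve-∀
        lem₂ : ∀ a b y → 0ℤ * a + (a - y) * b ≡ a * b - a * 1ℤ - b * y + a
        lem₂ = solve-∀
        next : 1ℤ ≤ X i - 1ℤ ⊎ X i ≡ 1ℤ → (1ℤ ≤ X i - 1ℤ × 1ℤ ≤ Y i) ⊎ InS (γ i + + a)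
        next (inj₁ h) = inj₁ (h , 1≤Y i)
        next (inj₂ h) = inj₂ (subst InS (trans (lem₂ (+ a) (+ b) (Y i)) (cong (λ x → + a * + b - + a * x - + b * Y i + + a) (sym h)))
          (axis∈S 0ℤ (+ a - Y i) (+≤+ z≤n) (ℤ.i≤j⇒0≤j-i (ℤ.<⇒≤ (Y<a i)))))

    n̂-+b : ∀ z → n̂ z ≤ n̂ (z + + b)
    n̂-+b z = by-class (classify z)
      where
      by-class : ∀ {z} → Class z → n̂ z ≤ n̂ (z + + b)
      by-class {z} (negative z<0) = subst (_≤ n̂ (z + + b)) (sym (N-neg weight z<0)) (n̂-nonNeg _)
      by-class (inS z∈S)    = ℤ.≤-reflexive (trans (N-S weight z∈S) (sym (N-S weight (S-+b z∈S))))
      by-class (gap i refl) = gap-step i (X i , Y i - 1ℤ) (+ b) (lem₁ (+ a) (+ b) (X i) (Y i)) (+≤+ z≤n)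
                           ℤ.≤-refl (x-1≤x (Y i)) (next (pred-or-one (Y i) (1≤Y i)))
        where
        lem₁ : ∀ a b x y → a * b - a * x - b * (y - 1ℤ) ≡ a * b - a * x - b * y + b
        lem₁ = solve-∀
        lem₂ : ∀ a b x → (b - x) * a + 0ℤ * b ≡ a * b - a * x - b * 1ℤ + b
        lem₂ = solve-∀
        next : 1ℤ ≤ Y i - 1ℤ ⊎ Y i ≡ 1ℤ → (1ℤ ≤ X i × 1ℤ ≤ Y i - 1ℤ) ⊎ InS (γ i + + b)
        next (inj₁ h) = inj₁ (1≤X i , h)
        next (inj₂ h) = inj₂ (subst InS (trans (lem₂ (+ a) (+ b) (X i)) (cong (λ y → + a * + b - + a * X i - + b * y + + b) (sym h)))
          (axis∈S (+ b - X i) 0ℤ (ℤ.i≤j⇒0≤j-i (ℤ.<⇒≤ (X<b i))) (+≤+ z≤n)))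

-- Summation by parts for two fillings.

module Pairing (a b : ℕ) (1<a : 1 < a) (a<b : a < b) (coprime : Coprime a b) where
  open Gaps a b 1<a a<b coprime
  open Filling a b 1<a a<b coprime

  -- The effect on a kernel `κ (q - p)` of differencing by `a` in `p` and by `b` in `q`.
  Λ : (ℤ → ℤ) → ℤ → ℤ
  Λ κ d = κ d - κ (d - + a) - κ (d + + b) + κ (d + + b - + a)

  -- Pairs the Apéry set of `b` with that of `a`, where the indicator of the semigroup has its
  -- differences.
  count : (ℤ → ℤ) → ℤ
  count κ = ∑ (upTo a) (λ k → ∑ (upTo b) (λ l → κ (+ l * + a - + k * + b)))

  pairing : (ℤ → ℤ) → (m m′ : G a b → ℤ) → ℤ
  pairing κ m m′ = 𝒫 m (λ p → ℛ m′ (λ q → κ (q - p)))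

  -- Balance makes the two telescoping mixed terms vanish.
  record Balanced (κ : ℤ → ℤ) : Set where
    field
      balanced-b : ∀ j → κ (γ j + + b - + a * + b) ≡ κ (γ j + + b)
      balanced-a : ∀ i → κ (+ b * + a - + a - γ i) ≡ κ (0ℤ - + a - γ i)

  -- The product of the two functionals has four parts. Gaps against gaps give `Λ κ`, lattice points
  -- against lattice points give `count κ`, and in `columns` and `rows` the mixed parts telescope to
  -- boundary values that cancel by balance.
  pairing-expand : ∀ {κ} → Balanced κ → ∀ m m′ → pairing κ m m′ ≡
    ∑ E (λ i → m i * ∑ E (λ j → m′ j * Λ κ (γ j - γ i))) + m top * (m′ top * count κ)
  pairing-expand {κ} bal m m′ = cong₂ (λ u v → u + m top * v)
    (∑-cong E λ i → cong (m i *_) (gap-part i)) lattice-part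
    where
    open Balanced bal
    open ≡-Reasoning
    D : ℤ → G a b → ℤ
    D p j = κ (γ j - p) - κ (γ j + + b - p)
    lem₁ : ∀ s t w x y → s + w * x - (t + w * y) ≡ (s - t) + w * (x - y)
    lem₁ = solve-∀
    lem₂ : ∀ w p q r s → w * (p - q) - w * (r - s) ≡ w * (p - r - q + s)
    lem₂ = solve-∀
    shift₁ : ∀ x y a → x - (y + a) ≡ x - y - a
    shift₁ = solve-∀
    shift₂ : ∀ x y b → x + b - y ≡ x - y + b
    shift₂ = solve-∀
    shift₃ : ∀ x y a b → x + b - (y + a) ≡ x - y + b - a
    shift₃ = solve-∀
    shift₄ : ∀ l a y → (1ℤ + l) * a - a - y ≡ l * a - y
    shift₄ = solve-∀
    shift₅ : ∀ l a y → l * a - a - y ≡ l * a - (y + a)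
    shift₅ = solve-∀
    columns : ∀ i → ∑ (upTo b) (λ l → κ (+ l * + a - γ i)) - ∑ (upTo b) (λ l → κ (+ l * + a - (γ i + + a))) ≡ 0ℤ
    columns i = begin
      ∑ (upTo b) (λ l → κ (+ l * + a - γ i)) - ∑ (upTo b) (λ l → κ (+ l * + a - (γ i + + a)))
        ≡⟨ ∑-- (upTo b) (λ l → κ (+ l * + a - γ i)) (λ l → κ (+ l * + a - (γ i + + a))) ⟨
      ∑ (upTo b) (λ l → κ (+ l * + a - γ i) - κ (+ l * + a - (γ i + + a)))
        ≡⟨ ∑-cong (upTo b) (λ l → cong₂ (λ u v → κ u - κ v) (sym (shift₄ (+ l) (+ a) (γ i))) (sym (shift₅ (+ l) (+ a) (γ i)))) ⟩
      ∑ (upTo b) (λ l → κ (+ suc l * + a - + a - γ i) - κ (+ l * + a - + a - γ i))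
        ≡⟨ ∑-telescope b (λ l → κ (+ l * + a - + a - γ i)) ⟩
      κ (+ b * + a - + a - γ i) - κ (0ℤ - + a - γ i)
        ≡⟨ ℤ.i≡j⇒i-j≡0 (balanced-a i) ⟩
      0ℤ ∎
    gap-part : ∀ i → ℛ m′ (λ q → κ (q - γ i)) - ℛ m′ (λ q → κ (q - (γ i + + a))) ≡ ∑ E (λ j → m′ j * Λ κ (γ j - γ i))
    gap-part i = begin
      ℛ m′ (λ q → κ (q - γ i)) - ℛ m′ (λ q → κ (q - (γ i + + a)))
        ≡⟨ lem₁ (∑ E (λ j → m′ j * D (γ i) j)) (∑ E (λ j → m′ j * D (γ i + + a) j)) (m′ top)
             (∑ (upTo b) (λ l → κ (+ l * + a - γ i))) (∑ (upTo b) (λ l → κ (+ l * + a - (γ i + + a)))) ⟩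
      (∑ E (λ j → m′ j * D (γ i) j) - ∑ E (λ j → m′ j * D (γ i + + a) j)) + m′ top *
        (∑ (upTo b) (λ l → κ (+ l * + a - γ i)) - ∑ (upTo b) (λ l → κ (+ l * + a - (γ i + + a))))
        ≡⟨ cong₂ (λ u v → u + m′ top * v) (sym (∑-- E (λ j → m′ j * D (γ i) j) (λ j → m′ j * D (γ i + + a) j))) (columns i) ⟩
      ∑ E (λ j → m′ j * D (γ i) j - m′ j * D (γ i + + a) j) + m′ top * 0ℤ
        ≡⟨ trans (cong (λ u → ∑ E (λ j → m′ j * D (γ i) j - m′ j * D (γ i + + a) j) + u) (ℤ.*-zeroʳ (m′ top))) (ℤ.+-identityʳ _) ⟩
      ∑ E (λ j → m′ j * D (γ i) j - m′ j * D (γ i + + a) j)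
        ≡⟨ ∑-cong E (λ j → trans (lem₂ (m′ j) (κ (γ j - γ i)) (κ (γ j + + b - γ i)) (κ (γ j - (γ i + + a))) (κ (γ j + + b - (γ i + + a))))
             (cong (m′ j *_) (cong₂ _+_ (cong₂ (λ u v → κ (γ j - γ i) - κ u - κ v) (shift₁ (γ j) (γ i) (+ a)) (shift₂ (γ j) (γ i) (+ b)))
               (cong κ (shift₃ (γ j) (γ i) (+ a) (+ b)))))) ⟩
      ∑ E (λ j → m′ j * Λ κ (γ j - γ i)) ∎
    shift₆ : ∀ x b k → x + b - (1ℤ + k) * b ≡ x - k * b
    shift₆ = solve-∀
    rows : ∀ j → ∑ (upTo a) (λ k → D (+ k * + b) j) ≡ 0ℤ
    rows j = begin
      ∑ (upTo a) (λ k → κ (γ j - + k * + b) - κ (γ j + + b - + k * + b))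
        ≡⟨ ∑-cong (upTo a) (λ k → cong (λ u → κ u - κ (γ j + + b - + k * + b)) (sym (shift₆ (γ j) (+ b) (+ k)))) ⟩
      ∑ (upTo a) (λ k → κ (γ j + + b - + suc k * + b) - κ (γ j + + b - + k * + b))
        ≡⟨ ∑-telescope a (λ k → κ (γ j + + b - + k * + b)) ⟩
      κ (γ j + + b - + a * + b) - κ (γ j + + b - 0ℤ)
        ≡⟨ ℤ.i≡j⇒i-j≡0 (trans (balanced-b j) (cong κ (sym (ℤ.+-identityʳ (γ j + + b))))) ⟩
      0ℤ ∎
    lattice-part : ∑ (upTo a) (λ k → ℛ m′ (λ q → κ (q - + k * + b))) ≡ m′ top * count κ
    lattice-part = begin
      ∑ (upTo a) (λ k → ℛ m′ (λ q → κ (q - + k * + b)))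
        ≡⟨ ∑-+ (upTo a) (λ k → ∑ E (λ j → m′ j * D (+ k * + b) j)) (λ k → m′ top * ∑ (upTo b) (λ l → κ (+ l * + a - + k * + b))) ⟩
      ∑ (upTo a) (λ k → ∑ E (λ j → m′ j * D (+ k * + b) j)) + ∑ (upTo a) (λ k → m′ top * ∑ (upTo b) (λ l → κ (+ l * + a - + k * + b)))
        ≡⟨ cong₂ _+_ (∑-swap (upTo a) E (λ k j → m′ j * D (+ k * + b) j)) (∑-*ˡ (upTo a) (m′ top) (λ k → ∑ (upTo b) (λ l → κ (+ l * + a - + k * + b)))) ⟩
      ∑ E (λ j → ∑ (upTo a) (λ k → m′ j * D (+ k * + b) j)) + m′ top * count κ
        ≡⟨ cong (_+ m′ top * count κ) (∑-zero E λ {j} _ → trans (∑-*ˡ (upTo a) (m′ j) (λ k → D (+ k * + b) j))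
             (trans (cong (m′ j *_) (rows j)) (ℤ.*-zeroʳ (m′ j)))) ⟩
      0ℤ + m′ top * count κ
        ≡⟨ ℤ.+-identityˡ _ ⟩
      m′ top * count κ ∎

-- Decomposition into layers and crossings between layers.

layer-cake : ∀ μ x → 0ℤ ≤ x → x ≤ + μ → x ≡ ∑ (upTo μ) (λ s → ⟦ + s ℤ.<? x ⟧)
layer-cake μ (+ n) _ (+≤+ n≤μ) = trans (cong +_ (sym (ℕ.m≤n⇒m⊓n≡m n≤μ))) (sym (truncated μ))
  where
  layer : ∀ μ → Dec (μ < n) → + (n ℕ.⊓ μ) + ⟦ + μ ℤ.<? + n ⟧ ≡ + (n ℕ.⊓ suc μ)
  layer μ (yes μ<n) = trans (cong₂ _+_ (cong +_ (ℕ.m≥n⇒m⊓n≡n (ℕ.<⇒≤ μ<n))) (⟦⟧-yes (+ μ ℤ.<? + n) (ℤ.+<+ μ<n)))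
    (trans (ℤ.+-comm (+ μ) 1ℤ) (cong +_ (sym (ℕ.m≥n⇒m⊓n≡n μ<n))))
  layer μ (no μ≮n) = trans (cong₂ _+_ (cong +_ (ℕ.m≤n⇒m⊓n≡m (ℕ.≮⇒≥ μ≮n))) (⟦⟧-no (+ μ ℤ.<? + n) (λ { (ℤ.+<+ h) → μ≮n h })))
    (trans (ℤ.+-identityʳ (+ n)) (cong +_ (sym (ℕ.m≤n⇒m⊓n≡m (ℕ.m≤n⇒m≤1+n (ℕ.≮⇒≥ μ≮n))))))
  truncated : ∀ μ → ∑ (upTo μ) (λ s → ⟦ + s ℤ.<? + n ⟧) ≡ + (n ℕ.⊓ μ)
  truncated zero    = cong +_ (sym (ℕ.⊓-zeroʳ n))
  truncated (suc μ) = trans (∑-upTo-suc μ (λ s → ⟦ + s ℤ.<? + n ⟧))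
    (trans (cong (_+ ⟦ + μ ℤ.<? + n ⟧) (truncated μ)) (layer μ (μ ℕ.<? n)))

module Crossing (a b : ℕ) (1<a : 1 < a) (a<b : a < b) (coprime : Coprime a b) where
  open Gaps a b 1<a a<b coprime
  open Filling a b 1<a a<b coprime
  open Pairing a b 1<a a<b coprime

  -- The sum of `α z · β′ (z + t)` over all `z`, expressed by the functional `𝒫` so that it is
  -- finite by construction.
  crossings : (m m′ : G a b → ℤ) → ℤ → ℤ
  crossings m m′ t = 𝒫 m (λ p → β m′ (p + t))

  crossings≡pairing : ∀ m m′ t → crossings m m′ t ≡ pairing (λ d → δ d t) m m′
  crossings≡pairing m m′ t = 𝓕-cong m (+ a) a (+ b) (λ p → β m′ (p + t)) (λ p → ℛ m′ (λ q → δ (q - p) t))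
    λ p → trans (β≡ℛ m′ (p + t)) (𝓕-cong m′ (+ b) b (+ a) (λ q → δ q (p + t)) (λ q → δ (q - p) t) λ q →
      trans (cong (δ q) (lem p t)) (sym (δ-shift (- p) q t)))
    where
    lem : ∀ p t → p + t ≡ t - - p
    lem = solve-∀

  -- All points sampled by `𝒫`, namely `γ i`, `γ i + a` and `k b` with `k < a`, lie in `0 ≤ z < L`.
  L : ℕ
  L = a ℕ.* b ℕ.+ a

  +L : + L ≡ + a * + b + + a
  +L = cong (_+ + a) (ℤ.pos-* a b)

  γ<ab : ∀ i → γ i ℤ.< + a * + b
  γ<ab i = ℤ.≤-<-trans (≤-by (0≤+ (0≤* (+≤+ (z≤n {a})) (ℤ.i≤j⇒0≤j-i (1≤X i)))
                                  (0≤* (+≤+ (z≤n {b})) (ℤ.<⇒≤ (ℤ.<-≤-trans (ℤ.+<+ (s≤s z≤n)) (1≤Y i)))))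
                             (lem₁ (+ a) (+ b) (X i) (Y i)))
                       (subst (+ a * + b - + a ℤ.<_) (ℤ.+-identityʳ (+ a * + b)) (ℤ.+-monoʳ-< (+ a * + b) (ℤ.neg-mono-< 0<a)))
    where
    lem₁ : ∀ a b x y → a * (x - 1ℤ) + b * y ≡ a * b - a - (a * b - a * x - b * y)
    lem₁ = solve-∀

  γ+a<L : ∀ i → γ i + + a ℤ.< + L
  γ+a<L i = subst (γ i + + a ℤ.<_) (sym +L) (ℤ.+-monoˡ-< (+ a) (γ<ab i))

  γ<L : ∀ i → γ i ℤ.< + L
  γ<L i = ℤ.≤-<-trans (ℤ.i≤i+j (γ i) (+ a)) (γ+a<L i)

  pick : ∀ (ψ : ℤ → ℤ) p → 0ℤ ≤ p → p ℤ.< + L → ∑ (upTo L) (λ z → δ p (+ z) * ψ (+ z)) ≡ ψ p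
  pick ψ (+ n) _ (ℤ.+<+ n<L) = trans
    (∑-single (upTo-unique L) (∈-upTo⁺ n<L) (λ z → δ (+ n) (+ z) * ψ (+ z))
      (λ {z} _ z≢n → trans (cong (_* ψ (+ z)) (δ-≢ (λ e → z≢n (sym (ℤ.+-injective e))))) (ℤ.*-zeroˡ (ψ (+ z)))))
    (trans (cong (_* ψ (+ n)) (δ-refl (+ n))) (ℤ.*-identityˡ (ψ (+ n))))

  𝒫-density : ∀ m ψ → 𝒫 m ψ ≡ ∑ (upTo L) (λ z → α m (+ z) * ψ (+ z))
  𝒫-density m ψ = sym (begin
    ∑ (upTo L) (λ z → α m (+ z) * ψ (+ z))
      ≡⟨ ∑-cong (upTo L) (λ z → trans (cong (_* ψ (+ z)) (α≡𝒫 m (+ z))) (sym (𝓕-* m (+ a) a (+ b) (λ p → δ p (+ z)) (ψ (+ z))))) ⟩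
    ∑ (upTo L) (λ z → 𝒫 m (λ p → δ p (+ z) * ψ (+ z)))
      ≡⟨ 𝓕-∑ m (+ a) a (+ b) (upTo L) (λ p z → δ p (+ z) * ψ (+ z)) ⟨
    𝒫 m (λ p → ∑ (upTo L) (λ z → δ p (+ z) * ψ (+ z)))
      ≡⟨ 𝓕-cong∈ m (+ a) a (+ b) (λ p → ∑ (upTo L) (λ z → δ p (+ z) * ψ (+ z))) ψ
           (λ i → pick ψ (γ i) (ℤ.<⇒≤ (0<γ i)) (γ<L i))
           (λ i → pick ψ (γ i + + a) (0≤+ (ℤ.<⇒≤ (0<γ i)) (+≤+ z≤n)) (γ+a<L i))
           (λ k k<a → pick ψ (+ k * + b) (0≤* {+ k} {+ b} (+≤+ z≤n) (+≤+ z≤n)) (kb<L k k<a)) ⟩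
    𝒫 m ψ ∎)
    where
    open ≡-Reasoning
    kb<L : ∀ k → k < a → + k * + b ℤ.< + L
    kb<L k k<a = subst (ℤ._< + L) (ℤ.pos-* k b) (ℤ.+<+ (ℕ.<-≤-trans (ℕ.*-monoˡ-< b k<a) (ℕ.m≤m+n (a ℕ.* b) a)))

  crossings-density : ∀ m m′ t → crossings m m′ t ≡ ∑ (upTo L) (λ z → α m (+ z) * β m′ (+ z + t))
  crossings-density m m′ t = 𝒫-density m (λ p → β m′ (p + t))

  module _ (c : IntCone) where
    open IntCone c

    U : ℕ → ℤ → Set
    U s z = + s ℤ.< n̂ z

    U? : ∀ s z → Dec (U s z)
    U? s z = + s ℤ.<? n̂ z

    private
      x-c+c : ∀ z c → z - c + c ≡ z
      x-c+c = solve-∀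

    n̂-a : ∀ z → n̂ (z - + a) ≤ n̂ z
    n̂-a z = subst (λ u → n̂ (z - + a) ≤ n̂ u) (x-c+c z (+ a)) (n̂-+a (z - + a))

    n̂-b : ∀ z → n̂ (z - + b) ≤ n̂ z
    n̂-b z = subst (λ u → n̂ (z - + b) ≤ n̂ u) (x-c+c z (+ b)) (n̂-+b (z - + b))

    α-nonNeg : ∀ z → 0ℤ ≤ α weight z
    α-nonNeg z = ℤ.i≤j⇒0≤j-i (n̂-a z)

    β-nonNeg : ∀ z → 0ℤ ≤ β weight z
    β-nonNeg z = ℤ.i≤j⇒0≤j-i (n̂-b z)

    μ : ℕ
    μ = ℤ.∣ M ∣

    +μ : + μ ≡ M
    +μ = ℤ.0≤i⇒+∣i∣≡i (nonNeg top)

    n̂-layers : ∀ z → n̂ z ≡ ∑ (upTo μ) (λ s → ⟦ U? s z ⟧)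
    n̂-layers z = layer-cake μ (n̂ z) (n̂-nonNeg z) (subst (n̂ z ≤_) (sym +μ) (n̂≤M z))

    U-up : ∀ {s} → s < μ → UpSet a b (U s)
    U-up {s} s<μ = record
      { dec   = U? s
      ; up-a  = λ {z} u → ℤ.<-≤-trans u (n̂-+a z)
      ; up-b  = λ {z} u → ℤ.<-≤-trans u (n̂-+b z)
      ; neg   = λ z<0 u → ℤ.<⇒≱ (subst (+ s ℤ.<_) (N-neg weight z<0) u) (+≤+ z≤n)
      ; zero∈ = subst (+ s ℤ.<_) (trans +μ (sym (N-S weight (combination∈S 0 0)))) (ℤ.+<+ s<μ)
      }

    -- A point `z - a` outside a superlevel set is not in the semigroup, where `N` is maximal. So it
    -- is negative or a gap and lies below `a b`; thus every crossing falls within the range of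
    -- summation.
    U-bounded : ∀ {s} → s < μ → ∀ {z} → U s z → ¬ U s (z - + a) → ∃ λ n → n < L × z ≡ + n
    U-bounded {s} s<μ {z} u ¬u = below z 0≤z (subst (z ℤ.<_) (sym +L) (z<ab+a (classify (z - + a))))
      where
      0≤z : 0ℤ ≤ z
      0≤z = ℤ.≮⇒≥ λ z<0 → UpSet.neg (U-up s<μ) z<0 u
      below : ∀ z → 0ℤ ≤ z → z ℤ.< + L → ∃ λ n → n < L × z ≡ + n
      below (+ n) _ (ℤ.+<+ n<L) = n , n<L , refl
      z-a<ab : Class (z - + a) → z - + a ℤ.< + a * + b
      z-a<ab (negative h) = ℤ.<-≤-trans h (0≤* {+ a} {+ b} (+≤+ z≤n) (+≤+ z≤n))
      z-a<ab (gap i eq)   = subst (ℤ._< + a * + b) eq (γ<ab i)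
      z-a<ab (inS h)      = contradiction (subst (+ s ℤ.<_) (trans +μ (sym (N-S weight h))) (ℤ.+<+ s<μ)) ¬u
      z<ab+a : Class (z - + a) → z ℤ.< + a * + b + + a
      z<ab+a h = subst (ℤ._< + a * + b + + a) (x-c+c z (+ a)) (ℤ.+-monoˡ-< (+ a) (z-a<ab h))

  swap-up : ∀ {U} → UpSet a b U → UpSet b a U
  swap-up up = record { dec = dec ; up-a = up-b ; up-b = up-a ; neg = neg ; zero∈ = zero∈ }
    where open UpSet up

  -- `common-generator` translates by less than its modulus, in one direction. A negative `t` uses
  -- modulus `a`; for `t ≥ 0` the sets and the moduli are exchanged, so the modulus is `b`.
  common-crossing : ∀ {U V : ℤ → Set} → UpSet a b U → UpSet a b V → ∀ t → - + a ℤ.< t → t ℤ.< + b →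
    ∃ λ z → (U z × ¬ U (z - + a)) × (V (z + t) × ¬ V (z + t - + b))
  common-crossing {U} {V} upU upV (+ n) _ (ℤ.+<+ n<b) =
    let z , (v , ¬v) , (u , ¬u) = common-generator (swap-up upV) (swap-up upU) (ℕ.sym coprime) (ℕ.>-nonZero⁻¹ a) n<b
    in z - + n , (u , ¬u) , (subst V (lem z) v , λ h → ¬v (subst (λ w → V (w - + b)) (sym (lem z)) h))
    where
    lem′ : ∀ z n → z ≡ z - n + n
    lem′ = solve-∀
    lem : ∀ z → z ≡ z - + n + + n
    lem z = lem′ z (+ n)
  common-crossing upU upV (-[1+ n ]) -a<t _ = common-generator upU upV coprime (ℕ.>-nonZero⁻¹ b) (1+n<a a -a<t)
    where
    1+n<a : ∀ a → - + a ℤ.< -[1+ n ] → suc n < a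
    1+n<a (suc a) (ℤ.-<- h) = s≤s h

  module _ (c c′ : IntCone) where
    private
      module C = IntCone c
      module C′ = IntCone c′

      σ : ℕ → ℕ → ℤ
      σ s z = ⟦ U? c s (+ z) ⟧ - ⟦ U? c s (+ z - + a) ⟧

      τ : ℕ → ℤ → ℤ
      τ s w = ⟦ U? c′ s w ⟧ - ⟦ U? c′ s (w - + b) ⟧

      σ-nonNeg : ∀ s z → 0ℤ ≤ σ s z
      σ-nonNeg s z = ℤ.i≤j⇒0≤j-i (⟦⟧-mono (U? c s (+ z - + a)) (U? c s (+ z)) (λ h → ℤ.<-≤-trans h (n̂-a c (+ z))))

      τ-nonNeg : ∀ s w → 0ℤ ≤ τ s w
      τ-nonNeg s w = ℤ.i≤j⇒0≤j-i (⟦⟧-mono (U? c′ s (w - + b)) (U? c′ s w) (λ h → ℤ.<-≤-trans h (n̂-b c′ w)))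

      α-layers : ∀ z → α C.weight (+ z) ≡ ∑ (upTo (μ c)) (λ s → σ s z)
      α-layers z = trans (cong₂ _-_ (n̂-layers c (+ z)) (n̂-layers c (+ z - + a)))
        (sym (∑-- (upTo (μ c)) (λ s → ⟦ U? c s (+ z) ⟧) (λ s → ⟦ U? c s (+ z - + a) ⟧)))

      β-layers : ∀ w → β C′.weight w ≡ ∑ (upTo (μ c′)) (λ s → τ s w)
      β-layers w = trans (cong₂ _-_ (n̂-layers c′ w) (n̂-layers c′ (w - + b)))
        (sym (∑-- (upTo (μ c′)) (λ s → ⟦ U? c′ s w ⟧) (λ s → ⟦ U? c′ s (w - + b) ⟧)))

    module _ (t : ℤ) (-a<t : - + a ℤ.< t) (t<b : t ℤ.< + b) where
      private
        layer-crossing : ∀ s s′ → s < μ c → s′ < μ c′ → 1ℤ ≤ ∑ (upTo L) (λ z → σ s z * τ s′ (+ z + t))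
        layer-crossing s s′ s<μ s′<μ′ = at (common-crossing (U-up c s<μ) (U-up c′ s′<μ′) t -a<t t<b)
          where
          at : (∃ λ z → (U c s z × ¬ U c s (z - + a)) × (U c′ s′ (z + t) × ¬ U c′ s′ (z + t - + b))) →
               1ℤ ≤ ∑ (upTo L) (λ z → σ s z * τ s′ (+ z + t))
          at (z , (u , ¬u) , (v , ¬v)) = at-ℕ (U-bounded c s<μ u ¬u) u ¬u v ¬v
            where
            at-ℕ : ∀ {z} → (∃ λ n → n < L × z ≡ + n) → U c s z → ¬ U c s (z - + a) →
                   U c′ s′ (z + t) → ¬ U c′ s′ (z + t - + b) →
                   1ℤ ≤ ∑ (upTo L) (λ z → σ s z * τ s′ (+ z + t))
            at-ℕ (n , n<L , refl) u ¬u v ¬v = subst (_≤ ∑ (upTo L) (λ z → σ s z * τ s′ (+ z + t)))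
              (cong₂ _*_ (cong₂ _-_ (⟦⟧-yes (U? c s (+ n)) u) (⟦⟧-no (U? c s (+ n - + a)) ¬u))
                         (cong₂ _-_ (⟦⟧-yes (U? c′ s′ (+ n + t)) v) (⟦⟧-no (U? c′ s′ (+ n + t - + b)) ¬v)))
              (∑-member (λ {z} _ → 0≤* (σ-nonNeg s z) (τ-nonNeg s′ (+ z + t))) (∈-upTo⁺ n<L))

      crossings-layers : crossings C.weight C′.weight t ≡
        ∑ (upTo (μ c)) (λ s → ∑ (upTo (μ c′)) (λ s′ → ∑ (upTo L) (λ z → σ s z * τ s′ (+ z + t))))
      crossings-layers = begin
        crossings C.weight C′.weight t
          ≡⟨ crossings-density C.weight C′.weight t ⟩
        ∑ (upTo L) (λ z → α C.weight (+ z) * β C′.weight (+ z + t))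
          ≡⟨ ∑-cong (upTo L) (λ z → trans (cong₂ _*_ (α-layers z) (β-layers (+ z + t)))
               (∑-product (upTo (μ c)) (upTo (μ c′)) (λ s → σ s z) (λ s′ → τ s′ (+ z + t)))) ⟩
        ∑ (upTo L) (λ z → ∑ (upTo (μ c)) (λ s → ∑ (upTo (μ c′)) (λ s′ → σ s z * τ s′ (+ z + t))))
          ≡⟨ ∑-swap (upTo L) (upTo (μ c)) (λ z s → ∑ (upTo (μ c′)) (λ s′ → σ s z * τ s′ (+ z + t))) ⟩
        ∑ (upTo (μ c)) (λ s → ∑ (upTo L) (λ z → ∑ (upTo (μ c′)) (λ s′ → σ s z * τ s′ (+ z + t))))
          ≡⟨ ∑-cong (upTo (μ c)) (λ s → ∑-swap (upTo L) (upTo (μ c′)) (λ z s′ → σ s z * τ s′ (+ z + t))) ⟩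
        ∑ (upTo (μ c)) (λ s → ∑ (upTo (μ c′)) (λ s′ → ∑ (upTo L) (λ z → σ s z * τ s′ (+ z + t)))) ∎
        where open ≡-Reasoning

      -- One crossing for each of the `M M′` pairs of layers.
      crossings-bound : C.M * C′.M ≤ crossings C.weight C′.weight t
      crossings-bound = subst₂ _≤_ total (sym crossings-layers)
        (∑-mono (upTo (μ c)) (λ {s} s∈ → ∑-mono (upTo (μ c′)) (λ {s′} s′∈ →
          layer-crossing s s′ (∈-upTo⁻ s∈) (∈-upTo⁻ s′∈))))
        where
        constant : ∀ n x → ∑ (upTo n) (λ _ → x) ≡ + n * x
        constant n x = trans (∑-const (upTo n) x) (cong (λ k → + k * x) (length-upTo n))
        total : ∑ (upTo (μ c)) (λ _ → ∑ (upTo (μ c′)) (λ _ → 1ℤ)) ≡ C.M * C′.M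
        total = trans (constant (μ c) _) (cong₂ _*_ (+μ c) (trans (constant (μ c′) 1ℤ) (trans (ℤ.*-identityʳ (+ μ c′)) (+μ c′))))

∑-two-members : ∀ {A : Set} {xs : List A} {f : A → ℤ} → (∀ {x} → x ∈ xs → 0ℤ ≤ f x) →
  ∀ {x y} → x ∈ xs → y ∈ xs → x ≢ y → f x + f y ≤ ∑ xs f
∑-two-members 0≤f (here refl) (here refl) x≢y = contradiction refl x≢y
∑-two-members {f = f} 0≤f {x} (here refl) (there y∈) x≢y = ℤ.+-monoʳ-≤ (f x) (∑-member (0≤f ∘ there) y∈)
∑-two-members {xs = y ∷ xs} {f} 0≤f {x} (there x∈) (here refl) x≢y =
  subst (_≤ f y + ∑ xs f) (ℤ.+-comm (f y) (f x)) (ℤ.+-monoʳ-≤ (f y) (∑-member (0≤f ∘ there) x∈))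
∑-two-members {xs = z ∷ xs} {f} 0≤f {x} {y} (there x∈) (there y∈) x≢y =
  subst (_≤ f z + ∑ xs f) (ℤ.+-identityˡ (f x + f y)) (ℤ.+-mono-≤ (0≤f (here refl)) (∑-two-members (0≤f ∘ there) x∈ y∈ x≢y))

-- The bilinear form as a sum of crossing excesses.

module IntegerForm (a b : ℕ) (1<a : 1 < a) (a<b : a < b) (coprime : Coprime a b) where
  open Gaps a b 1<a a<b coprime
  open Filling a b 1<a a<b coprime
  open Pairing a b 1<a a<b coprime
  open Crossing a b 1<a a<b coprime

  -- Twice the form `B`, to remain in the integers.
  Bℤ : (m m′ : G a b → ℤ) → ℤ
  Bℤ m m′ = ∑ E (λ i → ∑ E (λ j → K a b (γ j - γ i) * (m i * m′ j + m′ i * m j)))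

  -- Indicator of `- a < d < b`.
  W : ℤ → ℤ
  W d = H d (1ℤ - + a) - H d (+ b)

  -- Reflecting the steps of `K (- d)` by `H-neg` and translating those of `Λ W d` by `H-shift`
  -- turns both sides into combinations of the same eight steps in `d`.
  K-symmetrised : ∀ d → K a b d + K a b (- d) ≡ Λ W d
  K-symmetrised d = trans
    (cong₂ (λ u v → K a b d + (u - v - H (- d) (+ b) + H (- d) (+ a + + b))) (H-neg d 0ℤ) (H-neg d (+ a)))
    (trans (cong₂ (λ u v → K a b d + (1ℤ - H d 1ℤ - (1ℤ - H d (1ℤ - + a)) - u + v)) (H-neg d (+ b)) (H-neg d (+ a + + b)))
    (trans (rearrange (H d 0ℤ) (H d (+ a)) (H d (+ b)) (H d (+ a + + b)) (H d 1ℤ) (H d (1ℤ - + a)) (H d (1ℤ - + b)) (H d (1ℤ - (+ a + + b))))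
    (sym (cong₂ _+_ (cong₂ (λ u v → W d - u - v)
        (cong₂ _-_ (shift (d - + a) (1ℤ - + a) (- + a) 1ℤ refl (c₁ (+ a))) (shift (d - + a) (+ b) (- + a) (+ a + + b) refl (c₂ (+ a) (+ b))))
        (cong₂ _-_ (shift (d + + b) (1ℤ - + a) (+ b) (1ℤ - (+ a + + b)) refl (c₃ (+ a) (+ b))) (shift (d + + b) (+ b) (+ b) 0ℤ refl (c₄ (+ b)))))
        (cong₂ _-_ (shift (d + + b - + a) (1ℤ - + a) (+ b - + a) (1ℤ - + b) (c₅ d (+ a) (+ b)) (c₆ (+ a) (+ b)))
                   (shift (d + + b - + a) (+ b) (+ b - + a) (+ a) (c₅ d (+ a) (+ b)) (c₇ (+ a) (+ b))))))))
    where
    shift : ∀ x c e c′ → x ≡ d + e → c - e ≡ c′ → H x c ≡ H d c′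
    shift _ c e _ refl refl = H-shift d c e
    c₁ : ∀ a → 1ℤ - a - - a ≡ 1ℤ
    c₁ = solve-∀
    c₂ : ∀ a b → b - - a ≡ a + b
    c₂ = solve-∀
    c₃ : ∀ a b → 1ℤ - a - b ≡ 1ℤ - (a + b)
    c₃ = solve-∀
    c₄ : ∀ b → b - b ≡ 0ℤ
    c₄ = solve-∀
    c₅ : ∀ d a b → d + b - a ≡ d + (b - a)
    c₅ = solve-∀
    c₆ : ∀ a b → 1ℤ - a - (b - a) ≡ 1ℤ - b
    c₆ = solve-∀
    c₇ : ∀ a b → b - (b - a) ≡ a
    c₇ = solve-∀
    rearrange : ∀ h₀ ha hb hab h₁ h₁a h₁b h₁ab →
      h₀ - ha - hb + hab + (1ℤ - h₁ - (1ℤ - h₁a) - (1ℤ - h₁b) + (1ℤ - h₁ab)) ≡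
      (h₁a - hb) - (h₁ - hab) - (h₁ab - h₀) + (h₁b - ha)
    rearrange = solve-∀

  -- Renaming `i` and `j` in the second half of the sum collects the coefficient `κ i j + κ j i` at
  -- `m i m′ j`.
  Bℤ≡ : ∀ m m′ → Bℤ m m′ ≡ ∑ E (λ i → m i * ∑ E (λ j → m′ j * Λ W (γ j - γ i)))
  Bℤ≡ m m′ = begin
    Bℤ m m′
      ≡⟨ ∑-cong E (λ i → trans (∑-cong E (λ j → expand (κ i j) (m i) (m′ j) (m′ i) (m j)))
           (∑-+ E (λ j → κ i j * (m i * m′ j)) (λ j → κ i j * (m j * m′ i)))) ⟩
    ∑ E (λ i → ∑ E (λ j → κ i j * (m i * m′ j)) + ∑ E (λ j → κ i j * (m j * m′ i)))
      ≡⟨ ∑-+ E (λ i → ∑ E (λ j → κ i j * (m i * m′ j))) (λ i → ∑ E (λ j → κ i j * (m j * m′ i))) ⟩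
    ∑ E (λ i → ∑ E (λ j → κ i j * (m i * m′ j))) + ∑ E (λ i → ∑ E (λ j → κ i j * (m j * m′ i)))
      ≡⟨ cong (λ u → ∑ E (λ i → ∑ E (λ j → κ i j * (m i * m′ j))) + u) (∑-swap E E (λ i j → κ i j * (m j * m′ i))) ⟩
    ∑ E (λ i → ∑ E (λ j → κ i j * (m i * m′ j))) + ∑ E (λ i → ∑ E (λ j → κ j i * (m i * m′ j)))
      ≡⟨ ∑-+ E (λ i → ∑ E (λ j → κ i j * (m i * m′ j))) (λ i → ∑ E (λ j → κ j i * (m i * m′ j))) ⟨
    ∑ E (λ i → ∑ E (λ j → κ i j * (m i * m′ j)) + ∑ E (λ j → κ j i * (m i * m′ j)))
      ≡⟨ ∑-cong E (λ i → trans (sym (∑-+ E (λ j → κ i j * (m i * m′ j)) (λ j → κ j i * (m i * m′ j))))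
           (trans (∑-cong E (λ j → trans (collect (κ i j) (κ j i) (m i) (m′ j))
             (cong (λ u → m i * (m′ j * u)) (trans (cong (λ d → κ i j + K a b d) (antisymmetric (γ i) (γ j))) (K-symmetrised (γ j - γ i))))))
             (∑-*ˡ E (m i) (λ j → m′ j * Λ W (γ j - γ i))))) ⟩
    ∑ E (λ i → m i * ∑ E (λ j → m′ j * Λ W (γ j - γ i))) ∎
    where
    open ≡-Reasoning
    κ : G a b → G a b → ℤ
    κ i j = K a b (γ j - γ i)
    expand : ∀ k x y′ x′ y → k * (x * y′ + x′ * y) ≡ k * (x * y′) + k * (y * x′)
    expand = solve-∀
    collect : ∀ k l x y → k * (x * y) + l * (x * y) ≡ x * (y * (k + l))
    collect = solve-∀
    antisymmetric : ∀ x y → x - y ≡ - (y - x)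
    antisymmetric = solve-∀

  -- All four arguments in `Balanced` lie outside `- a < d < b`: two because the coordinates of gaps
  -- are at least 1, the other two because heights are positive.
  outside⇒balanced : ∀ κ → (∀ d → d ≤ - + a → κ d ≡ 0ℤ) → (∀ d → + b ≤ d → κ d ≡ 0ℤ) → Balanced κ
  outside⇒balanced κ low high = record
    { balanced-b = λ j → trans
        (low _ (≤-by (0≤+ (0≤* (+≤+ (z≤n {a})) (ℤ.i≤j⇒0≤j-i (1≤X j))) (0≤* (+≤+ (z≤n {b})) (ℤ.i≤j⇒0≤j-i (1≤Y j))))
                     (lem₁ (+ a) (+ b) (X j) (Y j))))
        (sym (high _ (≤-by (ℤ.<⇒≤ (0<γ j)) (lem₂ (γ j) (+ b)))))
    ; balanced-a = λ i → trans
        (high _ (≤-by (0≤+ (0≤* (+≤+ (z≤n {a})) (ℤ.i≤j⇒0≤j-i (1≤X i))) (0≤* (+≤+ (z≤n {b})) (ℤ.i≤j⇒0≤j-i (1≤Y i))))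
                      (lem₃ (+ a) (+ b) (X i) (Y i))))
        (sym (low _ (≤-by (ℤ.<⇒≤ (0<γ i)) (lem₄ (γ i) (+ a)))))
    }
    where
    lem₁ : ∀ a b x y → a * (x - 1ℤ) + b * (y - 1ℤ) ≡ - a - (a * b - a * x - b * y + b - a * b)
    lem₁ = solve-∀
    lem₂ : ∀ x b → x ≡ x + b - b
    lem₂ = solve-∀
    lem₃ : ∀ a b x y → a * (x - 1ℤ) + b * (y - 1ℤ) ≡ b * a - a - (a * b - a * x - b * y) - b
    lem₃ = solve-∀
    lem₄ : ∀ x a → x ≡ - a - (0ℤ - a - x)
    lem₄ = solve-∀

  1-a : ℤ
  1-a = 1ℤ - + a

  private
    -a<1-a : - + a ℤ.< 1-a
    -a<1-a = ℤ.suc[i]≤j⇒i<j ℤ.≤-refl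

    1-a≤b : 1-a ≤ + b
    1-a≤b = ℤ.≤-trans (ℤ.i<j⇒suc[i]≤j (ℤ.neg-mono-< 0<a)) (+≤+ z≤n)

  W-balanced : Balanced W
  W-balanced = outside⇒balanced W
    (λ d d≤-a → cong₂ _-_ (⟦⟧-no (1-a ℤ.≤? d) (ℤ.<⇒≱ (ℤ.≤-<-trans d≤-a -a<1-a)))
                          (⟦⟧-no (+ b ℤ.≤? d) (ℤ.<⇒≱ (ℤ.<-≤-trans (ℤ.≤-<-trans d≤-a -a<1-a) 1-a≤b))))
    (λ d b≤d → cong₂ _-_ (⟦⟧-yes (1-a ℤ.≤? d) (ℤ.≤-trans 1-a≤b b≤d)) (⟦⟧-yes (+ b ℤ.≤? d) b≤d))

  δ-balanced : ∀ t → - + a ℤ.< t → t ℤ.< + b → Balanced (λ d → δ d t)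
  δ-balanced t -a<t t<b = outside⇒balanced (λ d → δ d t)
    (λ { d d≤-a → δ-≢ {d} {t} (λ { refl → ℤ.<⇒≱ -a<t d≤-a }) })
    (λ { d b≤d → δ-≢ {d} {t} (λ { refl → ℤ.<⇒≱ t<b b≤d }) })

  -- The number of heights `t` with `- a < t < b`; index `j` stands for `t = 1 - a + j`.
  window : ℕ
  window = ℕ.pred (a ℕ.+ b)

  1-a+window : 1-a + + window ≡ + b
  1-a+window = trans (lem₁ (+ a) (+ window)) (trans (cong (_- + a) suc-window) (lem₂ (+ a) (+ b)))
    where
    suc-window : 1ℤ + + window ≡ + a + + b
    suc-window = cong +_ (ℕ.suc-pred (a ℕ.+ b) {{ℕ.>-nonZero (ℕ.≤-trans (ℕ.>-nonZero⁻¹ a) (ℕ.m≤m+n a b))}})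
    lem₁ : ∀ a w → 1ℤ - a + w ≡ 1ℤ + w - a
    lem₁ = solve-∀
    lem₂ : ∀ a b → a + b - a ≡ b
    lem₂ = solve-∀

  ∑-crossings : ∀ m m′ → ∑ (upTo window) (λ j → crossings m m′ (1-a + + j)) ≡ pairing W m m′
  ∑-crossings m m′ = begin
    ∑ (upTo window) (λ j → crossings m m′ (1-a + + j))
      ≡⟨ ∑-cong (upTo window) (λ j → crossings≡pairing m m′ (1-a + + j)) ⟩
    ∑ (upTo window) (λ j → 𝒫 m (λ p → ℛ m′ (λ q → δ (q - p) (1-a + + j))))
      ≡⟨ 𝓕-∑ m (+ a) a (+ b) (upTo window) (λ p j → ℛ m′ (λ q → δ (q - p) (1-a + + j))) ⟨
    𝒫 m (λ p → ∑ (upTo window) (λ j → ℛ m′ (λ q → δ (q - p) (1-a + + j))))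
      ≡⟨ 𝓕-cong m (+ a) a (+ b) (λ p → ∑ (upTo window) (λ j → ℛ m′ (λ q → δ (q - p) (1-a + + j)))) (λ p → ℛ m′ (λ q → W (q - p)))
           (λ p → trans (sym (𝓕-∑ m′ (+ b) b (+ a) (upTo window) (λ q j → δ (q - p) (1-a + + j))))
             (𝓕-cong m′ (+ b) b (+ a) (λ q → ∑ (upTo window) (λ j → δ (q - p) (1-a + + j))) (λ q → W (q - p))
               (λ q → trans (∑-interval window 1-a (q - p)) (cong (λ u → H (q - p) 1-a - H (q - p) u) 1-a+window)))) ⟩
    pairing W m m′ ∎
    where open ≡-Reasoning

  private
    lattice-unique : ∀ {k l k′ l′} → k < a → k′ < a →
      + l * + a - + k * + b ≡ + l′ * + a - + k′ * + b → k ≡ k′ × l ≡ l′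
    lattice-unique {k} {l} {k′} {l′} k<a k′<a eq = k≡k′ , ℤ.+-injective (ℤ.*-cancelʳ-≡ (+ l) (+ l′) (+ a) la≡l′a)
      where
      lem₂ : ∀ l l′ k k′ a b → (k - k′) * b ≡ (l - l′) * a - ((l * a - k * b) - (l′ * a - k′ * b))
      lem₂ = solve-∀
      a∣ : + a ∣ (+ k - + k′) * + b
      a∣ = divides (+ l - + l′) (trans (lem₂ (+ l) (+ l′) (+ k) (+ k′) (+ a) (+ b))
        (trans (cong (λ u → (+ l - + l′) * + a - u) (ℤ.i≡j⇒i-j≡0 eq)) (ℤ.+-identityʳ _)))
      k≡k′ : k ≡ k′
      k≡k′ = difference-multiple k<a k′<a (coprime-∣ a b coprime (+ k - + k′) a∣)
      x-c+c : ∀ x c → x ≡ x - c + c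
      x-c+c = solve-∀
      la≡l′a : + l * + a ≡ + l′ * + a
      la≡l′a = trans (x-c+c (+ l * + a) (+ k * + b)) (trans (cong₂ (λ u v → u + + v * + b) eq k≡k′) (sym (x-c+c (+ l′ * + a) (+ k′ * + b))))

  -- The differences `l a - k b` with `k < a` and `l < b` are pairwise distinct: modulo `a` they
  -- determine `k`, and then `l`.
  count-δ : ∀ {k l} → k < a → l < b → count (λ d → δ d (+ l * + a - + k * + b)) ≡ 1ℤ
  count-δ {k} {l} k<a l<b = trans
    (∑-single (upTo-unique a) (∈-upTo⁺ k<a) (λ k′ → ∑ (upTo b) (λ l′ → δ (+ l′ * + a - + k′ * + b) t))
      (λ {k′} k′∈ k′≢k → ∑-zero (upTo b) λ {l′} _ → δ-≢ {+ l′ * + a - + k′ * + b} {t} λ eq → k′≢k (proj₁ (lattice-unique {k′} {l′} {k} {l} (∈-upTo⁻ k′∈) k<a eq))))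
    (trans (∑-single (upTo-unique b) (∈-upTo⁺ l<b) (λ l′ → δ (+ l′ * + a - + k * + b) t)
      (λ {l′} _ l′≢l → δ-≢ {+ l′ * + a - + k * + b} {t} λ eq → l′≢l (proj₂ (lattice-unique {k} {l′} {k} {l} k<a k<a eq))))
    (δ-refl t))
    where
    t : ℤ
    t = + l * + a - + k * + b

  -- Moving the half-open boundary conditions of W by one lattice step makes both sums
  -- over k and l telescope; the diagonal terms that are left over see only (0 , 0).
  count-W : count W ≡ + window
  count-W = begin
    count W
      ≡⟨ ∑-cong (upTo a) (λ k → trans (∑-cong (upTo b) (λ l → split k l))
           (trans (∑-+ (upTo b) (λ l → (θ₁ k (suc l) - θ₁ k l) - δ (+ l * + a - + k * + b) 0ℤ) (λ l → θ₀ k l - θ₀ (suc k) l))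
             (cong₂ _+_ (trans (∑-- (upTo b) (λ l → θ₁ k (suc l) - θ₁ k l) (λ l → δ (+ l * + a - + k * + b) 0ℤ))
                (cong (_- ∑ (upTo b) (λ l → δ (+ l * + a - + k * + b) 0ℤ)) (∑-telescope b (θ₁ k)))) refl))) ⟩
    ∑ (upTo a) (λ k → (θ₁ k b - θ₁ k 0) - ∑ (upTo b) (λ l → δ (+ l * + a - + k * + b) 0ℤ) + ∑ (upTo b) (λ l → θ₀ k l - θ₀ (suc k) l))
      ≡⟨ trans (∑-+ (upTo a) (λ k → (θ₁ k b - θ₁ k 0) - ∑ (upTo b) (λ l → δ (+ l * + a - + k * + b) 0ℤ)) (λ k → ∑ (upTo b) (λ l → θ₀ k l - θ₀ (suc k) l)))
           (cong₂ _+_ (∑-- (upTo a) (λ k → θ₁ k b - θ₁ k 0) (λ k → ∑ (upTo b) (λ l → δ (+ l * + a - + k * + b) 0ℤ)))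
             (∑-swap (upTo a) (upTo b) (λ k l → θ₀ k l - θ₀ (suc k) l))) ⟩
    ∑ (upTo a) (λ k → θ₁ k b - θ₁ k 0) - count (λ d → δ d 0ℤ) + ∑ (upTo b) (λ l → ∑ (upTo a) (λ k → θ₀ k l - θ₀ (suc k) l))
      ≡⟨ cong₂ _+_ (cong₂ _-_ (constant a (λ k → θ₁ k b - θ₁ k 0) θ₁-ends) (count-δ (ℕ.>-nonZero⁻¹ a) (ℕ.>-nonZero⁻¹ b)))
           (constant b (λ l → ∑ (upTo a) (λ k → θ₀ k l - θ₀ (suc k) l)) θ₀-ends) ⟩
    + a - 1ℤ + + b
      ≡⟨ trans (cong (λ u → + a - 1ℤ + u) (sym 1-a+window)) (cancel (+ a) (+ window)) ⟩
    + window ∎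
    where
    open ≡-Reasoning
    θ₀ θ₁ : ℕ → ℕ → ℤ
    θ₀ k l = H (+ l * + a - + k * + b) 0ℤ
    θ₁ k l = H (+ l * + a - + k * + b) 1ℤ
    cancel : ∀ a w → a - 1ℤ + (1ℤ - a + w) ≡ w
    cancel = solve-∀
    constant : ∀ n (f : ℕ → ℤ) → (∀ k → k < n → f k ≡ 1ℤ) → ∑ (upTo n) f ≡ + n
    constant n f h = trans (∑-cong∈ (upTo n) (λ {k} k∈ → h k (∈-upTo⁻ k∈)))
      (trans (∑-const (upTo n) 1ℤ) (trans (ℤ.*-identityʳ _) (cong +_ (length-upTo n))))
    insert : ∀ x y z w → x - y ≡ (x - z) - (w - z) + (w - y)
    insert = solve-∀
    la+a : ∀ l a c → (1ℤ + l) * a - c ≡ l * a - c + a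
    la+a = solve-∀
    kb+b : ∀ k b c → c - (1ℤ + k) * b ≡ c - k * b - b
    kb+b = solve-∀
    0--b≡b : ∀ b → 0ℤ - - b ≡ b
    0--b≡b = solve-∀
    split : ∀ k l → W (+ l * + a - + k * + b) ≡ (θ₁ k (suc l) - θ₁ k l) - δ (+ l * + a - + k * + b) 0ℤ + (θ₀ k l - θ₀ (suc k) l)
    split k l = trans (cong₂ _-_
        (trans (sym (H-shift (+ l * + a - + k * + b) 1ℤ (+ a))) (cong (λ u → H u 1ℤ) (sym (la+a (+ l) (+ a) (+ k * + b)))))
        (trans (cong (H (+ l * + a - + k * + b)) (sym (0--b≡b (+ b))))
          (trans (sym (H-shift (+ l * + a - + k * + b) 0ℤ (- + b))) (cong (λ u → H u 0ℤ) (sym (kb+b (+ k) (+ b) (+ l * + a)))))))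
      (trans (insert (θ₁ k (suc l)) (θ₀ (suc k) l) (θ₁ k l) (θ₀ k l))
        (cong (λ u → (θ₁ k (suc l) - θ₁ k l) - u + (θ₀ k l - θ₀ (suc k) l)) (H-step (+ l * + a - + k * + b) 0ℤ)))
    flip : ∀ p q → p - q ≡ - q - - p
    flip = solve-∀
    flip′ : ∀ p q → - p - - q ≡ q - p
    flip′ = solve-∀
    0≤kb : ∀ k → 0ℤ ≤ + k * + b
    0≤kb k = 0≤* {+ k} {+ b} (+≤+ z≤n) (+≤+ z≤n)
    θ₁-ends : ∀ k → k < a → θ₁ k b - θ₁ k 0 ≡ 1ℤ
    θ₁-ends k k<a = cong₂ _-_
      (⟦⟧-yes (1ℤ ℤ.≤? + b * + a - + k * + b) (ℤ.i<j⇒suc[i]≤j {0ℤ} (subst (0ℤ ℤ.<_) (pull (+ b) (+ a) (+ k)) (0<* (ℤ.+<+ k<a)))))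
      (⟦⟧-no (1ℤ ℤ.≤? 0ℤ - + k * + b) λ h → ℤ.<⇒≱ (ℤ.suc[i]≤j⇒i<j {0ℤ} h) (subst (_≤ 0ℤ) (sym (ℤ.+-identityˡ _)) (ℤ.neg-mono-≤ (0≤kb k))))
      where
      pull : ∀ b a k → (a - k) * b ≡ b * a - k * b
      pull = solve-∀
      0<* : + k ℤ.< + a → 0ℤ ℤ.< (+ a - + k) * + b
      0<* k<a = ℤ.*-monoʳ-<-pos (+ b) {{ℤ.positive 0<b}} {0ℤ} {+ a - + k}
        (subst (ℤ._< + a - + k) (ℤ.+-inverseʳ (+ k)) (ℤ.+-monoˡ-< (- + k) k<a))
    θ₀-ends : ∀ l → l < b → ∑ (upTo a) (λ k → θ₀ k l - θ₀ (suc k) l) ≡ 1ℤ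
    θ₀-ends l l<b = begin
      ∑ (upTo a) (λ k → θ₀ k l - θ₀ (suc k) l)
        ≡⟨ ∑-cong (upTo a) (λ k → flip (θ₀ k l) (θ₀ (suc k) l)) ⟩
      ∑ (upTo a) (λ k → - θ₀ (suc k) l - - θ₀ k l)
        ≡⟨ ∑-telescope a (λ k → - θ₀ k l) ⟩
      - θ₀ a l - - θ₀ 0 l
        ≡⟨ flip′ (θ₀ a l) (θ₀ 0 l) ⟩
      θ₀ 0 l - θ₀ a l
        ≡⟨ cong₂ _-_
             (⟦⟧-yes (0ℤ ℤ.≤? + l * + a - 0ℤ) (ℤ.i≤j⇒0≤j-i (0≤* {+ l} {+ a} (+≤+ z≤n) (+≤+ z≤n))))
             (⟦⟧-no (0ℤ ℤ.≤? + l * + a - + a * + b) λ h → ℤ.<⇒≱ (la<ab l l<b) (ℤ.0≤i-j⇒j≤i h)) ⟩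
      1ℤ ∎
      where
      la<ab : ∀ l → l < b → + l * + a ℤ.< + a * + b
      la<ab l l<b = subst (+ l * + a ℤ.<_) (ℤ.*-comm (+ b) (+ a)) (ℤ.*-monoʳ-<-pos (+ a) {{ℤ.positive 0<a}} (ℤ.+<+ l<b))

  Bℤ-crossings : ∀ m m′ →
    ∑ (upTo window) (λ j → crossings m m′ (1-a + + j)) ≡ Bℤ m m′ + m top * (m′ top * + window)
  Bℤ-crossings m m′ = trans (∑-crossings m m′) (trans (pairing-expand W-balanced m m′)
    (cong₂ (λ u v → u + m top * (m′ top * v)) (sym (Bℤ≡ m m′)) count-W))

  -- Since `count W` is the length of the window, the lattice contribution splits evenly into one
  -- `M M′` for each height.
  Bℤ-excess : ∀ m m′ → Bℤ m m′ ≡ ∑ (upTo window) (λ j → crossings m m′ (1-a + + j) - m top * m′ top)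
  Bℤ-excess m m′ = sym (trans (∑-- (upTo window) (λ j → crossings m m′ (1-a + + j)) (λ _ → m top * m′ top))
    (trans (cong₂ _-_ (Bℤ-crossings m m′) (trans (∑-const (upTo window) _) (cong (λ n → + n * (m top * m′ top)) (length-upTo window))))
      (cancel (Bℤ m m′) (m top) (m′ top) (+ window))))
    where
    cancel : ∀ x p q w → x + p * (q * w) - w * (p * q) ≡ x
    cancel = solve-∀

  in-window : ∀ {j} → j < window → - + a ℤ.< 1-a + + j × 1-a + + j ℤ.< + b
  in-window {j} j<w = ℤ.<-≤-trans -a<1-a (ℤ.i≤i+j 1-a (+ j)) ,
    subst (1-a + + j ℤ.<_) 1-a+window (ℤ.+-monoʳ-< 1-a (ℤ.+<+ j<w))

  excess-nonNeg : ∀ (c c′ : IntCone) → let m = IntCone.weight c ; m′ = IntCone.weight c′ in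
    ∀ {j} → j ∈ upTo window → 0ℤ ≤ crossings m m′ (1-a + + j) - m top * m′ top
  excess-nonNeg c c′ {j} j∈ = ℤ.i≤j⇒0≤j-i
    (crossings-bound c c′ (1-a + + j) (proj₁ (in-window (∈-upTo⁻ j∈))) (proj₂ (in-window (∈-upTo⁻ j∈))))

  Bℤ-nonNeg : ∀ (c c′ : IntCone) → 0ℤ ≤ Bℤ (IntCone.weight c) (IntCone.weight c′)
  Bℤ-nonNeg c c′ = subst (0ℤ ≤_) (sym (Bℤ-excess (IntCone.weight c) (IntCone.weight c′))) (∑-nonNeg (upTo window) (excess-nonNeg c c′))

-- The lower bound for the quadratic form.

module QuadraticBound (a b : ℕ) (1<a : 1 < a) (a<b : a < b) (coprime : Coprime a b) where
  open Gaps a b 1<a a<b coprime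
  open Filling a b 1<a a<b coprime
  open Pairing a b 1<a a<b coprime
  open Crossing a b 1<a a<b coprime
  open IntegerForm a b 1<a a<b coprime

  b-a : ℤ
  b-a = + b - + a

  -- Λ turns the kernels [d = 0] and [d = b - a] into mirror images of each other,
  -- so their pairings of a filling with itself agree.
  Λ-mirror : ∀ d → Λ (λ u → δ u b-a) d ≡ Λ (λ u → δ u 0ℤ) (- d)
  Λ-mirror d = trans (cong₂ _+_ (cong₂ _-_ (cong₂ _-_
      (δ-by d b-a (- d + + b - + a) (c₁ d (+ a) (+ b)))
      (δ-by (d - + a) b-a (- d + + b) (c₂ d (+ a) (+ b))))
      (δ-by (d + + b) b-a (- d - + a) (c₃ d (+ a) (+ b))))
      (δ-by (d + + b - + a) b-a (- d) (c₄ d (+ a) (+ b))))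
    (reorder (δ (- d + + b - + a) 0ℤ) (δ (- d + + b) 0ℤ) (δ (- d - + a) 0ℤ) (δ (- d) 0ℤ))
    where
    δ-by : ∀ x y u → y - x ≡ u → δ x y ≡ δ u 0ℤ
    δ-by x y u refl = ⟦⟧-cong (x ℤ.≟ y) (y - x ℤ.≟ 0ℤ) (λ { refl → ℤ.+-inverseʳ y }) (λ e → sym (ℤ.i-j≡0⇒i≡j y x e))
    reorder : ∀ p q r s → p - q - r + s ≡ s - r - q + p
    reorder = solve-∀
    c₁ : ∀ d a b → b - a - d ≡ - d + b - a
    c₁ = solve-∀
    c₂ : ∀ d a b → b - a - (d - a) ≡ - d + b
    c₂ = solve-∀
    c₃ : ∀ d a b → b - a - (d + b) ≡ - d - a
    c₃ = solve-∀
    c₄ : ∀ d a b → b - a - (d + b - a) ≡ - d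
    c₄ = solve-∀

  private
    a-1 b-1 : ℕ
    a-1 = ℕ.pred a
    b-1 = ℕ.pred b

    1+[a-1] : suc a-1 ≡ a
    1+[a-1] = ℕ.suc-pred a
    1+[b-1] : suc b-1 ≡ b
    1+[b-1] = ℕ.suc-pred b

    a-1<a : a-1 < a
    a-1<a = ℕ.≤-reflexive 1+[a-1]
    b-1<b : b-1 < b
    b-1<b = ℕ.≤-reflexive 1+[b-1]

    0≢b-a : 0ℤ ≢ b-a
    0≢b-a eq = ℤ.<-irrefl (sym (ℤ.i-j≡0⇒i≡j (+ b) (+ a) (sym eq))) (ℤ.+<+ a<b)

    -- Exhibits `b - a` as a lattice difference, at the largest `l` and `k`, so that its `count` is
    -- 1 like that of 0.
    corner : + b-1 * + a - + a-1 * + b ≡ b-a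
    corner = trans (lem (+ a-1) (+ b-1) (+ a) (+ b)) (trans (cong₂ (λ u v → u * + a - v * + b - (+ a - + b)) (cong +_ 1+[b-1]) (cong +_ 1+[a-1])) (lem′ (+ a) (+ b)))
      where
      lem : ∀ p q a b → q * a - p * b ≡ (1ℤ + q) * a - (1ℤ + p) * b - (a - b)
      lem = solve-∀
      lem′ : ∀ a b → b * a - a * b - (a - b) ≡ b - a
      lem′ = solve-∀

    -a<0 : - + a ℤ.< 0ℤ
    -a<0 = ℤ.neg-mono-< 0<a

    -a<b-a : - + a ℤ.< b-a
    -a<b-a = subst (ℤ._< b-a) (ℤ.+-identityˡ (- + a)) (ℤ.+-monoˡ-< (- + a) 0<b)

    b-a<b : b-a ℤ.< + b
    b-a<b = subst (b-a ℤ.<_) (ℤ.+-identityʳ (+ b)) (ℤ.+-monoʳ-< (+ b) -a<0)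

  crossings-mirror : ∀ m → crossings m m b-a ≡ crossings m m 0ℤ
  crossings-mirror m = begin
    crossings m m b-a
      ≡⟨ trans (crossings≡pairing m m b-a) (pairing-expand (δ-balanced b-a -a<b-a b-a<b) m m) ⟩
    ∑ E (λ i → m i * ∑ E (λ j → m j * Λ (λ u → δ u b-a) (γ j - γ i))) + m top * (m top * count (λ u → δ u b-a))
      ≡⟨ cong₂ (λ u v → u + m top * (m top * v)) gaps (trans (subst (λ t → count (λ u → δ u t) ≡ 1ℤ) corner (count-δ a-1<a b-1<b))
           (sym (count-δ (ℕ.>-nonZero⁻¹ a) (ℕ.>-nonZero⁻¹ b)))) ⟩
    ∑ E (λ i → m i * ∑ E (λ j → m j * Λ (λ u → δ u 0ℤ) (γ j - γ i))) + m top * (m top * count (λ u → δ u 0ℤ))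
      ≡⟨ trans (crossings≡pairing m m 0ℤ) (pairing-expand (δ-balanced 0ℤ -a<0 0<b) m m) ⟨
    crossings m m 0ℤ ∎
    where
    open ≡-Reasoning
    neg-diff : ∀ x y → - (x - y) ≡ y - x
    neg-diff = solve-∀
    exchange : ∀ x y k → x * (y * k) ≡ y * (x * k)
    exchange = solve-∀
    gaps : ∑ E (λ i → m i * ∑ E (λ j → m j * Λ (λ u → δ u b-a) (γ j - γ i))) ≡ ∑ E (λ i → m i * ∑ E (λ j → m j * Λ (λ u → δ u 0ℤ) (γ j - γ i)))
    gaps = begin
      ∑ E (λ i → m i * ∑ E (λ j → m j * Λ (λ u → δ u b-a) (γ j - γ i)))
        ≡⟨ ∑-cong E (λ i → trans (sym (∑-*ˡ E (m i) (λ j → m j * Λ (λ u → δ u b-a) (γ j - γ i))))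
             (∑-cong E (λ j → trans (cong (λ u → m i * (m j * u)) (trans (Λ-mirror (γ j - γ i)) (cong (Λ (λ u → δ u 0ℤ)) (neg-diff (γ j) (γ i)))))
               (exchange (m i) (m j) (Λ (λ u → δ u 0ℤ) (γ i - γ j)))))) ⟩
      ∑ E (λ i → ∑ E (λ j → m j * (m i * Λ (λ u → δ u 0ℤ) (γ i - γ j))))
        ≡⟨ ∑-swap E E (λ i j → m j * (m i * Λ (λ u → δ u 0ℤ) (γ i - γ j))) ⟩
      ∑ E (λ j → ∑ E (λ i → m j * (m i * Λ (λ u → δ u 0ℤ) (γ i - γ j))))
        ≡⟨ ∑-cong E (λ j → ∑-*ˡ E (m j) (λ i → m i * Λ (λ u → δ u 0ℤ) (γ i - γ j))) ⟩
      ∑ E (λ i → m i * ∑ E (λ j → m j * Λ (λ u → δ u 0ℤ) (γ j - γ i))) ∎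

  module _ (c : IntCone) where
    open IntCone c

    -- All excesses are non-negative, so two of them may be kept alone; those at heights 0 and
    -- `b - a` are equal. The factor 2 offsets the ½ of `B`.
    Bℤ≥valleys : + 2 * (crossings weight weight 0ℤ - M * M) ≤ Bℤ weight weight
    Bℤ≥valleys = subst₂ _≤_ (trans (cong₂ _+_ at-0 at-b-a) (double (crossings weight weight 0ℤ - M * M)))
      (sym (Bℤ-excess weight weight))
      -- The indices `a - 1` and `b - 1` stand for the heights 0 and `b - a`.
      (∑-two-members (excess-nonNeg c c) (∈-upTo⁺ a-1<window) (∈-upTo⁺ b-1<window) a-1≢b-1)
      where
      double : ∀ x → x + x ≡ + 2 * x
      double = solve-∀
      suc-window : suc window ≡ a ℕ.+ b
      suc-window = ℕ.suc-pred (a ℕ.+ b) {{ℕ.>-nonZero (ℕ.≤-trans (ℕ.>-nonZero⁻¹ a) (ℕ.m≤m+n a b))}}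
      a-1<window : a-1 < window
      a-1<window = ℕ.≤-pred (subst₂ ℕ._≤_ (cong suc (sym 1+[a-1])) (sym suc-window) (ℕ.≤-trans (ℕ.≤-reflexive (ℕ.+-comm 1 a)) (ℕ.+-monoʳ-≤ a (ℕ.>-nonZero⁻¹ b))))
      b-1<window : b-1 < window
      b-1<window = ℕ.≤-pred (subst₂ ℕ._≤_ (cong suc (sym 1+[b-1])) (sym suc-window) (ℕ.+-monoˡ-≤ b (ℕ.>-nonZero⁻¹ a)))
      lem₁ : ∀ a p → 1ℤ - a + p ≡ 1ℤ + p - a
      lem₁ = solve-∀
      shift-a : 1-a + + a-1 ≡ 0ℤ
      shift-a = trans (lem₁ (+ a) (+ a-1)) (trans (cong (λ u → + u - + a) 1+[a-1]) (ℤ.+-inverseʳ (+ a)))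
      shift-b : 1-a + + b-1 ≡ b-a
      shift-b = trans (lem₁ (+ a) (+ b-1)) (cong (λ u → + u - + a) 1+[b-1])
      a-1≢b-1 : a-1 ≢ b-1
      a-1≢b-1 e = 0≢b-a (trans (sym shift-a) (trans (cong (λ u → 1-a + + u) e) shift-b))
      at-0 : crossings weight weight (1-a + + a-1) - M * M ≡ crossings weight weight 0ℤ - M * M
      at-0 = cong (λ t → crossings weight weight t - M * M) shift-a
      at-b-a : crossings weight weight (1-a + + b-1) - M * M ≡ crossings weight weight 0ℤ - M * M
      at-b-a = cong (_- M * M) (trans (cong (crossings weight weight) shift-b) (crossings-mirror weight))

    αβ : ℤ → ℤ
    αβ z = α weight z * β weight z

    αβ-nonNeg : ∀ z → 0ℤ ≤ αβ z
    αβ-nonNeg z = 0≤* (α-nonNeg c z) (β-nonNeg c z)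

    private
      -- Here `ũ` of the constant 1 is the indicator of the gap heights. These are distinct and
      -- nonzero, so `valleys` selects no term of the crossing sum twice.
      gaps-indicator≤1 : ∀ z → δ 0ℤ z + ũ (λ _ → 1ℤ) z ≤ 1ℤ
      gaps-indicator≤1 z = by-class (classify z)
        where
        δ≤1 : ∀ z → δ 0ℤ z ≤ 1ℤ
        δ≤1 z = ⟦⟧-mono (0ℤ ℤ.≟ z) (yes refl) (λ _ → refl {x = 0ℤ})
        by-class : ∀ {z} → Class z → δ 0ℤ z + ũ (λ _ → 1ℤ) z ≤ 1ℤ
        by-class {z} (negative z<0) = subst (λ u → δ 0ℤ z + u ≤ 1ℤ) (sym (ũ-nongap (λ _ → 1ℤ) (λ { i refl → ℤ.<-asym z<0 (0<γ i) })))
          (subst (_≤ 1ℤ) (sym (ℤ.+-identityʳ _)) (δ≤1 z))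
        by-class (gap i refl) = ℤ.≤-reflexive (cong₂ _+_ (δ-≢ (λ e → ℤ.<-irrefl e (0<γ i))) (ũ-gap (λ _ → 1ℤ) i))
        by-class {z} (inS h)  = subst (λ u → δ 0ℤ z + u ≤ 1ℤ) (sym (ũ-nongap (λ _ → 1ℤ) (λ { i refl → gap∉S i h })))
          (subst (_≤ 1ℤ) (sym (ℤ.+-identityʳ _)) (δ≤1 z))

    -- Of the non-negative terms `αβ z` only those at `z = 0` and at the gaps are kept. At `z = 0`
    -- both differences equal `M`, as `N` jumps there from 0 to `M`.
    valleys : M * M + ∑ E (λ i → αβ (γ i)) ≤ crossings weight weight 0ℤ
    valleys = subst₂ _≤_ left (sym (crossings-density weight weight 0ℤ)) (∑-mono (upTo L) {f = λ z → (δ 0ℤ (+ z) + ũ (λ _ → 1ℤ) (+ z)) * αβ (+ z)} λ {z} _ →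
      subst₂ _≤_ refl (trans (ℤ.*-identityˡ (αβ (+ z))) (cong (λ w → α weight (+ z) * β weight w) (sym (ℤ.+-identityʳ (+ z)))))
        (ℤ.*-monoʳ-≤-nonNeg (αβ (+ z)) {{ℤ.nonNegative (αβ-nonNeg (+ z))}} (gaps-indicator≤1 (+ z))))
      where
      open ≡-Reasoning
      at-zero : αβ 0ℤ ≡ M * M
      at-zero = cong₂ _*_ (step (+ a) 0<a) (step (+ b) 0<b)
        where
        step : ∀ x → 0ℤ ℤ.< x → n̂ 0ℤ - n̂ (0ℤ - x) ≡ M
        step x 0<x = trans (cong₂ _-_ (N-S weight (combination∈S 0 0)) (N-neg weight (subst (ℤ._< 0ℤ) (sym (ℤ.+-identityˡ (- x))) (ℤ.neg-mono-< 0<x))))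
          (ℤ.+-identityʳ M)
      distribute : ∀ p q x → (p + q) * x ≡ p * x + q * x
      distribute = solve-∀
      drop-1 : ∀ p x → 1ℤ * p * x ≡ p * x
      drop-1 = solve-∀
      left : ∑ (upTo L) (λ z → (δ 0ℤ (+ z) + ũ (λ _ → 1ℤ) (+ z)) * αβ (+ z)) ≡ M * M + ∑ E (λ i → αβ (γ i))
      left = begin
        ∑ (upTo L) (λ z → (δ 0ℤ (+ z) + ũ (λ _ → 1ℤ) (+ z)) * αβ (+ z))
          ≡⟨ ∑-cong (upTo L) (λ z → trans (distribute (δ 0ℤ (+ z)) (ũ (λ _ → 1ℤ) (+ z)) (αβ (+ z)))
               (cong (λ u → δ 0ℤ (+ z) * αβ (+ z) + u) (trans (sym (∑-*ʳ E (αβ (+ z)) (λ i → 1ℤ * δ (γ i) (+ z))))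
                 (∑-cong E (λ i → drop-1 (δ (γ i) (+ z)) (αβ (+ z))))))) ⟩
        ∑ (upTo L) (λ z → δ 0ℤ (+ z) * αβ (+ z) + ∑ E (λ i → δ (γ i) (+ z) * αβ (+ z)))
          ≡⟨ ∑-+ (upTo L) (λ z → δ 0ℤ (+ z) * αβ (+ z)) (λ z → ∑ E (λ i → δ (γ i) (+ z) * αβ (+ z))) ⟩
        ∑ (upTo L) (λ z → δ 0ℤ (+ z) * αβ (+ z)) + ∑ (upTo L) (λ z → ∑ E (λ i → δ (γ i) (+ z) * αβ (+ z)))
          ≡⟨ cong₂ _+_ (trans (pick αβ 0ℤ ℤ.≤-refl 0<L) at-zero)
               (trans (∑-swap (upTo L) E (λ z i → δ (γ i) (+ z) * αβ (+ z))) (∑-cong E (λ i → pick αβ (γ i) (ℤ.<⇒≤ (0<γ i)) (γ<L i)))) ⟩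
        M * M + ∑ E (λ i → αβ (γ i)) ∎
        where
        0<L : 0ℤ ℤ.< + L
        0<L = ℤ.<-trans (0<γ top) (γ<L top)

    -- The loss in the cheaper of the two steps down from a gap. Taking the minimum makes its square
    -- at most `α β`.
    drop : G a b → ℤ
    drop i = α weight (γ i) ℤ.⊓ β weight (γ i)

    drop-nonNeg : ∀ i → 0ℤ ≤ drop i
    drop-nonNeg i = ℤ.⊓-glb (α-nonNeg c (γ i)) (β-nonNeg c (γ i))

    drop²≤αβ : ∀ i → drop i * drop i ≤ αβ (γ i)
    drop²≤αβ i = *-mono-≤-nonNeg (drop-nonNeg i) (drop-nonNeg i) (ℤ.i⊓j≤i _ _) (ℤ.i⊓j≤j _ _)

    -- Counts all gaps up to height `z`, visited or not, so that the induction along the descent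
    -- need not record its path.
    drops-below : ℤ → ℤ
    drops-below z = ∑ E (λ i → H z (γ i) * drop i)

    private
      drops-below-nonNeg : ∀ z → 0ℤ ≤ drops-below z
      drops-below-nonNeg z = ∑-nonNeg E λ {i} _ → 0≤* (⟦⟧-nonNeg (γ i ℤ.≤? z)) (drop-nonNeg i)

      -- Gap `i` lies above `γ i - x`, so its drop is not yet counted there. Writing `drop i` as
      -- `ũ drop (γ i)` makes the comparison termwise.
      drops-below-step : ∀ i x → 0ℤ ℤ.< x → drops-below (γ i - x) + drop i ≤ drops-below (γ i)
      drops-below-step i x 0<x = subst (_≤ drops-below (γ i))
        (trans (∑-+ E (λ j → H (γ i - x) (γ j) * drop j) (λ j → drop j * δ (γ j) (γ i))) (cong (λ u → drops-below (γ i - x) + u) (ũ-gap drop i)))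
        (∑-mono E λ {j} _ → subst (_≤ H (γ i) (γ j) * drop j) (factor (H (γ i - x) (γ j)) (δ (γ j) (γ i)) (drop j))
          (ℤ.*-monoʳ-≤-nonNeg (drop j) {{ℤ.nonNegative (drop-nonNeg j)}} (indicators (γ j) (γ i))))
        where
        factor : ∀ h d x → (h + d) * x ≡ h * x + x * d
        factor = solve-∀
        z-x<z : ∀ z → z - x ℤ.< z
        z-x<z z = subst (z - x ℤ.<_) (ℤ.+-identityʳ z) (ℤ.+-monoʳ-< z (ℤ.neg-mono-< 0<x))
        indicators : ∀ y z → H (z - x) y + δ y z ≤ H z y
        indicators y z with y ℤ.≟ z
        ... | yes refl = ℤ.≤-reflexive (trans (cong (_+ 1ℤ) (⟦⟧-no (y ℤ.≤? y - x) (ℤ.<⇒≱ (z-x<z y)))) (sym (⟦⟧-yes (y ℤ.≤? y) ℤ.≤-refl)))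
        ... | no _     = subst (_≤ H z y) (sym (ℤ.+-identityʳ (H (z - x) y)))
          (⟦⟧-mono (y ℤ.≤? z - x) (y ℤ.≤? z) (λ h → ℤ.≤-trans h (ℤ.<⇒≤ (z-x<z z))))

      x-c+c : ∀ z c → z - c + c ≡ z
      x-c+c = solve-∀

    -- Descend from γ i by a or by b, whichever loses less, until the value is 0.
    n̂≤drops : ∀ n z → z ℤ.< + n → ¬ InS z → n̂ z ≤ drops-below z
    n̂≤drops n z z<n z∉S = by-class n z<n z∉S (classify z)
      where
      by-class : ∀ n {z} → z ℤ.< + n → ¬ InS z → Class z → n̂ z ≤ drops-below z
      descent : ∀ n i x → 0ℤ ℤ.< x → (∀ {z} → InS z → InS (z + x)) → γ i ℤ.< + suc n →
                drop i ≡ n̂ (γ i) - n̂ (γ i - x) → n̂ (γ i) ≤ drops-below (γ i)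
      by-class n       {z} _   _   (negative z<0) = subst (_≤ drops-below z) (sym (N-neg weight z<0)) (drops-below-nonNeg z)
      by-class n           _   z∉S (inS z∈S)      = contradiction z∈S z∉S
      by-class zero        z<0 _   (gap i refl)   = contradiction (0<γ i) (ℤ.<-asym z<0)
      by-class (suc n)     z<n _   (gap i refl)   = choose (ℤ.⊓-sel (α weight (γ i)) (β weight (γ i)))
        where
        choose : drop i ≡ α weight (γ i) ⊎ drop i ≡ β weight (γ i) → n̂ (γ i) ≤ drops-below (γ i)
        choose (inj₁ e) = descent n i (+ a) 0<a S-+a z<n e
        choose (inj₂ e) = descent n i (+ b) 0<b S-+b z<n e
      descent n i x 0<x S-+x γ<n e = ℤ.≤-trans
        (subst (_≤ drops-below (γ i - x) + drop i) (trans (cong (λ u → n̂ (γ i - x) + u) e) (refill (n̂ (γ i)) (n̂ (γ i - x))))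
          -- Closure under adding `x` keeps the descent from a gap out of the semigroup, so it can
          -- only end at a negative height, where `N` vanishes.
          (ℤ.+-monoˡ-≤ (drop i) (by-class n smaller (λ h → gap∉S i (subst InS (x-c+c (γ i) x) (S-+x h))) (classify (γ i - x)))))
        (drops-below-step i x 0<x)
        where
        refill : ∀ p q → q + (p - q) ≡ p
        refill = solve-∀
        1+n-1 : ∀ n → 1ℤ + n - 1ℤ ≡ n
        1+n-1 = solve-∀
        smaller : γ i - x ℤ.< + n
        smaller = subst (γ i - x ℤ.<_) (1+n-1 (+ n)) (ℤ.+-mono-<-≤ γ<n (ℤ.neg-mono-≤ (ℤ.i<j⇒suc[i]≤j 0<x)))

    M≤drops : M ≤ ∑ E drop
    M≤drops = ℤ.≤-trans (subst (_≤ drops-below (γ top)) (N-gap weight top) (n̂≤drops L (γ top) (γ<L top) (gap∉S top)))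
      (∑-mono E λ {i} _ → subst (H (γ top) (γ i) * drop i ≤_) (ℤ.*-identityˡ (drop i))
        (ℤ.*-monoʳ-≤-nonNeg (drop i) {{ℤ.nonNegative (drop-nonNeg i)}} (⟦⟧-mono (γ i ℤ.≤? γ top) (yes refl) (λ _ → refl {x = 0ℤ}))))

    Bℤ-bound : + 2 * (M * M) ≤ + ∣G∣ a b * Bℤ weight weight
    Bℤ-bound = begin
      + 2 * (M * M)
        ≤⟨ ℤ.*-monoˡ-≤-nonNeg (+ 2) (ℤ.≤-trans (*-mono-≤-nonNeg (nonNeg top) (nonNeg top) M≤drops M≤drops)
             (ℤ.≤-trans (cauchy-schwarz E drop) (ℤ.*-monoˡ-≤-nonNeg (+ ∣G∣ a b) (ℤ.≤-trans (∑-mono E λ {i} _ → drop²≤αβ i) excess)))) ⟩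
      + 2 * (+ ∣G∣ a b * (crossings weight weight 0ℤ - M * M))
        ≡⟨ exchange (+ 2) (+ ∣G∣ a b) (crossings weight weight 0ℤ - M * M) ⟩
      + ∣G∣ a b * (+ 2 * (crossings weight weight 0ℤ - M * M))
        ≤⟨ ℤ.*-monoˡ-≤-nonNeg (+ ∣G∣ a b) Bℤ≥valleys ⟩
      + ∣G∣ a b * Bℤ weight weight ∎
      where
      open ℤ.≤-Reasoning
      exchange : ∀ x y z → x * (y * z) ≡ y * (x * z)
      exchange = solve-∀
      lem : ∀ x s y → y - (x + s) ≡ y - x - s
      lem = solve-∀
      excess : ∑ E (λ i → αβ (γ i)) ≤ crossings weight weight 0ℤ - M * M
      excess = ≤-by (ℤ.i≤j⇒0≤j-i valleys) (lem (M * M) (∑ E (λ i → αβ (γ i))) (crossings weight weight 0ℤ))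

-- Integers inside the rationals and common denominators.

ι : ℤ → ℚ
ι k = k ℚ./ 1

ι-mkℚ : ∀ k → ι k ≡ mkℚ k 0 (ℕ.sym (ℕ.1-coprimeTo ℤ.∣ k ∣))
ι-mkℚ k = ℚ.fromℚᵘ-toℚᵘ (mkℚ k 0 (ℕ.sym (ℕ.1-coprimeTo ℤ.∣ k ∣)))

ι-+ : ∀ k l → ι (k + l) ≡ ι k ℚ.+ ι l
ι-+ k l = ℚ.toℚᵘ-injective (ℚᵘ.≃-trans (ℚ.toℚᵘ-fromℚᵘ (mkℚᵘ (k + l) 0))
  (ℚᵘ.≃-trans (ℚᵘ.*≡* (lem k l))
    (ℚᵘ.≃-sym (ℚᵘ.≃-trans (ℚ.toℚᵘ-homo-+ (ι k) (ι l)) (ℚᵘ.+-cong (ℚ.toℚᵘ-fromℚᵘ (mkℚᵘ k 0)) (ℚ.toℚᵘ-fromℚᵘ (mkℚᵘ l 0)))))))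
  where
  lem : ∀ k l → (k + l) * 1ℤ ≡ (k * 1ℤ + l * 1ℤ) * 1ℤ
  lem = solve-∀

ι-* : ∀ k l → ι (k * l) ≡ ι k ℚ.* ι l
ι-* k l = ℚ.toℚᵘ-injective (ℚᵘ.≃-trans (ℚ.toℚᵘ-fromℚᵘ (mkℚᵘ (k * l) 0))
  (ℚᵘ.≃-sym (ℚᵘ.≃-trans (ℚ.toℚᵘ-homo-* (ι k) (ι l)) (ℚᵘ.*-cong (ℚ.toℚᵘ-fromℚᵘ (mkℚᵘ k 0)) (ℚ.toℚᵘ-fromℚᵘ (mkℚᵘ l 0))))))

ι-mono : ∀ {k l} → k ≤ l → ι k ℚ.≤ ι l
ι-mono {k} {l} k≤l = subst₂ ℚ._≤_ (sym (ι-mkℚ k)) (sym (ι-mkℚ l)) (ℚ.*≤* (ℤ.*-monoʳ-≤-nonNeg 1ℤ k≤l))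

ι-cancel : ∀ {k l} → ι k ℚ.≤ ι l → k ≤ l
ι-cancel {k} {l} h = ℤ.*-cancelʳ-≤-pos k l 1ℤ (ℚ.drop-*≤* (subst₂ ℚ._≤_ (ι-mkℚ k) (ι-mkℚ l) h))

ι-∑ : ∀ {A : Set} (xs : List A) (f : A → ℤ) → ι (∑ xs f) ≡ ∑ℚ xs (λ x → ι (f x))
ι-∑ []       f = refl
ι-∑ (x ∷ xs) f = trans (ι-+ (f x) _) (cong (λ u → ι (f x) ℚ.+ u) (ι-∑ xs f))

denominator : ∀ p → p ℚ.* ι (ℚ.↧ p) ≡ ι (ℚ.↥ p)
denominator p = ℚ.toℚᵘ-injective (ℚᵘ.≃-trans (ℚ.toℚᵘ-homo-* p (ι (ℚ.↧ p)))
  (ℚᵘ.≃-trans (ℚᵘ.*-congˡ {ℚ.toℚᵘ p} (ℚ.toℚᵘ-fromℚᵘ (mkℚᵘ (ℚ.↧ p) 0)))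
    (ℚᵘ.≃-trans (eq p) (ℚᵘ.≃-sym (ℚ.toℚᵘ-fromℚᵘ (mkℚᵘ (ℚ.↥ p) 0))))))
  where
  eq : ∀ p → ℚ.toℚᵘ p ℚᵘ.* mkℚᵘ (ℚ.↧ p) 0 ℚᵘ.≃ mkℚᵘ (ℚ.↥ p) 0
  eq (mkℚ n d-1 _) = ℚᵘ.*≡* (trans (ℤ.*-identityʳ _) (cong (λ d → n * + d) (sym (ℕ.*-identityʳ (suc d-1)))))

0<ι : ∀ {k} → 0ℤ ℤ.< k → 0ℚ ℚ.< ι k
0<ι {k} 0<k = subst (0ℚ ℚ.<_) (sym (ι-mkℚ k)) (ℚ.*<* (subst (0ℤ ℤ.<_) (sym (ℤ.*-identityʳ k)) 0<k))

common-denominator : ∀ {A : Set} (f : A → ℚ) (xs : List A) →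
  ∃ λ D → 0ℤ ℤ.< D × (∀ {x} → x ∈ xs → ∃ λ k → f x ℚ.* ι D ≡ ι k)
common-denominator f []       = 1ℤ , ℤ.+<+ (s≤s z≤n) , λ ()
common-denominator f (x ∷ xs) with D , 0<D , integral ← common-denominator f xs =
  D * ℚ.↧ (f x) , positive (f x) , λ
    { (here refl) → ℚ.↥ (f x) * D , (begin
        f x ℚ.* ι (D * ℚ.↧ (f x))           ≡⟨ cong (f x ℚ.*_) (trans (cong ι (ℤ.*-comm D (ℚ.↧ (f x)))) (ι-* (ℚ.↧ (f x)) D)) ⟩
        f x ℚ.* (ι (ℚ.↧ (f x)) ℚ.* ι D)     ≡⟨ ℚ.*-assoc (f x) (ι (ℚ.↧ (f x))) (ι D) ⟨
        f x ℚ.* ι (ℚ.↧ (f x)) ℚ.* ι D       ≡⟨ cong (ℚ._* ι D) (denominator (f x)) ⟩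
        ι (ℚ.↥ (f x)) ℚ.* ι D               ≡⟨ ι-* (ℚ.↥ (f x)) D ⟨
        ι (ℚ.↥ (f x) * D)                   ∎)
    ; {y} (there y∈) → let k , eq = integral y∈ in k * ℚ.↧ (f x) , (begin
        f y ℚ.* ι (D * ℚ.↧ (f x))           ≡⟨ cong (f y ℚ.*_) (ι-* D (ℚ.↧ (f x))) ⟩
        f y ℚ.* (ι D ℚ.* ι (ℚ.↧ (f x)))     ≡⟨ ℚ.*-assoc (f y) (ι D) (ι (ℚ.↧ (f x))) ⟨
        f y ℚ.* ι D ℚ.* ι (ℚ.↧ (f x))       ≡⟨ cong (ℚ._* ι (ℚ.↧ (f x))) eq ⟩
        ι k ℚ.* ι (ℚ.↧ (f x))               ≡⟨ ι-* k (ℚ.↧ (f x)) ⟨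
        ι (k * ℚ.↧ (f x))                   ∎)
    }
  where
  open ≡-Reasoning
  positive : ∀ p → 0ℤ ℤ.< D * ℚ.↧ p
  positive p = ℤ.*-monoʳ-<-pos (ℚ.↧ p) {0ℤ} {D} 0<D

0≤ℚ* : ∀ {p q} → 0ℚ ℚ.≤ p → 0ℚ ℚ.≤ q → 0ℚ ℚ.≤ p ℚ.* q
0≤ℚ* {p} {q} 0≤p 0≤q = subst (ℚ._≤ p ℚ.* q) (ℚ.*-zeroʳ p) (ℚ.*-monoˡ-≤-nonNeg p {{ℚ.nonNegative 0≤p}} 0≤q)

½-double : ∀ p → ½ ℚ.* (p ℚ.+ p) ≡ p
½-double p = trans (ℚ.*-distribˡ-+ ½ p p) (trans (sym (ℚ.*-distribʳ-+ p ½ ½)) (ℚ.*-identityˡ p))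

-- The inequalities for rational families.

module RationalForm (a b : ℕ) (1<a : 1 < a) (a<b : a < b) (coprime : Coprime a b) where
  open Gaps a b 1<a a<b coprime
  open Filling a b 1<a a<b coprime
  open IntegerForm a b 1<a a<b coprime
  open QuadraticBound a b 1<a a<b coprime

  κ : G a b → G a b → ℚ
  κ i j = ι (K a b (γ j - γ i))

  Bℚ : (f f′ : G a b → ℚ) → ℚ
  Bℚ f f′ = ½ ℚ.* ∑ℚ E (λ i → ∑ℚ E (λ j → κ i j ℚ.* (f i ℚ.* f′ j ℚ.+ f′ i ℚ.* f j)))

  ∑∑-*ˡ : ∀ x (F : G a b → G a b → ℚ) → ∑ℚ E (λ i → ∑ℚ E (λ j → x ℚ.* F i j)) ≡ x ℚ.* ∑ℚ E (λ i → ∑ℚ E (F i))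
  ∑∑-*ˡ x F = trans (∑ℚ-cong E (λ i → ∑ℚ-*ˡ E x (F i))) (∑ℚ-*ˡ E x (λ i → ∑ℚ E (F i)))

  ∑∑-+ : ∀ (F F′ : G a b → G a b → ℚ) →
    ∑ℚ E (λ i → ∑ℚ E (λ j → F i j ℚ.+ F′ i j)) ≡ ∑ℚ E (λ i → ∑ℚ E (F i)) ℚ.+ ∑ℚ E (λ i → ∑ℚ E (F′ i))
  ∑∑-+ F F′ = trans (∑ℚ-cong E (λ i → ∑ℚ-+ E (F i) (F′ i))) (∑ℚ-+ E (λ i → ∑ℚ E (F i)) (λ i → ∑ℚ E (F′ i)))

  ∑∑-cong : ∀ {F F′ : G a b → G a b → ℚ} → (∀ i j → F i j ≡ F′ i j) →
    ∑ℚ E (λ i → ∑ℚ E (F i)) ≡ ∑ℚ E (λ i → ∑ℚ E (F′ i))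
  ∑∑-cong h = ∑ℚ-cong E (λ i → ∑ℚ-cong E (h i))

  record RatCone (f : G a b → ℚ) : Set where
    field
      nonNeg : ∀ i → 0ℚ ℚ.≤ f i
      mono   : ∀ i j → X j ≤ X i → Y j ≤ Y i → f i ℚ.≤ f j

  -- Both sides of each inequality scale alike under a positive factor, so an integral multiple of
  -- the family is as good as the family.
  record Scaling (f : G a b → ℚ) : Set where
    field
      cone    : IntCone
      D       : ℤ
      0<D     : 0ℤ ℤ.< D
      scaled  : ∀ i → f i ℚ.* ι D ≡ ι (IntCone.weight cone i)

  module _ {f f′ : G a b → ℚ} (s : Scaling f) (s′ : Scaling f′) where
    private
      module S = Scaling s
      module S′ = Scaling s′
      x = ι S.D
      x′ = ι S′.D
      m = IntCone.weight S.cone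
      m′ = IntCone.weight S′.cone

    Bℚ-scale : (x ℚ.* x′) ℚ.* Bℚ f f′ ≡ ½ ℚ.* ι (Bℤ m m′)
    Bℚ-scale = begin
      (x ℚ.* x′) ℚ.* Bℚ f f′
        ≡⟨ exchange (x ℚ.* x′) ½ S ⟩
      ½ ℚ.* ((x ℚ.* x′) ℚ.* S)
        ≡⟨ cong (½ ℚ.*_) (∑∑-*ˡ (x ℚ.* x′) (λ i j → κ i j ℚ.* (f i ℚ.* f′ j ℚ.+ f′ i ℚ.* f j))) ⟨
      ½ ℚ.* ∑ℚ E (λ i → ∑ℚ E (λ j → (x ℚ.* x′) ℚ.* (κ i j ℚ.* (f i ℚ.* f′ j ℚ.+ f′ i ℚ.* f j))))
        ≡⟨ cong (½ ℚ.*_) (∑∑-cong λ i j → trans (distribute x x′ (κ i j) (f i) (f′ j) (f′ i) (f j))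
             (trans (cong (κ i j ℚ.*_) (cong₂ ℚ._+_ (cong₂ ℚ._*_ (S.scaled i) (S′.scaled j)) (cong₂ ℚ._*_ (S′.scaled i) (S.scaled j))))
               (sym (ι-term (K a b (γ j - γ i)) (m i) (m′ j) (m′ i) (m j))))) ⟩
      ½ ℚ.* ∑ℚ E (λ i → ∑ℚ E (λ j → ι (K a b (γ j - γ i) * (m i * m′ j + m′ i * m j))))
        ≡⟨ cong (½ ℚ.*_) (trans (ι-∑ E (λ i → ∑ E (λ j → K a b (γ j - γ i) * (m i * m′ j + m′ i * m j))))
             (∑ℚ-cong E (λ i → ι-∑ E (λ j → K a b (γ j - γ i) * (m i * m′ j + m′ i * m j))))) ⟨
      ½ ℚ.* ι (Bℤ m m′) ∎
      where
      open ≡-Reasoning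
      S : ℚ
      S = ∑ℚ E (λ i → ∑ℚ E (λ j → κ i j ℚ.* (f i ℚ.* f′ j ℚ.+ f′ i ℚ.* f j)))
      exchange : ∀ p q r → p ℚ.* (q ℚ.* r) ≡ q ℚ.* (p ℚ.* r)
      exchange = solve 3 (λ p q r → p :* (q :* r) := q :* (p :* r)) refl
        where open +-*-Solver
      distribute : ∀ x x′ k u v′ u′ v → (x ℚ.* x′) ℚ.* (k ℚ.* (u ℚ.* v′ ℚ.+ u′ ℚ.* v)) ≡
        k ℚ.* ((u ℚ.* x) ℚ.* (v′ ℚ.* x′) ℚ.+ (u′ ℚ.* x′) ℚ.* (v ℚ.* x))
      distribute = solve 7 (λ x x′ k u v′ u′ v → (x :* x′) :* (k :* (u :* v′ :+ u′ :* v)) :=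
        k :* ((u :* x) :* (v′ :* x′) :+ (u′ :* x′) :* (v :* x))) refl
        where open +-*-Solver
      ι-term : ∀ k p q r s → ι (k * (p * q + r * s)) ≡ ι k ℚ.* (ι p ℚ.* ι q ℚ.+ ι r ℚ.* ι s)
      ι-term k p q r s = trans (ι-* k (p * q + r * s)) (cong (ι k ℚ.*_) (trans (ι-+ (p * q) (r * s)) (cong₂ ℚ._+_ (ι-* p q) (ι-* r s))))

  scaling : ∀ {f} → RatCone f → Scaling f
  scaling {f} f∈C = record
    { cone = record
      { weight = m
      ; nonNeg = λ i → ι-cancel (subst (0ℚ ℚ.≤_) (scaled i) (0≤ℚ* (RatCone.nonNeg f∈C i) 0≤D))
      ; mono   = λ i j x y → ι-cancel (subst₂ ℚ._≤_ (scaled i) (scaled j)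
          (ℚ.*-monoʳ-≤-nonNeg (ι D) {{ℚ.nonNegative 0≤D}} (RatCone.mono f∈C i j x y)))
      }
    ; D = D ; 0<D = 0<D ; scaled = scaled }
    where
    common = common-denominator f E
    D = proj₁ common
    0<D = proj₁ (proj₂ common)
    0≤D : 0ℚ ℚ.≤ ι D
    0≤D = ℚ.<⇒≤ (0<ι 0<D)
    m : G a b → ℤ
    m i = proj₁ (proj₂ (proj₂ common) (∈-elements a b i))
    scaled : ∀ i → f i ℚ.* ι D ≡ ι (m i)
    scaled i = proj₂ (proj₂ (proj₂ common) (∈-elements a b i))

  private
    *-pos : ∀ {p q} → 0ℚ ℚ.< p → 0ℚ ℚ.< q → ℚ.Positive (p ℚ.* q)
    *-pos {p} {q} 0<p 0<q = ℚ.pos*pos⇒pos p {{ℚ.positive 0<p}} q {{ℚ.positive 0<q}}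

  Bℚ-nonNeg : ∀ {f f′} → RatCone f → RatCone f′ → 0ℚ ℚ.≤ Bℚ f f′
  Bℚ-nonNeg {f} {f′} f∈C f′∈C = cleared (scaling f∈C) (scaling f′∈C)
    where
    cleared : Scaling f → Scaling f′ → 0ℚ ℚ.≤ Bℚ f f′
    cleared s s′ = ℚ.*-cancelˡ-≤-pos (ι S.D ℚ.* ι S′.D) {{*-pos (0<ι S.0<D) (0<ι S′.0<D)}}
      (subst₂ ℚ._≤_ (sym (ℚ.*-zeroʳ (ι S.D ℚ.* ι S′.D))) (sym (Bℚ-scale s s′))
        (0≤ℚ* {½} (ℚ.nonNegative⁻¹ ½) (ι-mono (Bℤ-nonNeg S.cone S′.cone))))
      where
      module S = Scaling s
      module S′ = Scaling s′

  Bℚ-bound-scaled : ∀ {f} → Scaling f → f top ℚ.* f top ℚ.≤ ι (+ ∣G∣ a b) ℚ.* Bℚ f f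
  Bℚ-bound-scaled {f} s = ℚ.*-cancelˡ-≤-pos (ι S.D ℚ.* ι S.D) {{*-pos (0<ι S.0<D) (0<ι S.0<D)}}
    (subst₂ ℚ._≤_ left right (ℚ.*-monoˡ-≤-nonNeg ½ (ι-mono (Bℤ-bound S.cone))))
    where
    module S = Scaling s
    open ≡-Reasoning
    M = IntCone.M S.cone
    x = ι S.D
    g′ = ι (+ ∣G∣ a b)
    m = IntCone.weight S.cone
    regroup : ∀ p x → (p ℚ.* x) ℚ.* (p ℚ.* x) ≡ (x ℚ.* x) ℚ.* (p ℚ.* p)
    regroup = solve 2 (λ p x → (p :* x) :* (p :* x) := (x :* x) :* (p :* p)) refl
      where open +-*-Solver
    exchange : ∀ p q r → p ℚ.* (q ℚ.* r) ≡ q ℚ.* (p ℚ.* r)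
    exchange = solve 3 (λ p q r → p :* (q :* r) := q :* (p :* r)) refl
      where open +-*-Solver
    2* : ∀ k → + 2 * k ≡ k + k
    2* = solve-∀
    left : ½ ℚ.* ι (+ 2 * (M * M)) ≡ (x ℚ.* x) ℚ.* (f top ℚ.* f top)
    left = begin
      ½ ℚ.* ι (+ 2 * (M * M))               ≡⟨ cong (½ ℚ.*_) (trans (cong ι (2* (M * M))) (ι-+ (M * M) (M * M))) ⟩
      ½ ℚ.* (ι (M * M) ℚ.+ ι (M * M))       ≡⟨ ½-double (ι (M * M)) ⟩
      ι (M * M)                             ≡⟨ ι-* M M ⟩
      ι M ℚ.* ι M                           ≡⟨ cong₂ ℚ._*_ (S.scaled top) (S.scaled top) ⟨
      (f top ℚ.* x) ℚ.* (f top ℚ.* x)       ≡⟨ regroup (f top) x ⟩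
      (x ℚ.* x) ℚ.* (f top ℚ.* f top)       ∎
    right : ½ ℚ.* ι (+ ∣G∣ a b * Bℤ m m) ≡ (x ℚ.* x) ℚ.* (g′ ℚ.* Bℚ f f)
    right = begin
      ½ ℚ.* ι (+ ∣G∣ a b * Bℤ m m)          ≡⟨ cong (½ ℚ.*_) (ι-* (+ ∣G∣ a b) (Bℤ m m)) ⟩
      ½ ℚ.* (g′ ℚ.* ι (Bℤ m m))             ≡⟨ exchange ½ g′ (ι (Bℤ m m)) ⟩
      g′ ℚ.* (½ ℚ.* ι (Bℤ m m))             ≡⟨ cong (g′ ℚ.*_) (Bℚ-scale s s) ⟨
      g′ ℚ.* ((x ℚ.* x) ℚ.* Bℚ f f)         ≡⟨ exchange g′ (x ℚ.* x) (Bℚ f f) ⟩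
      (x ℚ.* x) ℚ.* (g′ ℚ.* Bℚ f f)         ∎

  Bℚ-bound : ∀ {f} → RatCone f → f top ℚ.* f top ℚ.≤ ι (+ ∣G∣ a b) ℚ.* Bℚ f f
  Bℚ-bound f∈C = Bℚ-bound-scaled (scaling f∈C)

  -- Bilinear expansion, isolating by powers of ε the error made when approximate families are
  -- repaired by adding `ε h`.
  Bℚ-perturb : ∀ r r′ h ε →
    Bℚ (λ i → r i ℚ.+ ε ℚ.* h i) (λ i → r′ i ℚ.+ ε ℚ.* h i) ≡
    Bℚ r r′ ℚ.+ (ε ℚ.* (Bℚ r h ℚ.+ Bℚ h r′) ℚ.+ ε ℚ.* (ε ℚ.* Bℚ h h))
  Bℚ-perturb r r′ h ε = begin
    ½ ℚ.* ∑ℚ E (λ i → ∑ℚ E (F (λ i → r i ℚ.+ ε ℚ.* h i) (λ i → r′ i ℚ.+ ε ℚ.* h i) i))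
      ≡⟨ cong (½ ℚ.*_) (∑∑-cong λ i j → expand (κ i j) ε (r i) (r j) (r′ i) (r′ j) (h i) (h j)) ⟩
    ½ ℚ.* ∑ℚ E (λ i → ∑ℚ E (λ j → F r r′ i j ℚ.+ (ε ℚ.* (F r h i j ℚ.+ F h r′ i j) ℚ.+ (ε ℚ.* ε) ℚ.* F h h i j)))
      ≡⟨ cong (½ ℚ.*_) (trans (∑∑-+ (F r r′) (λ i j → ε ℚ.* (F r h i j ℚ.+ F h r′ i j) ℚ.+ (ε ℚ.* ε) ℚ.* F h h i j))
           (cong (λ u → T r r′ ℚ.+ u) (trans (∑∑-+ (λ i j → ε ℚ.* (F r h i j ℚ.+ F h r′ i j)) (λ i j → (ε ℚ.* ε) ℚ.* F h h i j))
             (cong₂ ℚ._+_ (trans (∑∑-*ˡ ε (λ i j → F r h i j ℚ.+ F h r′ i j)) (cong (ε ℚ.*_) (∑∑-+ (F r h) (F h r′)))) (∑∑-*ˡ (ε ℚ.* ε) (F h h)))))) ⟩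
    ½ ℚ.* (T r r′ ℚ.+ (ε ℚ.* (T r h ℚ.+ T h r′) ℚ.+ (ε ℚ.* ε) ℚ.* T h h))
      ≡⟨ collect ½ ε (T r r′) (T r h) (T h r′) (T h h) ⟩
    Bℚ r r′ ℚ.+ (ε ℚ.* (Bℚ r h ℚ.+ Bℚ h r′) ℚ.+ ε ℚ.* (ε ℚ.* Bℚ h h)) ∎
    where
    open ≡-Reasoning
    F : (f f′ : G a b → ℚ) → G a b → G a b → ℚ
    F f f′ i j = κ i j ℚ.* (f i ℚ.* f′ j ℚ.+ f′ i ℚ.* f j)
    T : (f f′ : G a b → ℚ) → ℚ
    T f f′ = ∑ℚ E (λ i → ∑ℚ E (F f f′ i))
    expand : ∀ k ε ri rj si sj hi hj →
      k ℚ.* ((ri ℚ.+ ε ℚ.* hi) ℚ.* (sj ℚ.+ ε ℚ.* hj) ℚ.+ (si ℚ.+ ε ℚ.* hi) ℚ.* (rj ℚ.+ ε ℚ.* hj)) ≡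
      k ℚ.* (ri ℚ.* sj ℚ.+ si ℚ.* rj) ℚ.+
        (ε ℚ.* (k ℚ.* (ri ℚ.* hj ℚ.+ hi ℚ.* rj) ℚ.+ k ℚ.* (hi ℚ.* sj ℚ.+ si ℚ.* hj)) ℚ.+ (ε ℚ.* ε) ℚ.* (k ℚ.* (hi ℚ.* hj ℚ.+ hi ℚ.* hj)))
    expand = solve 8 (λ k ε ri rj si sj hi hj →
      k :* ((ri :+ ε :* hi) :* (sj :+ ε :* hj) :+ (si :+ ε :* hi) :* (rj :+ ε :* hj)) :=
      k :* (ri :* sj :+ si :* rj) :+
        (ε :* (k :* (ri :* hj :+ hi :* rj) :+ k :* (hi :* sj :+ si :* hj)) :+ (ε :* ε) :* (k :* (hi :* hj :+ hi :* hj)))) refl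
      where open +-*-Solver
    collect : ∀ c ε p q r s → c ℚ.* (p ℚ.+ (ε ℚ.* (q ℚ.+ r) ℚ.+ (ε ℚ.* ε) ℚ.* s)) ≡
      c ℚ.* p ℚ.+ (ε ℚ.* (c ℚ.* q ℚ.+ c ℚ.* r) ℚ.+ ε ℚ.* (ε ℚ.* (c ℚ.* s)))
    collect = solve 6 (λ c ε p q r s → c :* (p :+ (ε :* (q :+ r) :+ (ε :* ε) :* s)) :=
      c :* p :+ (ε :* (c :* q :+ c :* r) :+ ε :* (ε :* (c :* s)))) refl
      where open +-*-Solver

-- Eventual properties and bounds of Cauchy sequences.

Eventually : (ℕ → Set) → Set
Eventually P = ∃ λ N → ∀ k → N ℕ.≤ k → P k

eventually-× : ∀ {P R : ℕ → Set} → Eventually P → Eventually R → Eventually (λ k → P k × R k)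
eventually-× (N , p) (N′ , r) = N ℕ.⊔ N′ , λ k N≤k →
  p k (ℕ.≤-trans (ℕ.m≤m⊔n N N′) N≤k) , r k (ℕ.≤-trans (ℕ.m≤n⊔m N N′) N≤k)

eventually-map : ∀ {P R : ℕ → Set} → (∀ k → P k → R k) → Eventually P → Eventually R
eventually-map f (N , p) = N , λ k N≤k → f k (p k N≤k)

eventually-all : ∀ {A : Set} {P : A → ℕ → Set} (xs : List A) → (∀ x → Eventually (P x)) →
                 Eventually (λ k → ∀ {x} → x ∈ xs → P x k)
eventually-all []       h = 0 , λ _ _ ()
eventually-all (x ∷ xs) h = eventually-map (λ { k (p , ps) (here refl) → p ; k (p , ps) (there x∈) → ps x∈ })
  (eventually-× (h x) (eventually-all xs h))

p≤∣p∣ : ∀ p → p ℚ.≤ ℚ.∣ p ∣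
p≤∣p∣ p with ℚ.≤-total 0ℚ p
... | inj₁ 0≤p = ℚ.≤-reflexive (sym (ℚ.0≤p⇒∣p∣≡p 0≤p))
... | inj₂ p≤0 = ℚ.≤-trans p≤0 (ℚ.0≤∣p∣ p)

∣p∣≤q : ∀ {p q} → p ℚ.≤ q → ℚ.- p ℚ.≤ q → ℚ.∣ p ∣ ℚ.≤ q
∣p∣≤q {p} {q} p≤q -p≤q with ℚ.∣p∣≡p∨∣p∣≡-p p
... | inj₁ e = subst (ℚ._≤ q) (sym e) p≤q
... | inj₂ e = subst (ℚ._≤ q) (sym e) -p≤q

eventually-≤ : ∀ x → ∃ λ C → 0ℚ ℚ.≤ C × Eventually (λ k → seq x k ℚ.≤ C)
eventually-≤ x = C , ℚ.+-mono-≤ (ℚ.0≤∣p∣ (seq x N)) (ℚ.nonNegative⁻¹ 1ℚ) , N , bound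
  where
  N : ℕ
  N = proj₁ (cauchy x 1ℚ (ℚ.positive⁻¹ 1ℚ))
  C : ℚ
  C = ℚ.∣ seq x N ∣ ℚ.+ 1ℚ
  split : ∀ p q → p ≡ q ℚ.+ (p ℚ.- q)
  split = solve 2 (λ p q → p := q :+ (p :- q)) refl
    where open +-*-Solver
  bound : ∀ k → N ℕ.≤ k → seq x k ℚ.≤ C
  bound k N≤k = begin
    seq x k                              ≡⟨ split (seq x k) (seq x N) ⟩
    seq x N ℚ.+ (seq x k ℚ.- seq x N)    ≤⟨ ℚ.+-mono-≤ (p≤∣p∣ (seq x N)) (ℚ.≤-trans (p≤∣p∣ (seq x k ℚ.- seq x N))
                                              (ℚ.<⇒≤ (proj₂ (cauchy x 1ℚ (ℚ.positive⁻¹ 1ℚ)) k N N≤k ℕ.≤-refl))) ⟩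
    C                                    ∎
    where open ℚ.≤-Reasoning

-- Supplies the size of the perturbation. `δ ≤ E` ensures `ε ≤ 1`, by which a term in `ε ε` is
-- bounded by one in ε.
divide : ∀ δ E → 0ℚ ℚ.< δ → δ ℚ.≤ E → ∃ λ ε → 0ℚ ℚ.< ε × ε ℚ.≤ 1ℚ × ε ℚ.* E ≡ δ
divide δ E 0<δ δ≤E = ε , 0<ε , ε≤1 , εE
  where
  0<E : 0ℚ ℚ.< E
  0<E = ℚ.<-≤-trans 0<δ δ≤E
  instance
    E-pos : ℚ.Positive E
    E-pos = ℚ.positive 0<E
    E≢0 : ℚ.NonZero E
    E≢0 = ℚ.pos⇒nonZero E
  ε : ℚ
  ε = δ ℚ.* ℚ.1/ E
  εE : ε ℚ.* E ≡ δ
  εE = trans (ℚ.*-assoc δ (ℚ.1/ E) E) (trans (cong (δ ℚ.*_) (ℚ.*-inverseˡ E)) (ℚ.*-identityʳ δ))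
  0<ε : 0ℚ ℚ.< ε
  0<ε = ℚ.*-cancelʳ-<-nonNeg E {{ℚ.pos⇒nonNeg E}} (subst₂ ℚ._<_ (sym (ℚ.*-zeroˡ E)) (sym εE) 0<δ)
  ε≤1 : ε ℚ.≤ 1ℚ
  ε≤1 = ℚ.*-cancelʳ-≤-pos E (subst₂ ℚ._≤_ (sym εE) (sym (ℚ.*-identityˡ E)) δ≤E)

-- From approximate rational families to real families.

module RealForm (a b : ℕ) (1<a : 1 < a) (a<b : a < b) (coprime : Coprime a b) where
  open Gaps a b 1<a a<b coprime
  open Filling a b 1<a a<b coprime using (E)
  open RationalForm a b 1<a a<b coprime

  seq-ΣG : ∀ F k → seq (ΣG a b F) k ≡ ∑ℚ E (λ i → seq (F i) k)
  seq-ΣG F k = go E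
    where
    go : ∀ xs → seq (foldr _+ℝ_ 0ℝ (map F xs)) k ≡ ∑ℚ xs (λ i → seq (F i) k)
    go []       = refl
    go (x ∷ xs) = cong (λ u → seq (F x) k ℚ.+ u) (go xs)

  seq-ΣΣ : ∀ (F : G a b → G a b → ℝ) k →
    seq (ΣG a b λ i → ΣG a b λ j → F i j) k ≡ ∑ℚ E (λ i → ∑ℚ E (λ j → seq (F i j) k))
  seq-ΣΣ F k = trans (seq-ΣG (λ i → ΣG a b (F i)) k) (∑ℚ-cong E (λ i → seq-ΣG (F i) k))

  at : ℝᴳ a b → ℕ → G a b → ℚ
  at n k i = seq (n i) k

  seq-B : ∀ n n′ k → seq (B a b n n′) k ≡ Bℚ (at n k) (at n′ k)
  seq-B n n′ k = cong (½ ℚ.*_) (seq-ΣΣ (λ i j → fromℤ (K a b (gᴳ a b j - gᴳ a b i)) *ℝ (n i *ℝ n′ j +ℝ n′ i *ℝ n j)) k)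

  seq-Q : ∀ n k → seq (Q a b n) k ≡ Bℚ (at n k) (at n k)
  seq-Q n k = trans (seq-ΣΣ (λ i j → fromℤ (K a b (gᴳ a b j - gᴳ a b i)) *ℝ n i *ℝ n j) k) (sym (trans
    (cong (½ ℚ.*_) (trans (∑∑-cong λ i j → double (κ i j) (at n k i) (at n k j))
      (∑∑-+ (λ i j → κ i j ℚ.* at n k i ℚ.* at n k j) (λ i j → κ i j ℚ.* at n k i ℚ.* at n k j))))
    (½-double _)))
    where
    double : ∀ c p q → c ℚ.* (p ℚ.* q ℚ.+ p ℚ.* q) ≡ c ℚ.* p ℚ.* q ℚ.+ c ℚ.* p ℚ.* q
    double = solve 3 (λ c p q → c :* (p :* q :+ p :* q) := c :* p :* q :+ c :* p :* q) refl
      where open +-*-Solver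

  -- Strictly increasing along the order, with steps ≥ 1 and values ≥ 2, so that adding ε h
  -- to a family satisfying the cone inequalities up to ε makes them hold exactly.
  h : G a b → ℚ
  h i = ι (1ℤ + γ i)

  perturbed : ℚ → (G a b → ℚ) → G a b → ℚ
  perturbed ε r i = r i ℚ.+ ε ℚ.* h i

  -- What the inequalities `≤ℝ` of the cone say about the rational terms at one late index.
  record ApproxCone (ε : ℚ) (r : G a b → ℚ) : Set where
    field
      nonNeg : ∀ i → 0ℚ ℚ.≤ r i ℚ.+ ε
      mono   : ∀ i j → X j ≤ X i → Y j ≤ Y i → r i ℚ.≤ r j ℚ.+ ε

  module _ {ε : ℚ} (0<ε : 0ℚ ℚ.< ε) {r : G a b → ℚ} (r∈C : ApproxCone ε r) where
    open ApproxCone r∈C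

    private
      0≤ε : 0ℚ ℚ.≤ ε
      0≤ε = ℚ.<⇒≤ 0<ε

      -- Since `h ≥ 2`, one ε pays for the slack and another is left over; the surplus bounds
      -- `- r i` in `∣r∣≤perturbed`.
      ε≤perturbed : ∀ i → ε ℚ.≤ perturbed ε r i
      ε≤perturbed i = begin
        ε                              ≡⟨ ℚ.+-identityˡ ε ⟨
        0ℚ ℚ.+ ε                       ≤⟨ ℚ.+-monoˡ-≤ ε (nonNeg i) ⟩
        r i ℚ.+ ε ℚ.+ ε                ≡⟨ twice (r i) ε ⟩
        r i ℚ.+ ε ℚ.* (1ℚ ℚ.+ 1ℚ)      ≤⟨ ℚ.+-monoʳ-≤ (r i) (ℚ.*-monoˡ-≤-nonNeg ε {{ℚ.nonNegative 0≤ε}}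
                                            (ι-mono {+ 2} (ℤ.+-monoʳ-≤ 1ℤ (ℤ.i<j⇒suc[i]≤j (0<γ i))))) ⟩
        perturbed ε r i                ∎
        where
        open ℚ.≤-Reasoning
        twice : ∀ p e → p ℚ.+ e ℚ.+ e ≡ p ℚ.+ e ℚ.* (1ℚ ℚ.+ 1ℚ)
        twice = solve 2 (λ p e → p :+ e :+ e := p :+ e :* (con 1ℚ :+ con 1ℚ)) refl
          where open +-*-Solver

      γ-mono : ∀ i j → X j ≤ X i → Y j ≤ Y i → γ i ≤ γ j
      γ-mono i j x y = ≤-by (0≤+ (0≤* (+≤+ (z≤n {a})) (ℤ.i≤j⇒0≤j-i x)) (0≤* (+≤+ (z≤n {b})) (ℤ.i≤j⇒0≤j-i y)))
        (lem (+ a) (+ b) (X i) (Y i) (X j) (Y j))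
        where
        lem : ∀ a b x y x′ y′ → a * (x - x′) + b * (y - y′) ≡ a * b - a * x′ - b * y′ - (a * b - a * x - b * y)
        lem = solve-∀

    perturbed-cone : RatCone (perturbed ε r)
    perturbed-cone = record { nonNeg = λ i → ℚ.≤-trans 0≤ε (ε≤perturbed i) ; mono = λ i j x y → increasing i j x y (γ i ℤ.≟ γ j) }
      where
      increasing : ∀ i j → X j ≤ X i → Y j ≤ Y i → Dec (γ i ≡ γ j) → perturbed ε r i ℚ.≤ perturbed ε r j
      -- At equal heights `h` has no gain to absorb the slack, but then `i` and `j` coincide.
      increasing i j x y (yes e) = ℚ.≤-reflexive (cong (perturbed ε r) (γ-injective e))
      increasing i j x y (no γ≢) = begin
        r i ℚ.+ ε ℚ.* h i              ≤⟨ ℚ.+-monoˡ-≤ (ε ℚ.* h i) (mono i j x y) ⟩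
        r j ℚ.+ ε ℚ.+ ε ℚ.* h i        ≡⟨ absorb (r j) ε (h i) ⟩
        r j ℚ.+ ε ℚ.* (1ℚ ℚ.+ h i)     ≤⟨ ℚ.+-monoʳ-≤ (r j) (ℚ.*-monoˡ-≤-nonNeg ε {{ℚ.nonNegative 0≤ε}} step) ⟩
        r j ℚ.+ ε ℚ.* h j              ∎
        where
        open ℚ.≤-Reasoning
        absorb : ∀ p e q → p ℚ.+ e ℚ.+ e ℚ.* q ≡ p ℚ.+ e ℚ.* (1ℚ ℚ.+ q)
        absorb = solve 3 (λ p e q → p :+ e :+ e :* q := p :+ e :* (con 1ℚ :+ q)) refl
          where open +-*-Solver
        step : 1ℚ ℚ.+ h i ℚ.≤ h j
        step = subst (ℚ._≤ h j) (ι-+ 1ℤ (1ℤ + γ i)) (ι-mono (ℤ.+-monoʳ-≤ 1ℤ (ℤ.i<j⇒suc[i]≤j (ℤ.≤∧≢⇒< (γ-mono i j x y) γ≢))))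

    ∣r∣≤perturbed : ∀ i → ℚ.∣ r i ∣ ℚ.≤ perturbed ε r i
    ∣r∣≤perturbed i = ∣p∣≤q
      (subst (ℚ._≤ perturbed ε r i) (ℚ.+-identityʳ (r i)) (ℚ.+-monoʳ-≤ (r i) (0≤ℚ* 0≤ε 0≤h)))
      (ℚ.≤-trans (subst₂ ℚ._≤_ (ℚ.+-identityˡ (ℚ.- r i)) (cancel (r i) ε) (ℚ.+-monoˡ-≤ (ℚ.- r i) (nonNeg i))) (ε≤perturbed i))
      where
      0≤h : 0ℚ ℚ.≤ h i
      0≤h = ι-mono {0ℤ} (0≤+ {1ℤ} (+≤+ z≤n) (ℤ.<⇒≤ (0<γ i)))
      cancel : ∀ p e → p ℚ.+ e ℚ.- p ≡ e
      cancel = solve 2 (λ p e → p :+ e :- p := e) refl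
        where open +-*-Solver

  eventually-cone : ∀ n → Cone a b n → ∀ {ε} → 0ℚ ℚ.< ε → Eventually (λ k → ApproxCone ε (at n k))
  eventually-cone n (0≤n , mono) {ε} 0<ε = eventually-map
    (λ k (p , q) → record { nonNeg = λ i → p (∈-elements a b i) ; mono = λ i j → q (∈-elements a b i) (∈-elements a b j) })
    (eventually-× (eventually-all E (λ i → 0≤n i ε 0<ε)) (eventually-all E (λ i → eventually-all E (λ j →
      comparable i j ((X j ℤ.≤? X i) ×-dec (Y j ℤ.≤? Y i))))))
    where
    below : ∀ i j → X j ≤ X i → Y j ≤ Y i → _⪯_ a b i j
    below i j x y = ℤ.∣ X i - X j ∣ , ℤ.∣ Y i - Y j ∣ ,
      trans (lem (+ a) (+ b) (X i) (Y i) (X j) (Y j)) (sym (cong₂ (λ u v → u * + a + v * + b)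
        (ℤ.0≤i⇒+∣i∣≡i (ℤ.i≤j⇒0≤j-i x)) (ℤ.0≤i⇒+∣i∣≡i (ℤ.i≤j⇒0≤j-i y))))
      where
      lem : ∀ a b x y x′ y′ → a * b - a * x′ - b * y′ - (a * b - a * x - b * y) ≡ (x - x′) * a + (y - y′) * b
      lem = solve-∀
    comparable : ∀ i j → Dec (X j ≤ X i × Y j ≤ Y i) →
      Eventually (λ k → X j ≤ X i → Y j ≤ Y i → at n k i ℚ.≤ at n k j ℚ.+ ε)
    comparable i j (yes (x , y)) = eventually-map (λ _ h _ _ → h) (mono i j (below i j x y) ε 0<ε)
    comparable i j (no ¬xy)      = 0 , λ _ _ x y → contradiction (x , y) ¬xy

  Approximation : ℝᴳ a b → ℝᴳ a b → ℚ → ℕ → Set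
  Approximation n n′ δ k = ∃ λ ε → 0ℚ ℚ.< ε × ApproxCone ε (at n k) × ApproxCone ε (at n′ k) ×
    Bℚ (perturbed ε (at n k)) (perturbed ε (at n′ k)) ℚ.≤ Bℚ (at n k) (at n′ k) ℚ.+ δ

  -- The first-order error is ε times the sequence of `Z`, which is eventually bounded because `Z`
  -- is a real number. So one ε serves all late indices `k`.
  approximation : ∀ n n′ → Cone a b n → Cone a b n′ → ∀ {δ} → 0ℚ ℚ.< δ → Eventually (Approximation n n′ δ)
  approximation n n′ n∈C n′∈C {δ} 0<δ = finish (eventually-≤ Z)
    where
    hℝ : ℝᴳ a b
    hℝ i = fromℚ (h i)
    Z : ℝ
    Z = B a b n hℝ +ℝ B a b hℝ n′
    y : ℚ
    y = Bℚ h h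
    finish : (∃ λ C → 0ℚ ℚ.≤ C × Eventually (λ k → seq Z k ℚ.≤ C)) → Eventually (Approximation n n′ δ)
    -- `C` bounds the first-order error and `∣ y ∣` the second-order one; the extra δ makes the
    -- divisor positive and at least δ.
    finish (C , 0≤C , Z≤C) = close (divide δ (C ℚ.+ ℚ.∣ y ∣ ℚ.+ δ) 0<δ
        (subst (ℚ._≤ C ℚ.+ ℚ.∣ y ∣ ℚ.+ δ) (ℚ.+-identityˡ δ) (ℚ.+-monoˡ-≤ δ (ℚ.+-mono-≤ 0≤C (ℚ.0≤∣p∣ y)))))
      where
      close : (∃ λ ε → 0ℚ ℚ.< ε × ε ℚ.≤ 1ℚ × ε ℚ.* (C ℚ.+ ℚ.∣ y ∣ ℚ.+ δ) ≡ δ) → Eventually (Approximation n n′ δ)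
      close (ε , 0<ε , ε≤1 , εE) = eventually-map (λ k (z , c , c′) → ε , 0<ε , c , c′ , estimate k z)
        (eventually-× Z≤C (eventually-× (eventually-cone n n∈C 0<ε) (eventually-cone n′ n′∈C 0<ε)))
        where
        0≤ε : 0ℚ ℚ.≤ ε
        0≤ε = ℚ.<⇒≤ 0<ε
        scale : ∀ {p q} → p ℚ.≤ q → ε ℚ.* p ℚ.≤ ε ℚ.* q
        scale = ℚ.*-monoˡ-≤-nonNeg ε {{ℚ.nonNegative 0≤ε}}
        εy≤∣y∣ : ε ℚ.* y ℚ.≤ ℚ.∣ y ∣
        εy≤∣y∣ = ℚ.≤-trans (scale (p≤∣p∣ y)) (subst (ε ℚ.* ℚ.∣ y ∣ ℚ.≤_) (ℚ.*-identityˡ ℚ.∣ y ∣)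
          (ℚ.*-monoʳ-≤-nonNeg ℚ.∣ y ∣ {{ℚ.∣-∣-nonNeg y}} ε≤1))
        estimate : ∀ k → seq Z k ℚ.≤ C →
          Bℚ (perturbed ε (at n k)) (perturbed ε (at n′ k)) ℚ.≤ Bℚ (at n k) (at n′ k) ℚ.+ δ
        estimate k z≤C = begin
          Bℚ (perturbed ε r) (perturbed ε r′)
            ≡⟨ Bℚ-perturb r r′ h ε ⟩
          Bℚ r r′ ℚ.+ (ε ℚ.* (Bℚ r h ℚ.+ Bℚ h r′) ℚ.+ ε ℚ.* (ε ℚ.* y))
            ≡⟨ cong (λ u → Bℚ r r′ ℚ.+ (ε ℚ.* u ℚ.+ ε ℚ.* (ε ℚ.* y))) (cong₂ ℚ._+_ (seq-B n hℝ k) (seq-B hℝ n′ k)) ⟨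
          Bℚ r r′ ℚ.+ (ε ℚ.* seq Z k ℚ.+ ε ℚ.* (ε ℚ.* y))
            ≤⟨ ℚ.+-monoʳ-≤ (Bℚ r r′) (ℚ.+-mono-≤ (scale z≤C) (scale εy≤∣y∣)) ⟩
          Bℚ r r′ ℚ.+ (ε ℚ.* C ℚ.+ ε ℚ.* ℚ.∣ y ∣)
            ≡⟨ cong (λ u → Bℚ r r′ ℚ.+ u) (ℚ.*-distribˡ-+ ε C ℚ.∣ y ∣) ⟨
          Bℚ r r′ ℚ.+ ε ℚ.* (C ℚ.+ ℚ.∣ y ∣)
            ≤⟨ ℚ.+-monoʳ-≤ (Bℚ r r′) (scale (subst (ℚ._≤ C ℚ.+ ℚ.∣ y ∣ ℚ.+ δ) (ℚ.+-identityʳ (C ℚ.+ ℚ.∣ y ∣)) (ℚ.+-monoʳ-≤ (C ℚ.+ ℚ.∣ y ∣) (ℚ.<⇒≤ 0<δ)))) ⟩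
          Bℚ r r′ ℚ.+ ε ℚ.* (C ℚ.+ ℚ.∣ y ∣ ℚ.+ δ)
            ≡⟨ cong (λ u → Bℚ r r′ ℚ.+ u) εE ⟩
          Bℚ r r′ ℚ.+ δ ∎
          where
          open ℚ.≤-Reasoning
          r r′ : G a b → ℚ
          r = at n k
          r′ = at n′ k

  Bℚ-eventually : ∀ n n′ → Cone a b n → Cone a b n′ → ∀ {δ} → 0ℚ ℚ.< δ →
    Eventually (λ k → 0ℚ ℚ.≤ Bℚ (at n k) (at n′ k) ℚ.+ δ)
  Bℚ-eventually n n′ n∈C n′∈C 0<δ = eventually-map
    (λ k (ε , 0<ε , c , c′ , close) → ℚ.≤-trans (Bℚ-nonNeg (perturbed-cone 0<ε c) (perturbed-cone 0<ε c′)) close)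
    (approximation n n′ n∈C n′∈C 0<δ)

  sup : (G a b → ℚ) → ℚ
  sup r = foldr ℚ._⊔_ 0ℚ (map (λ i → ℚ.∣ r i ∣) E)

  seq-‖‖ : ∀ n k → seq (‖_‖∞ a b n) k ≡ sup (at n k)
  seq-‖‖ n k = go E
    where
    go : ∀ xs → seq (foldr _⊔ℝ_ 0ℝ (map (λ i → ∣ n i ∣ℝ) xs)) k ≡ foldr ℚ._⊔_ 0ℚ (map (λ i → ℚ.∣ at n k i ∣) xs)
    go []       = refl
    go (x ∷ xs) = cong (ℚ.∣ at n k x ∣ ℚ.⊔_) (go xs)

  sup-≤ : ∀ {r C} → 0ℚ ℚ.≤ C → (∀ i → ℚ.∣ r i ∣ ℚ.≤ C) → sup r ℚ.≤ C
  sup-≤ {r} {C} 0≤C r≤C = go E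
    where
    go : ∀ xs → foldr ℚ._⊔_ 0ℚ (map (λ i → ℚ.∣ r i ∣) xs) ℚ.≤ C
    go []       = 0≤C
    go (x ∷ xs) = ℚ.⊔-lub (r≤C x) (go xs)

  0≤sup : ∀ r → 0ℚ ℚ.≤ sup r
  0≤sup r = go E
    where
    go : ∀ xs → 0ℚ ℚ.≤ foldr ℚ._⊔_ 0ℚ (map (λ i → ℚ.∣ r i ∣) xs)
    go []       = ℚ.≤-refl
    go (x ∷ xs) = ℚ.≤-trans (go xs) (ℚ.p≤q⊔p ℚ.∣ r x ∣ _)

  1/∣G∣ℚ : ℚ
  1/∣G∣ℚ = (1ℤ ℚ./ ∣G∣ a b) {{∣G∣-nonZero a b 1<a a<b}}

  1/∣G∣-inverse : 1/∣G∣ℚ ℚ.* ι (+ ∣G∣ a b) ≡ 1ℚ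
  1/∣G∣-inverse = inverse-of (∣G∣ a b) {{∣G∣-nonZero a b 1<a a<b}}
    where
    inverse-of : ∀ g .{{_ : ℕ.NonZero g}} → (1ℤ ℚ./ g) ℚ.* ι (+ g) ≡ 1ℚ
    inverse-of (suc g) = ℚ.toℚᵘ-injective (ℚᵘ.≃-trans (ℚ.toℚᵘ-homo-* (1ℤ ℚ./ suc g) (ι (+ suc g)))
      (ℚᵘ.≃-trans (ℚᵘ.*-cong (ℚ.toℚᵘ-fromℚᵘ (mkℚᵘ 1ℤ g)) (ℚ.toℚᵘ-fromℚᵘ (mkℚᵘ (+ suc g) 0)))
        (ℚᵘ.*≡* (lem (+ suc g)))))
      where
      lem : ∀ g → 1ℤ * g * 1ℤ ≡ 1ℤ * (g * 1ℤ)
      lem = solve-∀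

  0≤1/∣G∣ : 0ℚ ℚ.≤ 1/∣G∣ℚ
  0≤1/∣G∣ = nonNeg-of (∣G∣ a b) {{∣G∣-nonZero a b 1<a a<b}}
    where
    nonNeg-of : ∀ g .{{_ : ℕ.NonZero g}} → 0ℚ ℚ.≤ 1ℤ ℚ./ g
    nonNeg-of g = ℚ.nonNegative⁻¹ (1ℤ ℚ./ g) {{ℚ.normalize-nonNeg 1 g}}

  Bℚ-sup : ∀ n → Cone a b n → ∀ {δ} → 0ℚ ℚ.< δ →
    Eventually (λ k → 1/∣G∣ℚ ℚ.* (sup (at n k) ℚ.* sup (at n k)) ℚ.≤ Bℚ (at n k) (at n k) ℚ.+ δ)
  Bℚ-sup n n∈C {δ} 0<δ = eventually-map (λ k (ε , 0<ε , c , _ , close) → bound k ε 0<ε c close) (approximation n n n∈C n∈C 0<δ)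
    where
    bound : ∀ k ε → 0ℚ ℚ.< ε → ApproxCone ε (at n k) →
      Bℚ (perturbed ε (at n k)) (perturbed ε (at n k)) ℚ.≤ Bℚ (at n k) (at n k) ℚ.+ δ →
      1/∣G∣ℚ ℚ.* (sup (at n k) ℚ.* sup (at n k)) ℚ.≤ Bℚ (at n k) (at n k) ℚ.+ δ
    bound k ε 0<ε c close = begin
      1/∣G∣ℚ ℚ.* (s ℚ.* s)
        ≤⟨ ℚ.*-monoˡ-≤-nonNeg 1/∣G∣ℚ {{ℚ.nonNegative 0≤1/∣G∣}} s²≤f² ⟩
      1/∣G∣ℚ ℚ.* (f top ℚ.* f top)
        ≤⟨ ℚ.*-monoˡ-≤-nonNeg 1/∣G∣ℚ {{ℚ.nonNegative 0≤1/∣G∣}} (Bℚ-bound f∈C) ⟩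
      1/∣G∣ℚ ℚ.* (ι (+ ∣G∣ a b) ℚ.* Bℚ f f)
        ≡⟨ trans (sym (ℚ.*-assoc 1/∣G∣ℚ (ι (+ ∣G∣ a b)) (Bℚ f f))) (trans (cong (ℚ._* Bℚ f f) 1/∣G∣-inverse) (ℚ.*-identityˡ (Bℚ f f))) ⟩
      Bℚ f f
        ≤⟨ close ⟩
      Bℚ (at n k) (at n k) ℚ.+ δ ∎
      where
      open ℚ.≤-Reasoning
      s : ℚ
      s = sup (at n k)
      f : G a b → ℚ
      f = perturbed ε (at n k)
      f∈C : RatCone f
      f∈C = perturbed-cone 0<ε c
      s≤f : s ℚ.≤ f top
      -- Each `∣ r i ∣` is at most the perturbed entry at `i`, and the exact monotonicity of the
      -- perturbed family carries this to `top`.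
      s≤f = sup-≤ (RatCone.nonNeg f∈C top) (λ i → ℚ.≤-trans (∣r∣≤perturbed 0<ε c i) (RatCone.mono f∈C i top (1≤X i) (1≤Y i)))
      s²≤f² : s ℚ.* s ℚ.≤ f top ℚ.* f top
      s²≤f² = ℚ.≤-trans (ℚ.*-monoˡ-≤-nonNeg s {{ℚ.nonNegative (0≤sup (at n k))}} s≤f)
        (ℚ.*-monoʳ-≤-nonNeg (f top) {{ℚ.nonNegative (RatCone.nonNeg f∈C top)}} s≤f)

theorem1p3 : ∀ (a b : ℕ) (1<a : 1 < a) (a<b : a < b) → Coprime a b →
    (∀ (n n′ : ℝᴳ a b) → Cone a b n → Cone a b n′ → 0ℝ ≤ℝ B a b n n′) ×
    (∀ (n : ℝᴳ a b) → Cone a b n → 0ℝ ≤ℝ Q a b n) ×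
    (∀ (n : ℝᴳ a b) → Cone a b n →
      1/∣G∣ a b 1<a a<b *ℝ (‖_‖∞ a b n *ℝ ‖_‖∞ a b n) ≤ℝ Q a b n)
theorem1p3 a b 1<a a<b coprime =
    (λ n n′ n∈C n′∈C δ 0<δ → eventually-map (λ k → subst (λ x → 0ℚ ℚ.≤ x ℚ.+ δ) (sym (seq-B n n′ k)))
      (Bℚ-eventually n n′ n∈C n′∈C 0<δ))
  , (λ n n∈C δ 0<δ → eventually-map (λ k → subst (λ x → 0ℚ ℚ.≤ x ℚ.+ δ) (sym (seq-Q n k)))
      (Bℚ-eventually n n n∈C n∈C 0<δ))
  , (λ n n∈C δ 0<δ → eventually-map (λ k → subst₂ (λ s x → 1/∣G∣ℚ ℚ.* (s ℚ.* s) ℚ.≤ x ℚ.+ δ) (sym (seq-‖‖ n k)) (sym (seq-Q n k)))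
      (Bℚ-sup n n∈C 0<δ))
  where open RealForm a b 1<a a<b coprime
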